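{- Let $P$ be a finite $(3+1)$-free poset, $\alpha=(\alpha_1\ge\alpha_2\ge\cdots\ge\alpha_\ell\ge0)$ a partition, and $\mathbf Z=(Z_1,\dots,Z_\ell)$ lower order ideals of $P$ with $Z_1\subseteq Z_2\subseteq\cdots\subseteq Z_\ell$. Then $$J^P_\alpha(\mathbf Z)\equiv\sum_{T\in\mathrm{SSYT}^{\mathbf Z}_P(\alpha')}\mathbf{u}_{\mathrm{diagword}(T)}\pmod{I^P_{\mathrm{plac}}}.$$
   Context: $a<_Pb$: strict order; $a\sim_Pb$: incomparable or equal. $\mathcal{U}_P=\mathbb{Z}\langle u_a:a\in P\rangle$, $\mathbf u_w=u_{w_1}\cdots u_{w_m}$. For $S\subseteq P$, $e^P_k(\mathbf u_S)=\sum u_{a_1}\cdots u_{a_k}$ over $a_1>_P\cdots>_Pa_k$ in $S$, $e^P_0(\mathbf u_S)=1$, $e^P_k(\mathbf u_S)=0$ for $k<0$ or $k>|S|$. $J^P_\alpha(\mathbf Z)=\sum_{\pi\in S_\ell}\mathrm{sgn}(\pi)\,e^P_{\alpha_1+\pi(1)-1}(\mathbf u_{Z_1})e^P_{\alpha_2+\pi(2)-2}(\mathbf u_{Z_2})\cdots e^P_{\alpha_\ell+\pi(\ell)-\ell}(\mathbf u_{Z_\ell})$. $I^P_{\mathrm{plac}}$ is generated by $u_bu_au_c-u_bu_cu_a$ ($a<_Pb$, $c\not<_Pb$, $a<_Pc$), $u_cu_au_b-u_au_cu_b$ ($b\not<_Pa$, $b<_Pc$, $a<_Pc$), $u_cu_au_b-u_bu_cu_a$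 ($a\sim_Pb$, $b\sim_Pc$, $a<_Pc$). $\alpha'$ denotes the diagram $\{(i,j): j\in[\ell], i\in[\alpha_j]\}$ (column $j$ has height $\alpha_j$; English notation). $\mathrm{SSYT}^{\mathbf Z}_P(\alpha')$ is the set of fillings $T$ of $\alpha'$ by elements of $P$ with $T(1,j)<_PT(2,j)<_P\cdots<_PT(\alpha_j,j)$, $T(r,c+1)\not<_PT(r,c)$ whenever both boxes lie in $\alpha'$, and all entries of column $j$ in $Z_j$. $\mathrm{diagword}(T)$ is obtained by reading each diagonal $\{(r,c): c-r=\text{const}\}$ in the southeast direction (increasing $r$) and concatenating the diagonals starting from the southwesternmost one (smallest $c-r$). -}

module Defs where

open import Data.Bool.Base using (if_then_else_)
open import Data.Fin.Base as Fin using (Fin; toℕ)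
import Data.Fin.Properties as Fin
open import Data.Integer.Base as ℤ using (ℤ; +_; -[1+_]; 0ℤ; 1ℤ; -1ℤ; _⊖_)
import Data.Integer.Properties as ℤ
open import Data.List.Base as List
  using (List; []; _∷_; _++_; map; foldr; filter; length; concatMap;
         cartesianProduct; cartesianProductWith; allFin; upTo)
import Data.List.Properties as List
open import Data.List.Membership.Propositional using (_∈_)
open import Data.List.Relation.Unary.Unique.Propositional using (Unique)
open import Data.Nat.Base as ℕ using (ℕ; suc; _⊔_)
import Data.Nat.Properties as ℕ
open import Data.Product.Base using (Σ-syntax; _×_; _,_)
open import Data.Vec.Base as Vec using (Vec; []; _∷_; lookup; toList)
open import Data.Vec.Relation.Unary.All as All using (All; []; _∷_)
import Data.Vec.Relation.Unary.AllPairs as AllPairs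
open import Data.Vec.Relation.Unary.Linked using (Linked; linked?)
import Data.Vec.Relation.Unary.Unique.Propositional as Vec
open import Level using (0ℓ)
open import Relation.Binary.Core using (Rel)
open import Relation.Binary.Definitions using (DecidableEquality)
open import Relation.Binary.PropositionalEquality.Core using (_≡_)
open import Relation.Binary.Structures using (IsDecStrictPartialOrder)
open import Relation.Nullary.Decidable using (does; ¬?; _×-dec_; _→-dec_)
open import Relation.Nullary.Negation.Core using (¬_)
open import Relation.Unary using (Pred; Decidable)

module FreeAlgebra {A : Set} (_≟_ : DecidableEquality A) where

  infix  4 _≈_
  infixl 6 _+_ _-_
  infixl 7 _*_

  -- A formal sum of terms c · u_w; two formal sums denote the same element
  -- of the algebra when every word has the same total coefficient in both.
  Poly : Set
  Poly = List (ℤ × List A)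

  coeff : Poly → List A → ℤ
  coeff []            w = 0ℤ
  coeff ((c , v) ∷ f) w =
    (if does (List.≡-dec _≟_ v w) then c else 0ℤ) ℤ.+ coeff f w

  _≈_ : Rel Poly 0ℓ
  f ≈ g = ∀ w → coeff f w ≡ coeff g w

  0# 1# : Poly
  0# = []
  1# = (1ℤ , []) ∷ []

  mono : List A → Poly
  mono w = (1ℤ , w) ∷ []

  u : A → Poly
  u a = mono (a ∷ [])

  _·_ : ℤ → Poly → Poly
  c · f = map (λ (d , w) → (c ℤ.* d , w)) f

  _+_ _-_ _*_ : Poly → Poly → Poly
  f + g = f ++ g
  f - g = f + (-1ℤ · g)
  f * g = cartesianProductWith (λ (c , v) (d , w) → (c ℤ.* d , v ++ w)) f g

  ∑ : {B : Set} → List B → (B → Poly) → Poly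
  ∑ xs f = foldr (λ x s → f x + s) 0# xs

  ∏ : {B : Set} → List B → (B → Poly) → Poly
  ∏ xs f = foldr (λ x p → f x * p) 1# xs

  data Ideal (G : Pred Poly 0ℓ) : Pred Poly 0ℓ where
    generator : ∀ {f} → G f → Ideal G f
    zero      : Ideal G 0#
    add       : ∀ {f g} → Ideal G f → Ideal G g → Ideal G (f + g)
    mulˡ      : ∀ h {f} → Ideal G f → Ideal G (h * f)
    mulʳ      : ∀ h {f} → Ideal G f → Ideal G (f * h)
    resp      : ∀ {f g} → f ≈ g → Ideal G f → Ideal G g

  infix 4 _≡_[mod_]
  _≡_[mod_] : Poly → Poly → Pred Poly 0ℓ → Set
  f ≡ g [mod I ] = I (f - g)

vectors : {A : Set} → List A → ∀ k → List (Vec A k)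
vectors xs ℕ.zero  = [] ∷ []
vectors xs (suc k) = cartesianProductWith _∷_ xs (vectors xs k)

-- S_ℓ in one-line notation: entry i of the vector is π(i).
permutations : ∀ ℓ → List (Vec (Fin ℓ) ℓ)
permutations ℓ = filter unique? (vectors (allFin ℓ) ℓ)
  where
  unique? : Decidable (Vec.Unique {A = Fin ℓ} {n = ℓ})
  unique? = AllPairs.allPairs? (λ i j → ¬? (i Fin.≟ j))

inversions : ∀ {ℓ} → Vec (Fin ℓ) ℓ → List (Fin ℓ × Fin ℓ)
inversions {ℓ} π =
  filter (λ (i , j) → (i Fin.<? j) ×-dec (lookup π j Fin.<? lookup π i))
         (cartesianProduct (allFin ℓ) (allFin ℓ))

sgn : ∀ {ℓ} → Vec (Fin ℓ) ℓ → ℤ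
sgn π = -1ℤ ℤ.^ length (inversions π)

IsPartition : ∀ {ℓ} → Vec ℕ ℓ → Set
IsPartition α = ∀ i j → i Fin.≤ j → lookup α j ℕ.≤ lookup α i

-- The diagram α′ as a set of boxes (column , row), both counted from 0.
Box : ∀ {ℓ} → Vec ℕ ℓ → Set
Box {ℓ} α = Σ[ c ∈ Fin ℓ ] Fin (lookup α c)

-- Listed column by column from left to right, hence the boxes of any one
-- diagonal are met in the southeast direction.
boxes : ∀ {ℓ} (α : Vec ℕ ℓ) → List (Box α)
boxes {ℓ} α = concatMap (λ c → map (c ,_) (allFin (lookup α c))) (allFin ℓ)

content : ∀ {ℓ} (α : Vec ℕ ℓ) → Box α → ℤ
content α (c , r) = toℕ c ⊖ toℕ r

-- An interval, in increasing order, containing all contents of boxes of α′.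
diagonals : ∀ {ℓ} → Vec ℕ ℓ → List ℤ
diagonals {ℓ} α = map (_⊖ height) (upTo (height ℕ.+ ℓ))
  where
  height : ℕ
  height = Vec.foldr _ _⊔_ 0 α

diagonal : ∀ {ℓ} (α : Vec ℕ ℓ) → ℤ → List (Box α)
diagonal α d = filter (λ b → content α b ℤ.≟ d) (boxes α)

Filling : Set → ∀ {ℓ} → Vec ℕ ℓ → Set
Filling A α = All (Vec A) α

fillings : {A : Set} → List A → ∀ {ℓ} (α : Vec ℕ ℓ) → List (Filling A α)
fillings xs []      = [] ∷ []
fillings xs (k ∷ α) = cartesianProductWith _∷_ (vectors xs k) (fillings xs α)

column : ∀ {A ℓ} {α : Vec ℕ ℓ} → Filling A α → ∀ c → Vec A (lookup α c)
column (v ∷ T) Fin.zero    = v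
column (v ∷ T) (Fin.suc c) = column T c

entry : ∀ {A ℓ} {α : Vec ℕ ℓ} → Filling A α → Box α → A
entry T (c , r) = lookup (column T c) r

diagword : ∀ {A ℓ} {α : Vec ℕ ℓ} → Filling A α → List A
diagword {α = α} T =
  concatMap (λ d → map (entry T) (diagonal α d)) (diagonals α)

record FinitePoset : Set₁ where
  infix 4 _<_ _∼_
  field
    Carrier                 : Set
    _<_                     : Rel Carrier 0ℓ
    isDecStrictPartialOrder : IsDecStrictPartialOrder _≡_ _<_
    elements                : List Carrier
    elements-unique         : Unique elements
    elements-complete       : ∀ a → a ∈ elements

  open IsDecStrictPartialOrder isDecStrictPartialOrder public
    using (_≟_; _<?_)

  _∼_ : Rel Carrier 0ℓ
  a ∼ b = ¬ (a < b) × ¬ (b < a)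

  IsLowerIdeal : Pred (Pred Carrier 0ℓ) 0ℓ
  IsLowerIdeal Z = ∀ {a b} → a < b → Z b → Z a

  -- No induced 3+1.  An element d with d ∼ a, d ∼ b and d ∼ c is automatically
  -- distinct from a, b and c, as each of these is comparable to another one.
  ThreePlusOneFree : Set
  ThreePlusOneFree =
    ∀ a b c d → a < b → b < c → ¬ (d ∼ a × d ∼ b × d ∼ c)

module _ (P : FinitePoset) where
  open FinitePoset P
  open FreeAlgebra _≟_

  data PlacticGenerator : Pred Poly 0ℓ where
    plac₁ : ∀ {a b c} → a < b → ¬ (c < b) → a < c →
            PlacticGenerator (u b * u a * u c - u b * u c * u a)
    plac₂ : ∀ {a b c} → ¬ (b < a) → b < c → a < c →
            PlacticGenerator (u c * u a * u b - u a * u c * u b)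
    plac₃ : ∀ {a b c} → a ∼ b → b ∼ c → a < c →
            PlacticGenerator (u c * u a * u b - u b * u c * u a)

  I-plac : Pred Poly 0ℓ
  I-plac = Ideal PlacticGenerator

  decreasingWords : {S : Pred Carrier 0ℓ} → Decidable S →
                    ∀ k → List (Vec Carrier k)
  decreasingWords S? k =
    filter (λ w → linked? (λ a b → b <? a) w ×-dec All.all? S? w)
           (vectors elements k)

  -- For k > |S| this is an empty sum.
  e : ℤ → {S : Pred Carrier 0ℓ} → Decidable S → Poly
  e (+ k)    S? = ∑ (decreasingWords S? k) (λ w → mono (toList w))
  e -[1+ _ ] S? = 0#

  J : ∀ {ℓ} → Vec ℕ ℓ →
      {Z : Fin ℓ → Pred Carrier 0ℓ} → (∀ i → Decidable (Z i)) → Poly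
  J {ℓ} α Z? =
    ∑ (permutations ℓ) λ π →
      sgn π · ∏ (allFin ℓ) λ i →
        e (+ lookup α i ℤ.+ + toℕ (lookup π i) ℤ.- + toℕ i) (Z? i)

  record IsSSYT {ℓ} (α : Vec ℕ ℓ) (Z : Fin ℓ → Pred Carrier 0ℓ)
                (T : Filling Carrier α) : Set where
    constructor ssyt
    field
      columns-increasing : ∀ c → Linked _<_ (column T c)
      rows               : ∀ c c′ r r′ → toℕ c′ ≡ suc (toℕ c) → toℕ r′ ≡ toℕ r →
                           ¬ (entry T (c′ , r′) < entry T (c , r))
      columns-in-Z       : ∀ c → All (Z c) (column T c)

  isSSYT? : ∀ {ℓ} (α : Vec ℕ ℓ) {Z : Fin ℓ → Pred Carrier 0ℓ} →
            (∀ i → Decidable (Z i)) → Decidable (IsSSYT α Z)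
  isSSYT? α Z? T =
    Dec.map′
      (λ (p , q , r) → ssyt p q r)
      (λ (ssyt p q r) → p , q , r)
      (Fin.all? (λ c → linked? _<?_ (column T c))
       ×-dec
       Fin.all? (λ c → Fin.all? λ c′ → Fin.all? λ r → Fin.all? λ r′ →
         (toℕ c′ ℕ.≟ suc (toℕ c)) →-dec ((toℕ r′ ℕ.≟ toℕ r) →-dec
         ¬? (entry T (c′ , r′) <? entry T (c , r))))
       ×-dec
       Fin.all? (λ c → All.all? (Z? c) (column T c)))
    where import Relation.Nullary.Decidable as Dec

  SSYT : ∀ {ℓ} (α : Vec ℕ ℓ) {Z : Fin ℓ → Pred Carrier 0ℓ} →
         (∀ i → Decidable (Z i)) → List (Filling Carrier α)
  SSYT α Z? = filter (isSSYT? α Z?) (fillings elements α)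

{-# OPTIONS --safe #-}
-- Idea.  Write E k Z for e_k(u_Z).  In a (3+1)-free poset the plactic
-- relations make E p Z and E q Z commute for every lower ideal Z: remove a
-- maximal element x of Z and sort the remaining chains by how they compare
-- with x.  Hence a row-ordered determinant with two adjacent equal rows
-- vanishes.  Now peel the diagram off diagonal by diagonal, in the order of the
-- diagonal word.  Along a diagonal, column c carries the ideal Y_c of the letters
-- that fit above its last entry; subtracting from the row of column c the row with
-- ideal Y_{c-1} leaves exactly the chains whose top letter does not violate the
-- tableau condition.  The top letters can then be moved to the front by
-- u_b u_a u_c = u_b u_c u_a, and what remains is the determinant for the
-- shape with that diagonal removed.
module Submission where

open import Defs
open import Algebra.Bundles using (Ring)
open import Data.Bool.Base using (Bool; true; false; if_then_else_; _∧_; _∨_; not)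
import Data.Bool.Properties as Bool
open import Data.Empty using (⊥-elim)
open import Data.Fin.Base as Fin using (Fin; toℕ)
import Data.Fin.Properties as Fin
open import Data.Integer.Base as ℤ using (ℤ; +_; -[1+_]; 0ℤ; 1ℤ; -1ℤ; _⊖_)
import Data.Integer.Properties as ℤ
open import Data.List.Base as List using
    (List; []; _∷_; _++_; length; filter; concatMap; cartesianProduct; cartesianProductWith; allFin; tabulate; applyUpTo; upTo)
import Data.List.Properties as List
open import Data.List.Membership.Propositional renaming (_∈_ to _∈ˡ_) using ()
import Data.List.Membership.Propositional.Properties as Membership
open import Data.List.Relation.Binary.Permutation.Propositional as ↭ using (_↭_; ↭-refl; ↭-sym; ↭-trans; prep)
import Data.List.Relation.Binary.Permutation.Propositional.Properties as ↭
open import Data.List.Relation.Binary.Pointwise as Pointwise using (Pointwise; []; _∷_)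
open import Data.List.Relation.Unary.All as LAll using ([]; _∷_)
import Data.List.Relation.Unary.All.Properties as LAll
open import Data.List.Relation.Unary.AllPairs as LAllPairs using ([]; _∷_)
import Data.List.Relation.Unary.AllPairs.Properties as LAllPairs
open import Data.List.Relation.Unary.Any using (here; there)
open import Data.List.Relation.Unary.Unique.Propositional using (Unique)
import Data.List.Relation.Unary.Unique.Propositional.Properties as Unique
open import Data.Maybe.Base using (Maybe; just; nothing; maybe)
open import Data.Nat.Base as ℕ using (ℕ; zero; suc)
open import Data.Nat.Induction using (<-wellFounded)
import Data.Nat.Properties as ℕ
open import Data.Product.Base using (_×_; _,_; proj₁; proj₂; ∃-syntax)
open import Data.Product.Properties using (≡-dec)
open import Data.Sum.Base using (_⊎_; inj₁; inj₂)
open import Data.Unit.Base using (⊤; tt)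
open import Data.Vec.Base as Vec using (Vec; []; _∷_; lookup; toList)
import Data.Vec.Properties as Vec
open import Data.Vec.Relation.Unary.All as VAll using ([]; _∷_)
import Data.Vec.Relation.Unary.AllPairs as VAllPairs
import Data.Vec.Relation.Unary.AllPairs.Core as VAllPairs using ([]; _∷_)
open import Data.Vec.Relation.Unary.Linked as Linked using (Linked; linked?; []; [-]; _∷_)
import Data.Vec.Relation.Unary.Unique.Propositional as VUnique
open import Function.Base using (_∘_)
open import Function.Bundles using (mk⇔)
import Induction.WellFounded as WellFounded
open import Level using (0ℓ)
import Relation.Binary.Construct.On as On
open import Relation.Binary.Definitions using (DecidableEquality)
open import Relation.Binary.PropositionalEquality as ≡ using (_≡_; _≢_)
import Relation.Binary.Reflection
open import Relation.Binary.Structures using (IsDecStrictPartialOrder)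
open import Relation.Nullary.Decidable using (Dec; yes; no; does; dec-true; dec-false; decidable-stable; does-⇔; _×-dec_; ¬?)
open import Relation.Nullary.Negation.Core using (¬_)
open import Relation.Unary using (Pred; Decidable)

-- Diagonals are the right pieces to remove because the degrees agree along them. If column c is
-- filled from row r downwards, r boxes remain and its entry at position p has degree r + p - c. For
-- r = c + m this is m + p in every column, so neighbouring rows differ only in their ideals.
-- Products keep the order of the rows and commutation is available only within one ideal, hence a
-- row is subtracted only from its neighbour.
--
-- The hypothesis on P is used in one form: if z < a < x and c is not below x, then z < c. For
-- tableaux it says that a letter below some element of ↓ x is below everything outside ↓ x.
-- Therefore the tail of a chain lies below the later top letters of its diagonal, which can pass
-- it, and the ideals left for the next diagonal are nested again.
--
-- Above the main diagonal the degrees start at 0, where a chain has no top letter to remove; there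
-- the determinant has to shrink before the next diagonal can be peeled.

module NoncommutativeSolver (R : Ring 0ℓ 0ℓ) where

  open Ring R hiding (zero)
  open import Algebra.Properties.Ring R
  open import Relation.Binary.Reasoning.Setoid setoid

  infixl 6 _:+_ _:-_
  infixl 7 _:*_

  data Expr (n : ℕ) : Set where
    var             : Fin n → Expr n
    _:+_ _:-_ _:*_  : Expr n → Expr n → Expr n
    :0 :1           : Expr n

  ⟦_⟧ : ∀ {n} → Expr n → Vec Carrier n → Carrier
  ⟦ var i  ⟧ ρ = lookup ρ i
  ⟦ a :+ b ⟧ ρ = ⟦ a ⟧ ρ + ⟦ b ⟧ ρ
  ⟦ a :- b ⟧ ρ = ⟦ a ⟧ ρ - ⟦ b ⟧ ρ
  ⟦ a :* b ⟧ ρ = ⟦ a ⟧ ρ * ⟦ b ⟧ ρ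
  ⟦ :0     ⟧ ρ = 0#
  ⟦ :1     ⟧ ρ = 1#

  data Term (n : ℕ) : Set where
    pos neg : List (Fin n) → Term n

  word : ∀ {n} → List (Fin n) → Vec Carrier n → Carrier
  word []      ρ = 1#
  word (i ∷ w) ρ = lookup ρ i * word w ρ

  term : ∀ {n} → Term n → Vec Carrier n → Carrier
  term (pos w) ρ = word w ρ
  term (neg w) ρ = - word w ρ

  -- Normal forms are sorted lists of signed words; a word never occurs with
  -- both signs, and multiplicities are expressed by repetition.
  Normal : ℕ → Set
  Normal n = List (Term n)

  ⟦_⟧ₙ : ∀ {n} → Normal n → Vec Carrier n → Carrier
  ⟦ []    ⟧ₙ ρ = 0#
  ⟦ t ∷ f ⟧ₙ ρ = term t ρ + ⟦ f ⟧ₙ ρ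

  _<ʷ_ : ∀ {n} → List (Fin n) → List (Fin n) → Bool
  _       <ʷ []      = false
  []      <ʷ (_ ∷ _) = true
  (i ∷ v) <ʷ (j ∷ w) =
    if does (i Fin.<? j) then true else if does (j Fin.<? i) then false else v <ʷ w

  support : ∀ {n} → Term n → List (Fin n)
  support (pos w) = w
  support (neg w) = w

  insert : ∀ {n} → Term n → Normal n → Normal n
  -- Called only on terms with the same support. The comparison is repeated so that soundness needs
  -- no equation between the supports.
  cancel : ∀ {n} → Term n → Term n → Normal n → Normal n

  insert s []      = s ∷ []
  insert s (t ∷ f) with List.≡-dec Fin._≟_ (support s) (support t)
  ... | yes _ = cancel s t f
  ... | no  _ = if support s <ʷ support t then s ∷ t ∷ f else t ∷ insert s f

  cancel (pos v) (neg w) f with List.≡-dec Fin._≟_ v w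
  ... | yes _ = f
  ... | no  _ = pos v ∷ neg w ∷ f
  cancel (neg v) (pos w) f with List.≡-dec Fin._≟_ v w
  ... | yes _ = f
  ... | no  _ = neg v ∷ pos w ∷ f
  cancel s       t       f = s ∷ t ∷ f

  negate : ∀ {n} → Term n → Term n
  negate (pos w) = neg w
  negate (neg w) = pos w

  mulTerm : ∀ {n} → Term n → Term n → Term n
  mulTerm (pos v) (pos w) = pos (v ++ w)
  mulTerm (pos v) (neg w) = neg (v ++ w)
  mulTerm (neg v) (pos w) = neg (v ++ w)
  mulTerm (neg v) (neg w) = pos (v ++ w)

  scale : ∀ {n} → Term n → Normal n → Normal n
  scale t []      = []
  scale t (s ∷ f) = insert (mulTerm t s) (scale t f)

  _+ₙ_ _-ₙ_ _*ₙ_ : ∀ {n} → Normal n → Normal n → Normal n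
  []      +ₙ g = g
  (t ∷ f) +ₙ g = insert t (f +ₙ g)
  f -ₙ []      = f
  f -ₙ (t ∷ g) = insert (negate t) (f -ₙ g)
  []      *ₙ g = []
  (t ∷ f) *ₙ g = scale t g +ₙ (f *ₙ g)

  normalise : ∀ {n} → Expr n → Normal n
  normalise (var i)  = pos (i ∷ []) ∷ []
  normalise (a :+ b) = normalise a +ₙ normalise b
  normalise (a :- b) = normalise a -ₙ normalise b
  normalise (a :* b) = normalise a *ₙ normalise b
  normalise :0       = []
  normalise :1       = pos [] ∷ []

  private
    cancel-sound : ∀ {n} (s t : Term n) f ρ →
                   ⟦ cancel s t f ⟧ₙ ρ ≈ term s ρ + (term t ρ + ⟦ f ⟧ₙ ρ)
    cancel-sound (pos v) (neg w) f ρ with List.≡-dec Fin._≟_ v w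
    ... | yes ≡.refl = begin
      ⟦ f ⟧ₙ ρ                              ≈⟨ +-identityˡ _ ⟨
      0# + ⟦ f ⟧ₙ ρ                         ≈⟨ +-congʳ (-‿inverseʳ _) ⟨
      word v ρ - word v ρ + ⟦ f ⟧ₙ ρ        ≈⟨ +-assoc _ _ _ ⟩
      word v ρ + (- word v ρ + ⟦ f ⟧ₙ ρ)    ∎
    ... | no  _ = refl
    cancel-sound (neg v) (pos w) f ρ with List.≡-dec Fin._≟_ v w
    ... | yes ≡.refl = begin
      ⟦ f ⟧ₙ ρ                              ≈⟨ +-identityˡ _ ⟨
      0# + ⟦ f ⟧ₙ ρ                         ≈⟨ +-congʳ (-‿inverseˡ _) ⟨
      - word v ρ + word v ρ + ⟦ f ⟧ₙ ρ      ≈⟨ +-assoc _ _ _ ⟩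
      - word v ρ + (word v ρ + ⟦ f ⟧ₙ ρ)    ∎
    ... | no  _ = refl
    cancel-sound (pos _) (pos _) f ρ = refl
    cancel-sound (neg _) (neg _) f ρ = refl

    +-swap : ∀ a b c → a + (b + c) ≈ b + (a + c)
    +-swap a b c = begin
      a + (b + c) ≈⟨ +-assoc a b c ⟨
      a + b + c   ≈⟨ +-congʳ (+-comm a b) ⟩
      b + a + c   ≈⟨ +-assoc b a c ⟩
      b + (a + c) ∎

    insert-sound : ∀ {n} (s : Term n) f ρ → ⟦ insert s f ⟧ₙ ρ ≈ term s ρ + ⟦ f ⟧ₙ ρ
    insert-sound s []      ρ = refl
    insert-sound s (t ∷ f) ρ with List.≡-dec Fin._≟_ (support s) (support t)
    ... | yes _ = cancel-sound s t f ρ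
    ... | no  _ with support s <ʷ support t
    ...   | true  = refl
    ...   | false = trans (+-congˡ (insert-sound s f ρ)) (+-swap _ _ _)

    word-++ : ∀ {n} (v w : List (Fin n)) ρ → word (v ++ w) ρ ≈ word v ρ * word w ρ
    word-++ []      w ρ = sym (*-identityˡ _)
    word-++ (i ∷ v) w ρ = trans (*-congˡ (word-++ v w ρ)) (sym (*-assoc _ _ _))

    negate-sound : ∀ {n} (t : Term n) ρ → term (negate t) ρ ≈ - term t ρ
    negate-sound (pos w) ρ = refl
    negate-sound (neg w) ρ = sym (-‿involutive _)

    mulTerm-sound : ∀ {n} (s t : Term n) ρ → term (mulTerm s t) ρ ≈ term s ρ * term t ρ
    mulTerm-sound (pos v) (pos w) ρ = word-++ v w ρ
    mulTerm-sound (pos v) (neg w) ρ = trans (-‿cong (word-++ v w ρ)) (-‿distribʳ-* _ _)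
    mulTerm-sound (neg v) (pos w) ρ = trans (-‿cong (word-++ v w ρ)) (-‿distribˡ-* _ _)
    mulTerm-sound (neg v) (neg w) ρ = begin
      word (v ++ w) ρ             ≈⟨ word-++ v w ρ ⟩
      word v ρ * word w ρ         ≈⟨ -‿involutive _ ⟨
      - - (word v ρ * word w ρ)   ≈⟨ -‿cong (-‿distribˡ-* _ _) ⟩
      - (- word v ρ * word w ρ)   ≈⟨ -‿distribʳ-* _ _ ⟩
      - word v ρ * - word w ρ     ∎

    +ₙ-sound : ∀ {n} (f g : Normal n) ρ → ⟦ f +ₙ g ⟧ₙ ρ ≈ ⟦ f ⟧ₙ ρ + ⟦ g ⟧ₙ ρ
    +ₙ-sound []      g ρ = sym (+-identityˡ _)
    +ₙ-sound (t ∷ f) g ρ = begin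
      ⟦ insert t (f +ₙ g) ⟧ₙ ρ             ≈⟨ insert-sound t (f +ₙ g) ρ ⟩
      term t ρ + ⟦ f +ₙ g ⟧ₙ ρ             ≈⟨ +-congˡ (+ₙ-sound f g ρ) ⟩
      term t ρ + (⟦ f ⟧ₙ ρ + ⟦ g ⟧ₙ ρ)     ≈⟨ +-assoc _ _ _ ⟨
      term t ρ + ⟦ f ⟧ₙ ρ + ⟦ g ⟧ₙ ρ       ∎

    -ₙ-sound : ∀ {n} (f g : Normal n) ρ → ⟦ f -ₙ g ⟧ₙ ρ ≈ ⟦ f ⟧ₙ ρ - ⟦ g ⟧ₙ ρ
    -ₙ-sound f []      ρ = trans (sym (+-identityʳ _)) (+-congˡ (sym -0#≈0#))
    -ₙ-sound f (t ∷ g) ρ = begin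
      ⟦ insert (negate t) (f -ₙ g) ⟧ₙ ρ        ≈⟨ insert-sound (negate t) (f -ₙ g) ρ ⟩
      term (negate t) ρ + ⟦ f -ₙ g ⟧ₙ ρ        ≈⟨ +-cong (negate-sound t ρ) (-ₙ-sound f g ρ) ⟩
      - term t ρ + (⟦ f ⟧ₙ ρ - ⟦ g ⟧ₙ ρ)       ≈⟨ +-swap _ _ _ ⟩
      ⟦ f ⟧ₙ ρ + (- term t ρ - ⟦ g ⟧ₙ ρ)       ≈⟨ +-congˡ (-‿+-comm _ _) ⟩
      ⟦ f ⟧ₙ ρ - (term t ρ + ⟦ g ⟧ₙ ρ)         ∎

    scale-sound : ∀ {n} (t : Term n) f ρ → ⟦ scale t f ⟧ₙ ρ ≈ term t ρ * ⟦ f ⟧ₙ ρ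
    scale-sound t []      ρ = sym (zeroʳ _)
    scale-sound t (s ∷ f) ρ =
      trans (insert-sound (mulTerm t s) (scale t f) ρ)
            (trans (+-cong (mulTerm-sound t s ρ) (scale-sound t f ρ)) (sym (distribˡ _ _ _)))

    *ₙ-sound : ∀ {n} (f g : Normal n) ρ → ⟦ f *ₙ g ⟧ₙ ρ ≈ ⟦ f ⟧ₙ ρ * ⟦ g ⟧ₙ ρ
    *ₙ-sound []      g ρ = sym (zeroˡ _)
    *ₙ-sound (t ∷ f) g ρ =
      trans (+ₙ-sound (scale t g) (f *ₙ g) ρ)
            (trans (+-cong (scale-sound t g ρ) (*ₙ-sound f g ρ)) (sym (distribʳ _ _ _)))

    correct : ∀ {n} (a : Expr n) ρ → ⟦ normalise a ⟧ₙ ρ ≈ ⟦ a ⟧ ρ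
    correct (var i)  ρ = trans (+-identityʳ _) (*-identityʳ _)
    correct (a :+ b) ρ = trans (+ₙ-sound (normalise a) (normalise b) ρ) (+-cong (correct a ρ) (correct b ρ))
    correct (a :- b) ρ =
      trans (-ₙ-sound (normalise a) (normalise b) ρ) (+-cong (correct a ρ) (-‿cong (correct b ρ)))
    correct (a :* b) ρ = trans (*ₙ-sound (normalise a) (normalise b) ρ) (*-cong (correct a ρ) (correct b ρ))
    correct :0       ρ = refl
    correct :1       ρ = +-identityʳ _

  open Relation.Binary.Reflection setoid var ⟦_⟧ (λ a → ⟦ normalise a ⟧ₙ) correct public
    using (solve; _⊜_)

-- Finite sums and indicator factors in a ring

module Sums (R : Ring 0ℓ 0ℓ) where

  open Ring R hiding (zero)
  open NoncommutativeSolver R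
  open import Relation.Binary.Reasoning.Setoid setoid

  private variable B C : Set

  sum : List B → (B → Carrier) → Carrier
  sum xs f = List.foldr (λ x s → f x + s) 0# xs

  sum-cong : (xs : List B) {f g : B → Carrier} → (∀ x → f x ≈ g x) → sum xs f ≈ sum xs g
  sum-cong []       f≈g = refl
  sum-cong (x ∷ xs) f≈g = +-cong (f≈g x) (sum-cong xs f≈g)

  sum-zero : (xs : List B) {f : B → Carrier} → (∀ x → f x ≈ 0#) → sum xs f ≈ 0#
  sum-zero []       f≈0 = refl
  sum-zero (x ∷ xs) f≈0 = trans (+-cong (f≈0 x) (sum-zero xs f≈0)) (+-identityˡ 0#)

  sum-+ : (xs : List B) (f g : B → Carrier) → sum xs (λ x → f x + g x) ≈ sum xs f + sum xs g
  sum-+ []       f g = sym (+-identityˡ 0#)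
  sum-+ (x ∷ xs) f g = trans (+-congˡ (sum-+ xs f g))
    (solve 4 (λ a b c d → a :+ b :+ (c :+ d) ⊜ a :+ c :+ (b :+ d)) refl (f x) (g x) (sum xs f) (sum xs g))

  sum-*ˡ : (xs : List B) (y : Carrier) (f : B → Carrier) → y * sum xs f ≈ sum xs (λ x → y * f x)
  sum-*ˡ []       y f = zeroʳ y
  sum-*ˡ (x ∷ xs) y f = trans (distribˡ _ _ _) (+-congˡ (sum-*ˡ xs y f))

  sum-*ʳ : (xs : List B) (y : Carrier) (f : B → Carrier) → sum xs f * y ≈ sum xs (λ x → f x * y)
  sum-*ʳ []       y f = zeroˡ y
  sum-*ʳ (x ∷ xs) y f = trans (distribʳ _ _ _) (+-congˡ (sum-*ʳ xs y f))

  sum-++ : (xs ys : List B) (f : B → Carrier) → sum (xs ++ ys) f ≈ sum xs f + sum ys f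
  sum-++ []       ys f = sym (+-identityˡ _)
  sum-++ (x ∷ xs) ys f = trans (+-congˡ (sum-++ xs ys f)) (sym (+-assoc _ _ _))

  sum-map : (g : B → C) (xs : List B) (f : C → Carrier) → sum (List.map g xs) f ≡ sum xs (f ∘ g)
  sum-map g []       f = ≡.refl
  sum-map g (x ∷ xs) f = ≡.cong (λ s → f (g x) + s) (sum-map g xs f)

  sum-swap : (xs : List B) (ys : List C) (f : B → C → Carrier) →
             sum xs (λ x → sum ys (f x)) ≈ sum ys (λ y → sum xs (λ x → f x y))
  sum-swap []       ys f = sym (sum-zero ys (λ _ → refl))
  sum-swap (x ∷ xs) ys f = trans (+-congˡ (sum-swap xs ys f)) (sym (sum-+ ys (f x) _))

  -- Filtered sums and sums over subsets become sums over a fixed list with this indicator, so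
  -- splitting or comparing subsets never changes the index list.
  guard : Bool → Carrier → Carrier
  guard b x = if b then x else 0#

  guard-cong : ∀ b {x y} → x ≈ y → guard b x ≈ guard b y
  guard-cong true  x≈y = x≈y
  guard-cong false x≈y = refl

  guard-*ˡ : ∀ b x y → x * guard b y ≈ guard b (x * y)
  guard-*ˡ true  x y = refl
  guard-*ˡ false x y = zeroʳ x

  sum-filter : {B : Set} {Q : Pred B 0ℓ} (Q? : Decidable Q) (xs : List B) (f : B → Carrier) →
               sum (filter Q? xs) f ≈ sum xs (λ x → guard (does (Q? x)) (f x))
  sum-filter Q? []       f = refl
  sum-filter Q? (x ∷ xs) f with does (Q? x)
  ... | true  = +-congˡ (sum-filter Q? xs f)
  ... | false = trans (sum-filter Q? xs f) (sym (+-identityˡ _))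

  sum-cartesianProduct : {B C D : Set} (g : B → C → D) (xs : List B) (ys : List C) (f : D → Carrier) →
    sum (cartesianProductWith g xs ys) f ≈ sum xs (λ x → sum ys (λ y → f (g x y)))
  sum-cartesianProduct g []       ys f = refl
  sum-cartesianProduct g (x ∷ xs) ys f = trans (sum-++ (List.map (g x) ys) _ f)
    (+-cong (reflexive (sum-map (g x) ys f)) (sum-cartesianProduct g xs ys f))

-- Subsets and lower ideals of a finite poset

module Ideals (P : FinitePoset) where

  open FinitePoset P renaming (Carrier to A; _<_ to _≺_; _<?_ to _≺?_) public
  open IsDecStrictPartialOrder isDecStrictPartialOrder using () renaming (irrefl to ≺-irrefl; trans to ≺-trans) public

  infix 4 _∈_ _∉_ _⊆_
  infixl 6 _∖_
  infixr 7 _∩_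
  infix 8 ↓_

  -- Boolean-valued, so that membership can serve directly as the indicator in a guarded sum.
  SubsetOf : Set
  SubsetOf = A → Bool

  _∈_ _∉_ : A → SubsetOf → Set
  a ∈ Z = Z a ≡ true
  a ∉ Z = Z a ≡ false

  _⊆_ : SubsetOf → SubsetOf → Set
  G ⊆ F = ∀ {a} → a ∈ G → a ∈ F

  Lower : SubsetOf → Set
  Lower Z = ∀ {a b} → a ≺ b → b ∈ Z → a ∈ Z

  _∖_ _∩_ : SubsetOf → SubsetOf → SubsetOf
  (F ∖ G) a = F a ∧ not (G a)
  (F ∩ G) a = F a ∧ G a

  ↓_ : A → SubsetOf
  (↓ x) a = does (a ≺? x)

  ∈? : ∀ a Z → (a ∈ Z) ⊎ (a ∉ Z)
  ∈? a Z with Z a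
  ... | true  = inj₁ ≡.refl
  ... | false = inj₂ ≡.refl

  ∈∉-absurd : ∀ {a Z} {B : Set} → a ∈ Z → a ∉ Z → B
  ∈∉-absurd p q with ≡.trans (≡.sym p) q
  ... | ()

  ¬∈⇒∉ : ∀ {a} Z → ¬ (a ∈ Z) → a ∉ Z
  ¬∈⇒∉ {a} Z ¬p with ∈? a Z
  ... | inj₁ p = ⊥-elim (¬p p)
  ... | inj₂ q = q

  ∖⁻ : ∀ {a} F G → a ∈ F ∖ G → a ∈ F × a ∉ G
  ∖⁻ {a} F G p with F a | G a
  ∖⁻ F G p | true | false = ≡.refl , ≡.refl

  ∖⁺ : ∀ {a} F G → a ∈ F → a ∉ G → a ∈ F ∖ G
  ∖⁺ F G p q rewrite p | q = ≡.refl

  ∩⁻ : ∀ {a} F G → a ∈ F ∩ G → a ∈ F × a ∈ G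
  ∩⁻ {a} F G p with F a | G a
  ∩⁻ F G p | true | true = ≡.refl , ≡.refl

  ∩⁺ : ∀ {a} F G → a ∈ F → a ∈ G → a ∈ F ∩ G
  ∩⁺ F G p q rewrite p | q = ≡.refl

  ↓⁻ : ∀ {a x} → a ∈ ↓ x → a ≺ x
  ↓⁻ {a} {x} p with a ≺? x
  ... | yes a≺x = a≺x

  ↓⁺ : ∀ {a x} → a ≺ x → a ∈ ↓ x
  ↓⁺ {a} {x} = dec-true (a ≺? x)

  ∉↓⁻ : ∀ {a x} → a ∉ ↓ x → ¬ (a ≺ x)
  ∉↓⁻ {a} {x} q a≺x = ∈∉-absurd {a} {↓ x} (↓⁺ a≺x) q

  ∉↓⁺ : ∀ {a x} → ¬ (a ≺ x) → a ∉ ↓ x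
  ∉↓⁺ {a} {x} = dec-false (a ≺? x)

  ↓-lower : ∀ x → Lower (↓ x)
  ↓-lower x a≺b b∈ = ↓⁺ (≺-trans a≺b (↓⁻ b∈))

  ↓-mono : ∀ {x y} → x ≺ y → ↓ x ⊆ ↓ y
  ↓-mono x≺y a∈ = ↓⁺ (≺-trans (↓⁻ a∈) x≺y)

  ≺-irr : ∀ {x} → ¬ (x ≺ x)
  ≺-irr = ≺-irrefl ≡.refl

  ≐-from-⊆ : ∀ {F G} → F ⊆ G → G ⊆ F → ∀ a → F a ≡ G a
  ≐-from-⊆ {F} {G} p q a with ∈? a F | ∈? a G
  ... | inj₁ f | _      = ≡.trans f (≡.sym (p f))
  ... | inj₂ f | inj₁ g = ∈∉-absurd {a} {F} (q g) f
  ... | inj₂ f | inj₂ g = ≡.trans f (≡.sym g)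

  private
    bit : Bool → ℕ
    bit b = if b then 1 else 0

    countIn : List A → SubsetOf → ℕ
    countIn []       Z = 0
    countIn (a ∷ as) Z = bit (Z a) ℕ.+ countIn as Z

    bit-mono : ∀ {a} F G → G ⊆ F → bit (G a) ℕ.≤ bit (F a)
    bit-mono {a} F G G⊆F with ∈? a G
    ... | inj₁ p rewrite p | G⊆F p = ℕ.≤-refl
    ... | inj₂ q rewrite q = ℕ.z≤n

    countIn-mono : ∀ as F G → G ⊆ F → countIn as G ℕ.≤ countIn as F
    countIn-mono []       F G G⊆F = ℕ.z≤n
    countIn-mono (a ∷ as) F G G⊆F = ℕ.+-mono-≤ (bit-mono F G G⊆F) (countIn-mono as F G G⊆F)

    countIn-strict : ∀ {a} as F G → G ⊆ F → a ∈ˡ as → a ∈ F → a ∉ G → countIn as G ℕ.< countIn as F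
    countIn-strict (_ ∷ as) F G G⊆F (here ≡.refl) p q rewrite p | q = ℕ.s≤s (countIn-mono as F G G⊆F)
    countIn-strict (b ∷ as) F G G⊆F (there i) p q =
      ℕ.+-mono-≤-< (bit-mono F G G⊆F) (countIn-strict as F G G⊆F i p q)

  count : SubsetOf → ℕ
  count = countIn elements

  count-strict : ∀ {a} F G → G ⊆ F → a ∈ F → a ∉ G → count G ℕ.< count F
  count-strict F G G⊆F = countIn-strict elements F G G⊆F (elements-complete _)

  ↓-count : ∀ {x y} → x ≺ y → count (↓ x) ℕ.< count (↓ y)
  ↓-count {x} {y} x≺y = count-strict (↓ y) (↓ x) (↓-mono x≺y) (↓⁺ x≺y) (∉↓⁺ ≺-irr)

  -- The number of elements below x is a rank function: for x ≺ y the set ↓ y contains ↓ x and also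
  -- x itself.
  ≺-rec : (Q : A → Set) → (∀ x → (∀ y → y ≺ x → Q y) → Q x) → ∀ x → Q x
  ≺-rec Q step = WellFounded.All.wfRec (On.wellFounded (count ∘ ↓_) <-wellFounded) 0ℓ Q
                   (λ x rec → step x (λ y y≺x → rec (↓-count y≺x)))

  private
    search : ∀ as Z → (∃[ a ] a ∈ Z) ⊎ (∀ {a} → a ∈ˡ as → a ∉ Z)
    search []       Z = inj₂ λ ()
    search (a ∷ as) Z with ∈? a Z | search as Z
    ... | inj₁ p | _            = inj₁ (a , p)
    ... | inj₂ q | inj₁ found   = inj₁ found
    ... | inj₂ q | inj₂ none    = inj₂ λ { (here ≡.refl) → q ; (there i) → none i }

  inhabited? : ∀ Z → (∃[ a ] a ∈ Z) ⊎ (∀ a → a ∉ Z)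
  inhabited? Z with search elements Z
  ... | inj₁ found = inj₁ found
  ... | inj₂ none  = inj₂ λ a → none (elements-complete a)

  Maximal : A → SubsetOf → Set
  Maximal x Z = x ∈ Z × (∀ {y} → y ∈ Z → ¬ (x ≺ y))

  maximal : ∀ Z {a} → a ∈ Z → ∃[ x ] Maximal x Z
  maximal Z {a} a∈Z = go (count (above a)) a a∈Z ℕ.≤-refl
    where
    ↑_ : A → SubsetOf
    (↑ x) y = does (x ≺? y)
    ↑⁻ : ∀ {x y} → y ∈ ↑ x → x ≺ y
    ↑⁻ {x} {y} p with x ≺? y
    ... | yes x≺y = x≺y
    above : A → SubsetOf
    above x = Z ∩ ↑ x
    above⁻ : ∀ {x y} → y ∈ above x → y ∈ Z × x ≺ y
    above⁻ {x} {y} p = let q , r = ∩⁻ {y} Z (↑ x) p in q , ↑⁻ r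
    above⁺ : ∀ {x y} → y ∈ Z → x ≺ y → y ∈ above x
    above⁺ {x} {y} p q = ∩⁺ {y} Z (↑ x) p (dec-true (x ≺? y) q)
    -- The number n bounds how often one can still climb: the set of elements of Z above x shrinks
    -- at each step.
    go : ∀ n x → x ∈ Z → count (above x) ℕ.≤ n → ∃[ x ] Maximal x Z
    go n x x∈Z bound with inhabited? (above x)
    ... | inj₂ none = x , x∈Z , λ {y} y∈Z x≺y → ∈∉-absurd {y} {above x} (above⁺ y∈Z x≺y) (none y)
    go zero x x∈Z bound | inj₁ (y , y∈) =
      ⊥-elim (ℕ.n≮0 (ℕ.<-≤-trans (count-strict (above x) (λ _ → false) (λ ()) y∈ ≡.refl) bound))
    go (suc n) x x∈Z bound | inj₁ (y , y∈) =
      go n y (proj₁ (above⁻ y∈)) (ℕ.≤-pred (ℕ.≤-trans smaller bound))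
      where
      smaller : count (above y) ℕ.< count (above x)
      smaller = count-strict (above x) (above y)
        (λ z∈ → above⁺ (proj₁ (above⁻ z∈)) (≺-trans (proj₂ (above⁻ y∈)) (proj₂ (above⁻ z∈)))) y∈
        (¬∈⇒∉ (above y) (λ p → ≺-irr (proj₂ (above⁻ p))))

-- Determinants with noncommuting entries

data Sign : Set where
  plus null minus : Sign

infixr 7 _∙_

opposite : Sign → Sign
opposite plus  = minus
opposite null  = null
opposite minus = plus

_∙_ : Sign → Sign → Sign
plus  ∙ t = t
null  ∙ t = null
minus ∙ t = opposite t

∙-comm : ∀ s t → s ∙ t ≡ t ∙ s
∙-comm plus  plus  = ≡.refl
∙-comm plus  null  = ≡.refl
∙-comm plus  minus = ≡.refl
∙-comm null  plus  = ≡.refl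
∙-comm null  null  = ≡.refl
∙-comm null  minus = ≡.refl
∙-comm minus plus  = ≡.refl
∙-comm minus null  = ≡.refl
∙-comm minus minus = ≡.refl

∙-assoc : ∀ s t r → (s ∙ t) ∙ r ≡ s ∙ (t ∙ r)
∙-assoc plus  t     r     = ≡.refl
∙-assoc null  t     r     = ≡.refl
∙-assoc minus plus  r     = ≡.refl
∙-assoc minus null  r     = ≡.refl
∙-assoc minus minus plus  = ≡.refl
∙-assoc minus minus null  = ≡.refl
∙-assoc minus minus minus = ≡.refl

∙-null : ∀ s → s ∙ null ≡ null
∙-null s = ∙-comm s null

∙-swap : ∀ s t r → s ∙ (t ∙ r) ≡ t ∙ (s ∙ r)
∙-swap s t r = ≡.trans (≡.sym (∙-assoc s t r)) (≡.trans (≡.cong (_∙ r) (∙-comm s t)) (∙-assoc t s r))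

-- The sign of q - p. The value `null` at p = q extends the sign of a permutation by zero to all
-- words, so that a determinant becomes a sum over all words and can be expanded row by row.
order : ℕ → ℕ → Sign
order zero    zero    = null
order zero    (suc q) = plus
order (suc p) zero    = minus
order (suc p) (suc q) = order p q

order-refl : ∀ p → order p p ≡ null
order-refl zero    = ≡.refl
order-refl (suc p) = order-refl p

order-anti : ∀ p q → order p q ≡ minus ∙ order q p
order-anti zero    zero    = ≡.refl
order-anti zero    (suc q) = ≡.refl
order-anti (suc p) zero    = ≡.refl
order-anti (suc p) (suc q) = order-anti p q

against : ℕ → List ℕ → Sign
against p []      = plus
against p (q ∷ v) = order p q ∙ against p v

-- The sign of a permutation in one-line notation; null on words with a
-- repeated letter.
ε : List ℕ → Sign
ε []      = plus
ε (p ∷ v) = against p v ∙ ε v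

against-swap : ∀ x v p q w → against x (v ++ p ∷ q ∷ w) ≡ against x (v ++ q ∷ p ∷ w)
against-swap x []      p q w = ∙-swap (order x p) (order x q) _
against-swap x (y ∷ v) p q w = ≡.cong (order x y ∙_) (against-swap x v p q w)

-- Only the pair p, q changes its factor; the other factors are merely reordered, and signs commute.
ε-swap : ∀ v p q w → ε (v ++ p ∷ q ∷ w) ≡ minus ∙ ε (v ++ q ∷ p ∷ w)
ε-swap []      p q w = begin
  (order p q ∙ P) ∙ (Q ∙ ε w)           ≡⟨ ∙-assoc (order p q) P (Q ∙ ε w) ⟩
  order p q ∙ (P ∙ (Q ∙ ε w))           ≡⟨ ≡.cong₂ _∙_ (order-anti p q) (∙-swap P Q (ε w)) ⟩
  (minus ∙ order q p) ∙ (Q ∙ (P ∙ ε w)) ≡⟨ ∙-assoc minus (order q p) _ ⟩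
  minus ∙ (order q p ∙ (Q ∙ (P ∙ ε w))) ≡⟨ ≡.cong (minus ∙_) (∙-assoc (order q p) Q _) ⟨
  minus ∙ ((order q p ∙ Q) ∙ (P ∙ ε w)) ∎
  where
  open ≡.≡-Reasoning
  P = against p w
  Q = against q w
ε-swap (x ∷ v) p q w =
  ≡.trans (≡.cong₂ _∙_ (against-swap x v p q w) (ε-swap v p q w))
    (∙-swap (against x (v ++ q ∷ p ∷ w)) minus (ε (v ++ q ∷ p ∷ w)))

ε-double : ∀ v p w → ε (v ++ p ∷ p ∷ w) ≡ null
ε-double []      p w rewrite order-refl p = ≡.refl
ε-double (x ∷ v) p w = ≡.trans (≡.cong (against x (v ++ p ∷ p ∷ w) ∙_) (ε-double v p w))
    (∙-null (against x (v ++ p ∷ p ∷ w)))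

ε-repeat : ∀ v (i j : Fin (length v)) → i Fin.< j → List.lookup v i ≡ List.lookup v j → ε v ≡ null
ε-repeat (p ∷ v) Fin.zero    (Fin.suc j) _           eq = ≡.cong (_∙ ε v) (against-null v j eq)
  where
  against-null : ∀ v (j : Fin (length v)) → p ≡ List.lookup v j → against p v ≡ null
  against-null (q ∷ v) Fin.zero    ≡.refl = ≡.cong (_∙ against p v) (order-refl p)
  against-null (q ∷ v) (Fin.suc j) eq     = ≡.trans (≡.cong (order p q ∙_) (against-null v j eq)) (∙-null (order p q))
ε-repeat (p ∷ v) (Fin.suc i) (Fin.suc j) (ℕ.s≤s i<j) eq =
  ≡.trans (≡.cong (against p v ∙_) (ε-repeat v i j i<j eq)) (∙-null (against p v))

ε-pigeonhole : ∀ {n} v → LAll.All (ℕ._< n) v → n ℕ.< length v → ε v ≡ null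
ε-pigeonhole {n} v bound n<len =
  let i , j , i<j , eq = Fin.pigeonhole n<len (λ i → Fin.fromℕ< (small i))
  in ε-repeat v i j i<j (≡.trans (≡.sym (Fin.toℕ-fromℕ< (small i)))
                          (≡.trans (≡.cong Fin.toℕ eq) (Fin.toℕ-fromℕ< (small j))))
  where
  small : ∀ i → List.lookup v i ℕ.< n
  small i = LAll.lookup bound (Membership.∈-lookup i)

ε-map-suc : ∀ v → ε (List.map suc v) ≡ ε v
ε-map-suc []      = ≡.refl
ε-map-suc (p ∷ v) = ≡.cong₂ _∙_ (against-suc v) (ε-map-suc v)
  where
  against-suc : ∀ v → against (suc p) (List.map suc v) ≡ against p v
  against-suc []      = ≡.refl
  against-suc (q ∷ v) = ≡.cong (order p q ∙_) (against-suc v)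

-- A leading 0 is in no inversion, and raising all other letters by one preserves their order.
ε-zero : ∀ v → ε (0 ∷ List.map suc v) ≡ ε v
ε-zero v = ≡.trans (≡.cong (_∙ ε (List.map suc v)) (against-zero v)) (ε-map-suc v)
  where
  against-zero : ∀ v → against 0 (List.map suc v) ≡ plus
  against-zero []      = ≡.refl
  against-zero (q ∷ v) = against-zero v

-- Built by shifting, so that removing the letter 0 leaves a shifted copy of a shorter range;
-- inductions that drop a column of the matrix follow this pattern.
range : ℕ → List ℕ
range zero    = []
range (suc n) = 0 ∷ List.map suc (range n)

module Determinants (R : Ring 0ℓ 0ℓ) where

  open Ring R renaming (Carrier to K) hiding (zero)
  open Sums R
  open NoncommutativeSolver R
  open import Algebra.Properties.Ring R
  open import Relation.Binary.Reasoning.Setoid setoid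

  act : Sign → K → K
  act plus  x = x
  act null  x = 0#
  act minus x = - x

  act-minus : ∀ s x → act (minus ∙ s) x ≈ - act s x
  act-minus plus  x = refl
  act-minus null  x = sym -0#≈0#
  act-minus minus x = sym (-‿involutive x)

  Row : Set
  Row = ℕ → K

  _≋_ : List Row → List Row → Set
  _≋_ = Pointwise λ M N → ∀ p → M p ≈ N p

  -- Σ φ(v) M₁(v₁) ⋯ Mₖ(vₖ) over all words v with letters below n.
  expansion : ℕ → List Row → (List ℕ → Sign) → K
  expansion n []       φ = act (φ []) 1#
  expansion n (M ∷ Ms) φ = sum (range n) λ p → M p * expansion n Ms (φ ∘ (p ∷_))

  -- The determinant expanded with the factors of each product in row order.
  det : List Row → K
  det Ms = expansion (length Ms) Ms ε

  expansion-cong : ∀ n {Ms Ns} {φ ψ : List ℕ → Sign} → Ms ≋ Ns → (∀ v → φ v ≡ ψ v) →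
                   expansion n Ms φ ≈ expansion n Ns ψ
  expansion-cong n []            φ≡ψ = reflexive (≡.cong (λ s → act s 1#) (φ≡ψ []))
  expansion-cong n (M≈N ∷ Ms≋Ns) φ≡ψ =
    sum-cong (range n) λ p → *-cong (M≈N p) (expansion-cong n Ms≋Ns (φ≡ψ ∘ (p ∷_)))

  ≋-refl : ∀ {Ms} → Ms ≋ Ms
  ≋-refl = Pointwise.refl (λ _ → refl)

  det-cong : ∀ {Ms Ns} → Ms ≋ Ns → det Ms ≈ det Ns
  det-cong {Ms} {Ns} Ms≋Ns =
    trans (reflexive (≡.cong (λ n → expansion n Ms ε) (Pointwise.Pointwise-length Ms≋Ns)))
          (expansion-cong (length Ns) Ms≋Ns (λ _ → ≡.refl))

  -- The hypothesis is restricted to words that really occur, because the pigeonhole argument needs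
  -- both their length and the bound on their letters.
  expansion-null : ∀ n Ms {φ} → (∀ v → length v ≡ length Ms → LAll.All (ℕ._< n) v → φ v ≡ null) →
                   expansion n Ms φ ≈ 0#
  expansion-null n []       φ≡ = reflexive (≡.cong (λ s → act s 1#) (φ≡ [] ≡.refl []))
  expansion-null n (M ∷ Ms) {φ} φ≡ = go n (λ p → p) (λ p<n → p<n)
    where
    -- Here `f` composes the shifts made so far; its values have to stay below the original n.
    go : ∀ m (f : ℕ → ℕ) → (∀ {p} → p ℕ.< m → f p ℕ.< n) →
         sum (range m) (λ p → M (f p) * expansion n Ms (φ ∘ (f p ∷_))) ≈ 0#
    go zero    f f< = refl
    go (suc m) f f< = trans
      (+-cong (trans (*-congˡ (expansion-null n Ms λ v len bound →
                        φ≡ (f 0 ∷ v) (≡.cong suc len) (f< ℕ.z<s ∷ bound))) (zeroʳ _))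
              (trans (reflexive (sum-map suc (range m) _)) (go m (f ∘ suc) (f< ∘ ℕ.s<s))))
      (+-identityˡ 0#)

  expansion-minus : ∀ n Ms {φ ψ} → (∀ v → φ v ≡ minus ∙ ψ v) → expansion n Ms φ ≈ - expansion n Ms ψ
  expansion-minus n []       {φ} {ψ} φ≡ = trans (reflexive (≡.cong (λ s → act s 1#) (φ≡ []))) (act-minus (ψ []) 1#)
  expansion-minus n (M ∷ Ms) {φ} {ψ} φ≡ = begin
    sum (range n) (λ p → M p * expansion n Ms (φ ∘ (p ∷_)))
      ≈⟨ sum-cong (range n) (λ p → trans (*-congˡ (expansion-minus n Ms (φ≡ ∘ (p ∷_)))) (sym (-‿distribʳ-* _ _))) ⟩
    sum (range n) (λ p → - (M p * expansion n Ms (ψ ∘ (p ∷_))))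
      ≈⟨ sum-neg (range n) _ ⟩
    - sum (range n) (λ p → M p * expansion n Ms (ψ ∘ (p ∷_)))
      ∎
    where
    sum-neg : ∀ (xs : List ℕ) f → sum xs (λ x → - f x) ≈ - sum xs f
    sum-neg []       f = sym -0#≈0#
    sum-neg (x ∷ xs) f = trans (+-congˡ (sum-neg xs f)) (-‿+-comm _ _)

  expansion-+ : ∀ n pre (M N : Row) post φ →
    expansion n (pre ++ (λ p → M p + N p) ∷ post) φ ≈
    expansion n (pre ++ M ∷ post) φ + expansion n (pre ++ N ∷ post) φ
  expansion-+ n []        M N post φ =
    trans (sum-cong (range n) (λ p → distribʳ _ _ _)) (sum-+ (range n) _ _)
  expansion-+ n (L ∷ pre) M N post φ =
    trans (sum-cong (range n) (λ p → trans (*-congˡ (expansion-+ n pre M N post (φ ∘ (p ∷_)))) (distribˡ _ _ _)))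
          (sum-+ (range n) _ _)

  det-+ : ∀ pre (M N : Row) post →
    det (pre ++ (λ p → M p + N p) ∷ post) ≈ det (pre ++ M ∷ post) + det (pre ++ N ∷ post)
  det-+ pre M N post
    rewrite List.length-++ pre {(λ p → M p + N p) ∷ post}
          | List.length-++ pre {M ∷ post} | List.length-++ pre {N ∷ post} =
    expansion-+ _ pre M N post ε

  private
    -- The row and the column of the first index cancel each other. The diagonal has its own
    -- hypothesis since antisymmetry only makes twice a diagonal term zero.
    sum-alternating : (xs : List ℕ) (T : ℕ → ℕ → K) → (∀ p → T p p ≈ 0#) → (∀ p q → T p q + T q p ≈ 0#) →
                      sum xs (λ p → sum xs (T p)) ≈ 0#
    sum-alternating []       T diag anti = refl
    sum-alternating (x ∷ xs) T diag anti = begin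
      T x x + sum xs (T x) + sum xs (λ p → T p x + sum xs (T p))
        ≈⟨ +-cong (+-congʳ (diag x)) (sum-+ xs _ _) ⟩
      0# + sum xs (T x) + (sum xs (λ p → T p x) + sum xs (λ p → sum xs (T p)))
        ≈⟨ +-congˡ (+-congˡ (sum-alternating xs T diag anti)) ⟩
      0# + sum xs (T x) + (sum xs (λ p → T p x) + 0#)
        ≈⟨ solve 2 (λ a b → :0 :+ a :+ (b :+ :0) ⊜ a :+ b) refl _ _ ⟩
      sum xs (T x) + sum xs (λ p → T p x)
        ≈⟨ sum-+ xs _ _ ⟨
      sum xs (λ p → T x p + T p x)
        ≈⟨ sum-zero xs (anti x) ⟩
      0# ∎

  -- The two equal rows stand next to each other in every product, so exchanging their letters
  -- involves only entries of M; the rows before and after keep their places. The conditions on φ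
  -- range over all prefixes so that they survive the choice of letters for `pre`.
  expansion-alternating : ∀ n pre (M : Row) post {φ} → (∀ p q → M p * M q ≈ M q * M p) →
    (∀ v p q w → φ (v ++ p ∷ q ∷ w) ≡ minus ∙ φ (v ++ q ∷ p ∷ w)) →
    (∀ v p w → φ (v ++ p ∷ p ∷ w) ≡ null) →
    expansion n (pre ++ M ∷ M ∷ post) φ ≈ 0#
  expansion-alternating n (L ∷ pre) M post comm swap double =
    sum-zero (range n) λ p → trans
      (*-congˡ (expansion-alternating n pre M post comm (λ v → swap (p ∷ v)) (λ v → double (p ∷ v)))) (zeroʳ _)
  expansion-alternating n [] M post {φ} comm swap double =
    trans (sum-cong (range n) (λ p → sum-*ˡ (range n) (M p) _))
          (sum-alternating (range n) T diag anti)
    where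
    minor : ℕ → ℕ → K
    minor p q = expansion n post (λ w → φ (p ∷ q ∷ w))
    T : ℕ → ℕ → K
    T p q = M p * (M q * minor p q)
    diag : ∀ p → T p p ≈ 0#
    diag p = trans (*-congˡ (*-congˡ (expansion-null n post λ w _ _ → double [] p w)))
                   (solve 1 (λ m → m :* (m :* :0) ⊜ :0) refl _)
    anti : ∀ p q → T p q + T q p ≈ 0#
    anti p q = begin
      M p * (M q * minor p q) + M q * (M p * minor q p)
        ≈⟨ +-congʳ (*-congˡ (*-congˡ (expansion-minus n post (swap [] p q)))) ⟩
      M p * (M q * - minor q p) + M q * (M p * minor q p)
        ≈⟨ solve 4 (λ a b c d → a :* (b :* c) :+ b :* (a :* d) ⊜ a :* b :* c :+ b :* a :* d) refl _ _ _ _ ⟩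
      M p * M q * - minor q p + M q * M p * minor q p
        ≈⟨ +-congʳ (*-congʳ (comm p q)) ⟩
      M q * M p * - minor q p + M q * M p * minor q p
        ≈⟨ distribˡ _ _ _ ⟨
      M q * M p * (- minor q p + minor q p)
        ≈⟨ trans (*-congˡ (-‿inverseˡ _)) (zeroʳ _) ⟩
      0# ∎

  det-alternating : ∀ pre (M : Row) post → (∀ p q → M p * M q ≈ M q * M p) →
                    det (pre ++ M ∷ M ∷ post) ≈ 0#
  det-alternating pre M post comm = expansion-alternating _ pre M post comm ε-swap ε-double

  -- No row can use the letter 0, hence all letters are successors and may be lowered by one.
  expansion-shift : ∀ n Ms φ → LAll.All (λ M → M 0 ≈ 0#) Ms →
    expansion (suc n) Ms φ ≈ expansion n (List.map (_∘ suc) Ms) (φ ∘ List.map suc)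
  expansion-shift n []       φ []            = refl
  expansion-shift n (M ∷ Ms) φ (M0≈0 ∷ rest) = begin
    M 0 * expansion (suc n) Ms (φ ∘ (0 ∷_)) +
      sum (List.map suc (range n)) (λ p → M p * expansion (suc n) Ms (φ ∘ (p ∷_)))
      ≈⟨ +-cong (trans (*-congʳ M0≈0) (zeroˡ _)) (reflexive (sum-map suc (range n) _)) ⟩
    0# + sum (range n) (λ p → M (suc p) * expansion (suc n) Ms (φ ∘ (suc p ∷_)))
      ≈⟨ +-identityˡ _ ⟩
    sum (range n) (λ p → M (suc p) * expansion (suc n) Ms (φ ∘ (suc p ∷_)))
      ≈⟨ sum-cong (range n) (λ p → *-congˡ (expansion-shift n Ms (φ ∘ (suc p ∷_)) rest)) ⟩
    sum (range n) (λ p → M (suc p) * expansion n (List.map (_∘ suc) Ms) (φ ∘ (suc p ∷_) ∘ List.map suc))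
      ∎

  -- Only the first row can use the letter 0. If it uses another letter, all k + 1 letters come from
  -- the k values 1, ..., k, so one repeats and the sign is `null`.
  det-drop : ∀ (M : Row) Ms → LAll.All (λ N → N 0 ≈ 0#) Ms → det (M ∷ Ms) ≈ M 0 * det (List.map (_∘ suc) Ms)
  det-drop M Ms zeros = begin
    M 0 * expansion (suc k) Ms (ε ∘ (0 ∷_)) +
      sum (List.map suc (range k)) (λ p → M p * expansion (suc k) Ms (ε ∘ (p ∷_)))
      ≈⟨ +-cong (*-congˡ (trans (expansion-shift k Ms _ zeros) (expansion-cong k {Ms′} ≋-refl ε-zero)))
                (trans (reflexive (sum-map suc (range k) _)) (sum-small k (λ p → p) (λ p<k → p<k))) ⟩
    M 0 * expansion k Ms′ ε + 0#
      ≈⟨ +-identityʳ _ ⟩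
    M 0 * expansion k Ms′ ε
      ≈⟨ *-congˡ (reflexive (≡.cong (λ m → expansion m Ms′ ε) (List.length-map (_∘ suc) Ms))) ⟨
    M 0 * det Ms′
      ∎
    where
    k = length Ms
    Ms′ = List.map (_∘ suc) Ms
    small : ∀ {p} → p ℕ.< k → expansion (suc k) Ms (ε ∘ (suc p ∷_)) ≈ 0#
    small {p} p<k = trans (expansion-shift k Ms _ zeros) (expansion-null k Ms′ λ v len bound →
      ≡.trans (ε-map-suc (p ∷ v))
        (ε-pigeonhole (p ∷ v) (p<k ∷ bound)
          (ℕ.s≤s (ℕ.≤-reflexive (≡.sym (≡.trans len (List.length-map (_∘ suc) Ms)))))))
    sum-small : ∀ m (f : ℕ → ℕ) → (∀ {p} → p ℕ.< m → f p ℕ.< k) →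
                sum (range m) (λ p → M (suc (f p)) * expansion (suc k) Ms (ε ∘ (suc (f p) ∷_))) ≈ 0#
    sum-small zero    f f< = refl
    sum-small (suc m) f f< = trans
      (+-cong (trans (*-congˡ (small (f< ℕ.z<s))) (zeroʳ _))
              (trans (reflexive (sum-map suc (range m) _)) (sum-small m (f ∘ suc) (f< ∘ ℕ.s<s))))
      (+-identityˡ 0#)

-- The order of the diagonal word

data Inside (r n : ℕ) : Bool → Set where
  inside  : r ℕ.< n → Inside r n true
  outside : n ℕ.≤ r → Inside r n false

-- Matching on this view together with the Boolean reduces the conditionals that contain the
-- comparison and at the same time supplies the inequality.
inside? : ∀ r n → Inside r n (r ℕ.<ᵇ n)
inside? r       zero    = outside ℕ.z≤n
inside? zero    (suc n) = inside ℕ.z<s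
inside? (suc r) (suc n) with r ℕ.<ᵇ n | inside? r n
... | _ | inside r<n  = inside (ℕ.s<s r<n)
... | _ | outside n≤r = outside (ℕ.s≤s n≤r)

-- The boxes (column , row) on the diagonal through (c , r), at most k of them.
cells : (ℕ → ℕ) → ℕ → ℕ → ℕ → List (ℕ × ℕ)
cells α c r zero    = []
cells α c r (suc k) = if does (r ℕ.<? α c) then (c , r) ∷ cells α (suc c) (suc r) k else []

-- Here k counts the columns from c on. The diagonal through (c , 0) itself is excluded, having been
-- read just before.
upper-order : (ℕ → ℕ) → ℕ → ℕ → List (ℕ × ℕ)
upper-order α c zero    = []
upper-order α c (suc k) = cells α (suc c) 0 k ++ upper-order α (suc c) k

-- The boxes in ℓ columns with row < column + m, in the order of the diagonal word.
order-from : (ℕ → ℕ) → ℕ → ℕ → List (ℕ × ℕ)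
order-from α ℓ zero    = upper-order α 0 ℓ
order-from α ℓ (suc m) = cells α 0 m ℓ ++ order-from α ℓ m

-- The reading order: larger content c - r, or equal content and further right. Contents are
-- compared by cross addition to avoid subtraction. It ensures that the boxes against which a letter
-- is tested are not assigned again afterwards.
Later : ℕ × ℕ → ℕ × ℕ → Set
Later (c , r) (c′ , r′) = c ℕ.+ r′ ℕ.< c′ ℕ.+ r ⊎ (c ℕ.+ r′ ≡ c′ ℕ.+ r × c ℕ.< c′)

cells-All : ∀ α {Q : Pred (ℕ × ℕ) 0ℓ} k c r → (∀ j → Q (j ℕ.+ c , j ℕ.+ r)) → LAll.All Q (cells α c r k)
cells-All α zero    c r q = []
cells-All α {Q} (suc k) c r q with r ℕ.<ᵇ α c
... | false = []
... | true  = q 0 ∷ cells-All α k (suc c) (suc r)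
  (λ j → ≡.subst₂ (λ x y → Q (x , y)) (≡.sym (ℕ.+-suc j c)) (≡.sym (ℕ.+-suc j r)) (q (suc j)))

cells-later : ∀ α k c r → LAllPairs.AllPairs Later (cells α c r k)
cells-later α zero    c r = []
cells-later α (suc k) c r with r ℕ.<ᵇ α c
... | false = []
... | true  = cells-All α k (suc c) (suc r) (λ j → inj₂ (same j , ℕ.m≤n+m (suc c) j)) ∷ cells-later α k (suc c) (suc r)
  where
  same : ∀ j → c ℕ.+ (j ℕ.+ suc r) ≡ j ℕ.+ suc c ℕ.+ r
  same j = begin
    c ℕ.+ (j ℕ.+ suc r)    ≡⟨ ≡.cong (c ℕ.+_) (ℕ.+-suc j r) ⟩
    c ℕ.+ suc (j ℕ.+ r)    ≡⟨ ℕ.+-suc c (j ℕ.+ r) ⟩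
    suc (c ℕ.+ (j ℕ.+ r))  ≡⟨ ≡.cong suc (ℕ.+-assoc c j r) ⟨
    suc (c ℕ.+ j ℕ.+ r)    ≡⟨ ≡.cong (λ i → suc (i ℕ.+ r)) (ℕ.+-comm c j) ⟩
    suc (j ℕ.+ c ℕ.+ r)    ≡⟨ ≡.cong (ℕ._+ r) (ℕ.+-suc j c) ⟨
    j ℕ.+ suc c ℕ.+ r      ∎
    where open ≡.≡-Reasoning

upper-order-above : ∀ α k c → LAll.All (λ (c′ , r′) → r′ ℕ.+ c ℕ.< c′) (upper-order α c k)
upper-order-above α zero    c = []
upper-order-above α (suc k) c = LAll.++⁺
  (cells-All α k (suc c) 0 (λ j → ℕ.≤-reflexive
    (≡.trans (≡.cong (λ i → suc (i ℕ.+ c)) (ℕ.+-identityʳ j)) (≡.sym (ℕ.+-suc j c)))))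
  (LAll.map (λ {b} lt → ℕ.<-trans (ℕ.+-monoʳ-< (proj₂ b) (ℕ.n<1+n c)) lt) (upper-order-above α k (suc c)))

upper-order-later : ∀ α k c → LAllPairs.AllPairs Later (upper-order α c k)
upper-order-later α zero    c = []
upper-order-later α (suc k) c = LAllPairs.++⁺ (cells-later α k (suc c) 0) (upper-order-later α k (suc c))
  (cells-All α k (suc c) 0 λ j → LAll.map (λ {b} → separate j b) (upper-order-above α k (suc c)))
  where
  separate : ∀ j b → proj₂ b ℕ.+ suc c ℕ.< proj₁ b → Later (j ℕ.+ suc c , j ℕ.+ 0) b
  separate j (c′ , r′) lt = inj₁ (begin-strict
    j ℕ.+ suc c ℕ.+ r′      ≡⟨ ℕ.+-assoc j (suc c) r′ ⟩
    j ℕ.+ (suc c ℕ.+ r′)    ≡⟨ ≡.cong (j ℕ.+_) (ℕ.+-comm (suc c) r′) ⟩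
    j ℕ.+ (r′ ℕ.+ suc c)    <⟨ ℕ.+-monoʳ-< j lt ⟩
    j ℕ.+ c′                ≡⟨ ℕ.+-comm j c′ ⟩
    c′ ℕ.+ j                ≡⟨ ≡.cong (c′ ℕ.+_) (ℕ.+-identityʳ j) ⟨
    c′ ℕ.+ (j ℕ.+ 0)        ∎)
    where open ℕ.≤-Reasoning

order-from-below : ∀ α ℓ m → LAll.All (λ (c′ , r′) → r′ ℕ.< c′ ℕ.+ m) (order-from α ℓ m)
order-from-below α ℓ zero    = LAll.map
  (λ {b} lt → ≡.subst₂ ℕ._<_ (ℕ.+-identityʳ (proj₂ b)) (≡.sym (ℕ.+-identityʳ (proj₁ b))) lt) (upper-order-above α ℓ 0)
order-from-below α ℓ (suc m) = LAll.++⁺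
  (cells-All α ℓ 0 m (λ j → ℕ.≤-reflexive
    (≡.trans (≡.sym (ℕ.+-suc j m)) (≡.cong (ℕ._+ suc m) (≡.sym (ℕ.+-identityʳ j))))))
  (LAll.map (λ {b} lt → ℕ.<-≤-trans lt (ℕ.+-monoʳ-≤ (proj₁ b) (ℕ.n≤1+n m))) (order-from-below α ℓ m))

order-from-later : ∀ α ℓ m → LAllPairs.AllPairs Later (order-from α ℓ m)
order-from-later α ℓ zero    = upper-order-later α ℓ 0
order-from-later α ℓ (suc m) = LAllPairs.++⁺ (cells-later α ℓ 0 m) (order-from-later α ℓ m)
  (cells-All α ℓ 0 m λ j → LAll.map (λ {b} → separate j b) (order-from-below α ℓ m))
  where
  separate : ∀ j b → proj₂ b ℕ.< proj₁ b ℕ.+ m → Later (j ℕ.+ 0 , j ℕ.+ m) b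
  separate j (c′ , r′) lt = inj₁ (begin-strict
    j ℕ.+ 0 ℕ.+ r′       ≡⟨ ≡.cong (ℕ._+ r′) (ℕ.+-identityʳ j) ⟩
    j ℕ.+ r′             <⟨ ℕ.+-monoʳ-< j lt ⟩
    j ℕ.+ (c′ ℕ.+ m)     ≡⟨ ℕ.+-assoc j c′ m ⟨
    j ℕ.+ c′ ℕ.+ m       ≡⟨ ≡.cong (ℕ._+ m) (ℕ.+-comm j c′) ⟩
    c′ ℕ.+ j ℕ.+ m       ≡⟨ ℕ.+-assoc c′ j m ⟩
    c′ ℕ.+ (j ℕ.+ m)     ∎)
    where open ℕ.≤-Reasoning

shift : ℕ × ℕ → ℕ × ℕ
shift (c , r) = suc c , r

columnBoxes : List ℕ → List (ℕ × ℕ)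
columnBoxes []      = []
columnBoxes (a ∷ α) = List.map (0 ,_) (range a) ++ List.map shift (columnBoxes α)

-- The value 0 beyond the last column keeps the sequence weakly decreasing.
heights : List ℕ → ℕ → ℕ
heights []      c       = 0
heights (a ∷ α) zero    = a
heights (a ∷ α) (suc c) = heights α c

Antitone : List ℕ → Set
Antitone α = ∀ c → heights α (suc c) ℕ.≤ heights α c

-- The content c - r equals n - m. With m the height of the diagram, n is the position in the list
-- of diagonals, whose first content is minus the height.
OnDiagonal : ℕ → ℕ → ℕ × ℕ → Set
OnDiagonal m n (c , r) = c ℕ.+ m ≡ n ℕ.+ r

onDiagonal? : ∀ m n → Decidable (OnDiagonal m n)
onDiagonal? m n (c , r) = (c ℕ.+ m) ℕ.≟ (n ℕ.+ r)

filter-map : ∀ {B C : Set} {Q : Pred C 0ℓ} (Q? : Decidable Q) (f : B → C) xs →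
             filter Q? (List.map f xs) ≡ List.map f (filter (Q? ∘ f) xs)
filter-map Q? f []       = ≡.refl
filter-map Q? f (x ∷ xs) with does (Q? (f x))
... | true  = ≡.cong (f x ∷_) (filter-map Q? f xs)
... | false = filter-map Q? f xs

filter-does : ∀ {B : Set} {Q S : Pred B 0ℓ} (Q? : Decidable Q) (S? : Decidable S) xs →
              (∀ x → does (Q? x) ≡ does (S? x)) → filter Q? xs ≡ filter S? xs
filter-does Q? S? []       eq = ≡.refl
filter-does Q? S? (x ∷ xs) eq with does (Q? x) | does (S? x) | eq x
... | true  | .true  | ≡.refl = ≡.cong (x ∷_) (filter-does Q? S? xs eq)
... | false | .false | ≡.refl = filter-does Q? S? xs eq

filter-none : ∀ {B : Set} {Q : Pred B 0ℓ} (Q? : Decidable Q) xs → (∀ x → ¬ Q x) → filter Q? xs ≡ []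
filter-none Q? xs ¬q = List.filter-none Q? (LAll.universal ¬q xs)

range-filter : ∀ a m {Q : Pred ℕ 0ℓ} (Q? : Decidable Q) → (∀ {r} → Q r → r ≡ m) → Q m →
               filter Q? (range a) ≡ (if does (m ℕ.<? a) then m ∷ [] else [])
range-filter zero    m       Q? only q = ≡.refl
range-filter (suc a) zero    Q? only q with Q? 0
... | yes _ = ≡.cong (0 ∷_) (≡.trans (filter-map Q? suc (range a))
                (≡.cong (List.map suc) (filter-none (Q? ∘ suc) (range a) (λ r q′ → ℕ.1+n≢0 (only q′)))))
... | no ¬q = ⊥-elim (¬q q)
range-filter (suc a) (suc m) Q? only q with Q? 0
... | yes q0 = ⊥-elim (ℕ.0≢1+n (only q0))
... | no _   = ≡.trans (filter-map Q? suc (range a))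
  (≡.trans (≡.cong (List.map suc) (range-filter a m (Q? ∘ suc) (λ q′ → ℕ.suc-injective (only q′)) q)) (map-if (m ℕ.<ᵇ a)))
  where
  map-if : ∀ b → List.map suc (if b then m ∷ [] else []) ≡ (if b then suc m ∷ [] else [])
  map-if true  = ≡.refl
  map-if false = ≡.refl

cells-shift : ∀ a α c r k → List.map shift (cells (heights α) c r k) ≡ cells (heights (a ∷ α)) (suc c) r k
cells-shift a α c r zero    = ≡.refl
cells-shift a α c r (suc k) with r ℕ.<ᵇ heights α c
... | true  = ≡.cong ((suc c , r) ∷_) (cells-shift a α (suc c) (suc r) k)
... | false = ≡.refl

cells-outside : ∀ α c r k → α c ℕ.≤ r → cells α c r k ≡ []
cells-outside α c r zero    α≤r = ≡.refl
cells-outside α c r (suc k) α≤r rewrite dec-false (r ℕ.<? α c) (ℕ.≤⇒≯ α≤r) = ≡.refl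

shifted-diagonal : ∀ α m n → filter (onDiagonal? m n) (List.map shift (columnBoxes α)) ≡
                   List.map shift (filter (onDiagonal? (suc m) n) (columnBoxes α))
shifted-diagonal α m n = ≡.trans (filter-map (onDiagonal? m n) shift (columnBoxes α))
  (≡.cong (List.map shift) (filter-does (onDiagonal? m n ∘ shift) (onDiagonal? (suc m) n) (columnBoxes α)
    (λ (c , r) → ≡.cong (λ i → does (i ℕ.≟ n ℕ.+ r)) (≡.sym (ℕ.+-suc c m)))))

-- The content is -m, so the diagonal enters the first column in row m. Dropping that column raises
-- h and m by one, which is why h has to be arbitrary rather than the height.
lower-diagonal : ∀ α → Antitone α → ∀ h n m → n ℕ.+ m ≡ h →
  filter (onDiagonal? h n) (columnBoxes α) ≡ cells (heights α) 0 m (List.length α)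
lower-diagonal []      dec h n m eq = ≡.refl
lower-diagonal (a ∷ α) dec h n m eq = begin
  filter (onDiagonal? h n) (List.map (0 ,_) (range a) ++ List.map shift (columnBoxes α))
    ≡⟨ List.filter-++ (onDiagonal? h n) (List.map (0 ,_) (range a)) _ ⟩
  filter (onDiagonal? h n) (List.map (0 ,_) (range a)) ++ filter (onDiagonal? h n) (List.map shift (columnBoxes α))
    ≡⟨ ≡.cong₂ _++_ (≡.trans (filter-map (onDiagonal? h n) (0 ,_) (range a))
         (≡.cong (List.map (0 ,_)) (range-filter a m (onDiagonal? h n ∘ (0 ,_))
           (λ {r} q → ℕ.+-cancelˡ-≡ n r m (≡.trans (≡.sym q) (≡.sym eq))) (≡.sym eq))))
       (≡.trans (shifted-diagonal α h n)
         (≡.trans (≡.cong (List.map shift) (lower-diagonal α (dec ∘ suc) (suc h) n (suc m)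
                    (≡.trans (ℕ.+-suc n m) (≡.cong suc eq))))
           (cells-shift a α 0 (suc m) (List.length α)))) ⟩
  List.map (0 ,_) (if m ℕ.<ᵇ a then m ∷ [] else []) ++ cells (heights (a ∷ α)) 1 (suc m) (List.length α)
    ≡⟨ join ⟩
  cells (heights (a ∷ α)) 0 m (suc (List.length α))
    ∎
  where
  open ≡.≡-Reasoning
  join : List.map (0 ,_) (if m ℕ.<ᵇ a then m ∷ [] else []) ++ cells (heights (a ∷ α)) 1 (suc m) (List.length α) ≡
         (if m ℕ.<ᵇ a then (0 , m) ∷ cells (heights (a ∷ α)) 1 (suc m) (List.length α) else [])
  join with m ℕ.<ᵇ a | inside? m a
  ... | _ | inside _    = ≡.refl
  -- The diagonal misses the first column; as heights decrease weakly it misses all later ones too,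
  -- in agreement with `cells`, which stops at the first miss.
  ... | _ | outside a≤m = cells-outside (heights (a ∷ α)) 1 (suc m) (List.length α)
                            (ℕ.≤-trans (dec 0) (ℕ.m≤n⇒m≤1+n a≤m))

upper-diagonal : ∀ α → Antitone α → ∀ h n j → h ℕ.+ j ≡ n →
  filter (onDiagonal? h n) (columnBoxes α) ≡ cells (heights α) j 0 (List.length α ℕ.∸ j)
upper-diagonal α       dec h n zero    eq =
  lower-diagonal α dec h n 0 (≡.trans (ℕ.+-identityʳ n) (≡.trans (≡.sym eq) (ℕ.+-identityʳ h)))
upper-diagonal []      dec h n (suc j) eq = ≡.refl
upper-diagonal (a ∷ α) dec h n (suc j) eq = begin
  filter (onDiagonal? h n) (List.map (0 ,_) (range a) ++ List.map shift (columnBoxes α))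
    ≡⟨ List.filter-++ (onDiagonal? h n) (List.map (0 ,_) (range a)) _ ⟩
  filter (onDiagonal? h n) (List.map (0 ,_) (range a)) ++ filter (onDiagonal? h n) (List.map shift (columnBoxes α))
    ≡⟨ ≡.cong₂ _++_ (≡.trans (filter-map (onDiagonal? h n) (0 ,_) (range a))
         (≡.cong (List.map (0 ,_)) (filter-none (onDiagonal? h n ∘ (0 ,_)) (range a) absent)))
       (≡.trans (shifted-diagonal α h n)
         (≡.cong (List.map shift) (upper-diagonal α (dec ∘ suc) (suc h) n j (≡.trans (≡.sym (ℕ.+-suc h j)) eq)))) ⟩
  List.map shift (cells (heights α) j 0 (List.length α ℕ.∸ j))
    ≡⟨ cells-shift a α j 0 (List.length α ℕ.∸ j) ⟩
  cells (heights (a ∷ α)) (suc j) 0 (List.length α ℕ.∸ j)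
    ∎
  where
  open ≡.≡-Reasoning
  absent : ∀ r → ¬ (h ≡ n ℕ.+ r)
  absent r q = ℕ.<-irrefl q (ℕ.<-≤-trans (≡.subst (h ℕ.<_) eq (ℕ.m<m+n h ℕ.z<s)) (ℕ.m≤m+n n r))

diagonal-at : List ℕ → ℕ → ℕ → List (ℕ × ℕ)
diagonal-at α h n = filter (onDiagonal? h n) (columnBoxes α)

upper-diagonals : ∀ α → Antitone α → ∀ h k c (f : ℕ → ℕ) → (∀ j → f j ≡ h ℕ.+ c ℕ.+ j) → c ℕ.+ k ≡ List.length α →
  concatMap (diagonal-at α h) (applyUpTo f k) ≡ cells (heights α) c 0 k ++ upper-order (heights α) c k
upper-diagonals α dec h zero    c f f≡ eq = ≡.refl
upper-diagonals α dec h (suc k) c f f≡ eq = ≡.cong₂ _++_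
  (≡.trans (upper-diagonal α dec h (f 0) c (≡.trans (≡.sym (ℕ.+-identityʳ _)) (≡.sym (f≡ 0))))
    (≡.cong (cells (heights α) c 0) (≡.trans (≡.cong (ℕ._∸ c) (≡.sym eq)) (ℕ.m+n∸m≡n c (suc k)))))
  (upper-diagonals α dec h k (suc c) (f ∘ suc)
    (λ j → ≡.trans (f≡ (suc j)) (≡.trans (ℕ.+-suc (h ℕ.+ c) j) (≡.cong (ℕ._+ j) (≡.sym (ℕ.+-suc h c)))))
    (≡.trans (≡.sym (ℕ.+-suc c k)) eq))

-- The function `f` enumerates the diagonals still to be read, beginning with n; of these, the first
-- m + 1 start in the first column of the quadrant.
all-diagonals : ∀ α → Antitone α → ∀ h m n (f : ℕ → ℕ) → (∀ j → f j ≡ n ℕ.+ j) → n ℕ.+ m ≡ h →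
  concatMap (diagonal-at α h) (applyUpTo f (m ℕ.+ List.length α)) ≡ order-from (heights α) (List.length α) (suc m)
all-diagonals α dec h zero    n f f≡ eq = upper-diagonals α dec h (List.length α) 0 f
  (λ j → ≡.trans (f≡ j) (≡.cong (ℕ._+ j) (≡.trans (≡.sym (ℕ.+-identityʳ n)) (≡.trans eq (≡.sym (ℕ.+-identityʳ h)))))) ≡.refl
all-diagonals α dec h (suc m) n f f≡ eq = ≡.cong₂ _++_
  (lower-diagonal α dec h (f 0) (suc m) (≡.trans (≡.cong (ℕ._+ suc m) (≡.trans (f≡ 0) (ℕ.+-identityʳ n))) eq))
  (all-diagonals α dec h m (suc n) (f ∘ suc) (λ j → ≡.trans (f≡ (suc j)) (ℕ.+-suc n j)) (≡.trans (≡.sym (ℕ.+-suc n m)) eq))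

filter-complement : ∀ {B : Set} {Q : Pred B 0ℓ} (Q? : Decidable Q) xs →
                    filter Q? xs ++ filter (¬? ∘ Q?) xs ↭ xs
filter-complement Q? []       = ↭-refl
filter-complement Q? (x ∷ xs) with Q? x
... | yes _ = prep x (filter-complement Q? xs)
... | no  _ = ↭-trans (↭.shift x (filter Q? xs) _) (prep x (filter-complement Q? xs))

filter-filter : ∀ {B : Set} {Q S : Pred B 0ℓ} (Q? : Decidable Q) (S? : Decidable S) xs →
                (∀ {x} → S x → Q x) → filter S? xs ≡ filter S? (filter Q? xs)
filter-filter Q? S? []       S⇒Q = ≡.refl
filter-filter Q? S? (x ∷ xs) S⇒Q with S? x in eq | Q? x
... | yes s | no ¬q = ⊥-elim (¬q (S⇒Q s))
... | no  _ | no  _ = filter-filter Q? S? xs S⇒Q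
... | yes _ | yes _ rewrite eq = ≡.cong (x ∷_) (filter-filter Q? S? xs S⇒Q)
... | no  _ | yes _ rewrite eq = filter-filter Q? S? xs S⇒Q

-- Every element lies in exactly one class. Taking out the first class leaves the others unchanged
-- because they are disjoint from it.
classes-↭ : ∀ {B : Set} {Q : ℕ → Pred B 0ℓ} (Q? : ∀ n → Decidable (Q n)) →
  (∀ {m n x} → Q m x → Q n x → m ≡ n) → ∀ ns → Unique ns → ∀ xs →
  LAll.All (λ x → ∃[ n ] n ∈ˡ ns × Q n x) xs → concatMap (λ n → filter (Q? n) xs) ns ↭ xs
classes-↭ Q? functional []       _ []      _ = ↭-refl
classes-↭ Q? functional []       _ (x ∷ xs) ((n , () , _) ∷ _)
classes-↭ {Q = Q} Q? functional (n ∷ ns) (n∉ ∷ unique) xs covered = ↭-trans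
  (↭.++⁺ˡ (filter (Q? n) xs) (↭-trans (↭.↭-reflexive (others ns n∉))
    (classes-↭ Q? functional ns unique rest covered′)))
  (filter-complement (Q? n) xs)
  where
  rest = filter (¬? ∘ Q? n) xs
  others : ∀ ns → LAll.All (n ≢_) ns → concatMap (λ m → filter (Q? m) xs) ns ≡ concatMap (λ m → filter (Q? m) rest) ns
  others []       []           = ≡.refl
  others (m ∷ ns) (n≢m ∷ n≢ns) = ≡.cong₂ _++_
    (filter-filter (¬? ∘ Q? n) (Q? m) xs (λ qm qn → n≢m (functional qn qm))) (others ns n≢ns)
  covered′ : LAll.All (λ x → ∃[ m ] m ∈ˡ ns × Q m x) rest
  covered′ = LAll.map
    (λ { ((_ , here ≡.refl , q) , ¬q) → ⊥-elim (¬q q) ; ((m , there i , q) , _) → m , i , q })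
    (LAll.zip (LAll.filter⁺ (¬? ∘ Q? n) covered , LAll.all-filter (¬? ∘ Q? n) xs))

-- Commuting elementary polynomials

record PlacticMap (P : FinitePoset) (R : Ring 0ℓ 0ℓ) : Set where
  open FinitePoset P using (_∼_) renaming (Carrier to A; _<_ to _≺_)
  open Ring R using (_≈_; _*_)
  field
    u        : A → Ring.Carrier R
    plactic₁ : ∀ {a b c} → a ≺ b → ¬ (c ≺ b) → a ≺ c → u b * u a * u c ≈ u b * u c * u a
    plactic₂ : ∀ {a b c} → ¬ (b ≺ a) → b ≺ c → a ≺ c → u c * u a * u b ≈ u a * u c * u b
    plactic₃ : ∀ {a b c} → a ∼ b → b ∼ c → a ≺ c → u c * u a * u b ≈ u b * u c * u a

-- The argument runs in any ring in which the images of the letters satisfy the plactic relations;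
-- the quotient of the free algebra enters only at the end.
module PlacticRing (P : FinitePoset) (free : FinitePoset.ThreePlusOneFree P)
  (R : Ring 0ℓ 0ℓ) (plactic : PlacticMap P R) where

  open PlacticMap plactic
  open Ring R renaming (Carrier to K) hiding (zero)
  open NoncommutativeSolver R
  open Determinants R
  open Sums R public
  open Ideals P public
  open import Relation.Binary.Reasoning.Setoid setoid

  Σ⟨_⟩ : SubsetOf → (A → K) → K
  Σ⟨ Z ⟩ f = sum elements (λ a → guard (Z a) (f a))

  Σ-cong : ∀ Z {f g} → (∀ {a} → a ∈ Z → f a ≈ g a) → Σ⟨ Z ⟩ f ≈ Σ⟨ Z ⟩ g
  Σ-cong Z {f} {g} f≈g = sum-cong elements pointwise
    where
    pointwise : ∀ a → guard (Z a) (f a) ≈ guard (Z a) (g a)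
    pointwise a with ∈? a Z
    ... | inj₁ p rewrite p = f≈g p
    ... | inj₂ q rewrite q = refl

  Σ-≐ : ∀ {Y Z} f → (∀ a → Y a ≡ Z a) → Σ⟨ Y ⟩ f ≈ Σ⟨ Z ⟩ f
  Σ-≐ f Y≐Z = sum-cong elements λ a → reflexive (≡.cong (λ b → guard b (f a)) (Y≐Z a))

  Σ-+ : ∀ Z f g → Σ⟨ Z ⟩ (λ a → f a + g a) ≈ Σ⟨ Z ⟩ f + Σ⟨ Z ⟩ g
  Σ-+ Z f g = trans (sum-cong elements pointwise) (sum-+ elements _ _)
    where
    pointwise : ∀ a → guard (Z a) (f a + g a) ≈ guard (Z a) (f a) + guard (Z a) (g a)
    pointwise a with Z a
    ... | true  = refl
    ... | false = sym (+-identityˡ 0#)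

  Σ-*ˡ : ∀ Z y f → y * Σ⟨ Z ⟩ f ≈ Σ⟨ Z ⟩ (λ a → y * f a)
  Σ-*ˡ Z y f = trans (sum-*ˡ elements y _) (sum-cong elements pointwise)
    where
    pointwise : ∀ a → y * guard (Z a) (f a) ≈ guard (Z a) (y * f a)
    pointwise a with Z a
    ... | true  = refl
    ... | false = zeroʳ y

  Σ-*ʳ : ∀ Z y f → Σ⟨ Z ⟩ f * y ≈ Σ⟨ Z ⟩ (λ a → f a * y)
  Σ-*ʳ Z y f = trans (sum-*ʳ elements y _) (sum-cong elements pointwise)
    where
    pointwise : ∀ a → guard (Z a) (f a) * y ≈ guard (Z a) (f a * y)
    pointwise a with Z a
    ... | true  = refl
    ... | false = zeroˡ y

  Σ-*ˡʳ : ∀ Z x y f → x * Σ⟨ Z ⟩ f * y ≈ Σ⟨ Z ⟩ (λ a → x * f a * y)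
  Σ-*ˡʳ Z x y f = trans (*-congʳ (Σ-*ˡ Z x f)) (Σ-*ʳ Z y _)

  Σ-zero : ∀ Z {f} → (∀ {a} → a ∈ Z → f a ≈ 0#) → Σ⟨ Z ⟩ f ≈ 0#
  Σ-zero Z {f} f≈0 = sum-zero elements pointwise
    where
    pointwise : ∀ a → guard (Z a) (f a) ≈ 0#
    pointwise a with ∈? a Z
    ... | inj₁ p rewrite p = f≈0 p
    ... | inj₂ q rewrite q = refl

  Σ-split : ∀ F G f → G ⊆ F → Σ⟨ F ⟩ f ≈ Σ⟨ G ⟩ f + Σ⟨ F ∖ G ⟩ f
  Σ-split F G f G⊆F = trans (sum-cong elements pointwise) (sum-+ elements _ _)
    where
    pointwise : ∀ a → guard (F a) (f a) ≈ guard (G a) (f a) + guard (F a ∧ not (G a)) (f a)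
    pointwise a with ∈? a G
    ... | inj₁ p rewrite p | G⊆F p = sym (+-identityʳ _)
    ... | inj₂ q rewrite q with F a
    ...   | true  = sym (+-identityˡ _)
    ...   | false = sym (+-identityˡ _)

  Σ-single : ∀ {Z x} f → x ∈ Z → (∀ {a} → a ∈ Z → a ≡ x) → Σ⟨ Z ⟩ f ≈ f x
  Σ-single {Z} {x} f x∈Z only = go elements elements-unique (elements-complete x)
    where
    absent : ∀ as → LAll.All (x ≢_) as → sum as (λ a → guard (Z a) (f a)) ≈ 0#
    absent []       []         = refl
    absent (a ∷ as) (x≢a ∷ ps)
      rewrite ¬∈⇒∉ {a} Z (λ p → x≢a (≡.sym (only p))) = trans (+-identityˡ _) (absent as ps)
    go : ∀ as → Unique as → x ∈ˡ as → sum as (λ a → guard (Z a) (f a)) ≈ f x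
    go (a ∷ as) (x∉ ∷ _) (here ≡.refl) rewrite x∈Z = trans (+-congˡ (absent as x∉)) (+-identityʳ _)
    go (a ∷ as) (a∉ ∷ unique) (there i)
      rewrite ¬∈⇒∉ {a} Z (λ p → LAll.lookup a∉ i (only p)) = trans (+-identityˡ _) (go as unique i)

  -- For a lower ideal Z this is e_k(u_Z): below its largest letter a, a
  -- decreasing word in Z is an arbitrary decreasing word in ↓ a.
  E : ℕ → SubsetOf → K
  E zero    Z = 1#
  E (suc k) Z = Σ⟨ Z ⟩ λ a → u a * E k (↓ a)

  -- The part of `E k` formed by words with largest letter a. It is 0 in degree 0, where the empty
  -- word has no largest letter; with this convention `E-split` holds in all degrees.
  h : ℕ → A → K
  h zero    a = 0#
  h (suc k) a = u a * E k (↓ a)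

  E-≐ : ∀ k {Y Z} → (∀ a → Y a ≡ Z a) → E k Y ≈ E k Z
  E-≐ zero    Y≐Z = refl
  E-≐ (suc k) Y≐Z = Σ-≐ _ Y≐Z

  E-split : ∀ k F G → G ⊆ F → E k F ≈ E k G + Σ⟨ F ∖ G ⟩ (h k)
  E-split zero    F G G⊆F = sym (trans (+-congˡ (Σ-zero (F ∖ G) (λ _ → refl))) (+-identityʳ _))
  E-split (suc k) F G G⊆F = Σ-split F G _ G⊆F

  -- Commutation is proved by rewriting a product, uniformly in p and q, as a sum of families that
  -- exchanging p and q leaves unchanged; the closure rules below assemble such sums.
  Symmetric : (ℕ → ℕ → K) → Set
  Symmetric F = ∀ p q → F p q ≈ F q p

  sym-resp : ∀ {F G} → (∀ p q → F p q ≈ G p q) → Symmetric G → Symmetric F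
  sym-resp F≈G s p q = trans (F≈G p q) (trans (s p q) (sym (F≈G q p)))

  sym-+ : ∀ {F G} → Symmetric F → Symmetric G → Symmetric (λ p q → F p q + G p q)
  sym-+ s t p q = +-cong (s p q) (t p q)

  sym-- : ∀ {F G} → Symmetric F → Symmetric G → Symmetric (λ p q → F p q - G p q)
  sym-- s t p q = +-cong (s p q) (-‿cong (t p q))

  sym-* : ∀ {F} x → Symmetric F → Symmetric (λ p q → x * F p q)
  sym-* x s p q = *-congˡ (s p q)

  sym-Σ : ∀ Z {F : A → ℕ → ℕ → K} → (∀ {a} → a ∈ Z → Symmetric (F a)) →
          Symmetric (λ p q → Σ⟨ Z ⟩ λ a → F a p q)
  sym-Σ Z s p q = Σ-cong Z (λ a∈Z → s a∈Z p q)

  Commute : SubsetOf → Set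
  Commute Z = Symmetric λ p q → E p Z * E q Z

  -- A polarised form of `Commute`. For different ideals E p G and E q F need not commute, but the
  -- symmetrised product can still be controlled.
  Interchange : SubsetOf → SubsetOf → Set
  Interchange G F = Symmetric λ p q → E p G * E q F + E p F * E q G

  CommuteBelow : A → Set
  CommuteBelow x = ∀ Y → Lower Y → Y ⊆ ↓ x → Commute Y

  commute-mono : ∀ {x y} → x ≺ y → CommuteBelow y → CommuteBelow x
  commute-mono x≺y below Y lower Y⊆ = below Y lower (↓-mono x≺y ∘ Y⊆)

  -- Otherwise c would be incomparable to all of the chain z ≺ a ≺ x. Every use of (3+1)-freeness
  -- goes through here.
  below-third : ∀ {x a z c} → a ≺ x → z ≺ a → ¬ (c ≺ x) → z ≺ c
  below-third {x} {a} {z} {c} a≺x z≺a c⊀x with z ≺? c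
  ... | yes z≺c = z≺c
  ... | no  z⊀c = ⊥-elim (free z a x c z≺a a≺x
    ( ((λ c≺z → c⊀x (≺-trans c≺z (≺-trans z≺a a≺x))) , z⊀c)
    , ((λ c≺a → c⊀x (≺-trans c≺a a≺x)) , λ a≺c → z⊀c (≺-trans z≺a a≺c))
    , (c⊀x , λ x≺c → z⊀c (≺-trans z≺a (≺-trans a≺x x≺c)))))

  -- The letter c travels left through a chain, one letter at a time. Each letter it passes has a
  -- larger one to its left, finally b, and c is not below that one since c ⊀ b; so `plactic₁`
  -- applies.
  pass : ∀ b c Z → (∀ {z} → z ∈ Z → z ≺ b × z ≺ c) → ¬ (c ≺ b) → ∀ k →
         u b * E k Z * u c ≈ u b * u c * E k Z
  pass b c Z Z≺ c⊀b zero    = solve 2 (λ b c → b :* :1 :* c ⊜ b :* c :* :1) refl (u b) (u c)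
  pass b c Z Z≺ c⊀b (suc k) = begin
    u b * E (suc k) Z * u c                       ≈⟨ Σ-*ˡʳ Z _ _ _ ⟩
    Σ⟨ Z ⟩ (λ z → u b * (u z * E k (↓ z)) * u c)  ≈⟨ Σ-cong Z step ⟩
    Σ⟨ Z ⟩ (λ z → u b * u c * (u z * E k (↓ z)))  ≈⟨ Σ-*ˡ Z _ _ ⟨
    u b * u c * E (suc k) Z                       ∎
    where
    step : ∀ {z} → z ∈ Z → u b * (u z * E k (↓ z)) * u c ≈ u b * u c * (u z * E k (↓ z))
    step {z} z∈Z = let z≺b , z≺c = Z≺ z∈Z in begin
      u b * (u z * E k (↓ z)) * u c
        ≈⟨ solve 4 (λ b z X c → b :* (z :* X) :* c ⊜ b :* (z :* X :* c)) refl _ _ _ _ ⟩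
      u b * (u z * E k (↓ z) * u c)
        ≈⟨ *-congˡ (pass z c (↓ z) (λ y∈ → ↓⁻ y∈ , ≺-trans (↓⁻ y∈) z≺c)
                      (λ c≺z → c⊀b (≺-trans c≺z z≺b)) k) ⟩
      u b * (u z * u c * E k (↓ z))
        ≈⟨ solve 4 (λ b z X c → b :* (z :* c :* X) ⊜ b :* z :* c :* X) refl _ _ _ _ ⟩
      u b * u z * u c * E k (↓ z)
        ≈⟨ *-congʳ (plactic₁ z≺b c⊀b z≺c) ⟩
      u b * u c * u z * E k (↓ z)
        ≈⟨ *-assoc _ _ _ ⟩
      u b * u c * (u z * E k (↓ z))
        ∎

  -- The second f passes the chain of the first factor and comes to stand next to the first f; what
  -- follows are elementary polynomials of ↓ f, which commute.
  h-commute : ∀ {f} → Commute (↓ f) → Symmetric λ p q → h p f * h q f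
  h-commute {f} comm zero    zero    = refl
  h-commute {f} comm zero    (suc q) = trans (zeroˡ _) (sym (zeroʳ _))
  h-commute {f} comm (suc p) zero    = trans (zeroʳ _) (sym (zeroˡ _))
  h-commute {f} comm (suc p) (suc q) = trans (square p q) (trans (*-congˡ (comm p q)) (sym (square q p)))
    where
    square : ∀ p q → h (suc p) f * h (suc q) f ≈ u f * u f * (E p (↓ f) * E q (↓ f))
    square p q = begin
      u f * E p (↓ f) * (u f * E q (↓ f))   ≈⟨ *-assoc _ _ _ ⟨
      u f * E p (↓ f) * u f * E q (↓ f)
        ≈⟨ *-congʳ (pass f f (↓ f) (λ z∈ → ↓⁻ z∈ , ↓⁻ z∈) ≺-irr p) ⟩
      u f * u f * E p (↓ f) * E q (↓ f)     ≈⟨ *-assoc _ _ _ ⟩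
      u f * u f * (E p (↓ f) * E q (↓ f))   ∎

  -- What remains of the commutation of E p and E q on G ∪ {f}, f maximal,
  -- once it is known on G.
  Step : SubsetOf → A → Set
  Step G f = Symmetric λ p q → h p f * E q G + E p G * h q f

  E-adjoin : ∀ F G {f} → G ⊆ F → f ∈ F ∖ G → (∀ {a} → a ∈ F ∖ G → a ≡ f) → ∀ k → E k F ≈ E k G + h k f
  E-adjoin F G G⊆F f∈ only k = trans (E-split k F G G⊆F) (+-congˡ (Σ-single (h k) f∈ only))

  private
    adjoin-product : ∀ {F G f} → (∀ k → E k F ≈ E k G + h k f) → ∀ p q →
             E p F * E q F ≈ E p G * E q G + (h p f * E q G + E p G * h q f) + h p f * h q f
    adjoin-product split p q = trans (*-cong (split p) (split q))
      (solve 4 (λ a b c d → (a :+ b) :* (c :+ d) ⊜ a :* c :+ (b :* c :+ a :* d) :+ b :* d) refl _ _ _ _)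

  -- The product over G with f adjoined has three parts, the outer two already symmetric. Read this
  -- way, known commutation yields the middle part; read as in `step⇒commute`, the middle part
  -- extends commutation by one letter.
  commute⇒step : ∀ F G {f} → (∀ k → E k F ≈ E k G + h k f) →
                 Commute F → Commute G → Commute (↓ f) → Step G f
  commute⇒step F G split commF commG comm↓ =
    sym-resp
      (λ p q → trans
        (solve 3 (λ a b c → b ⊜ a :+ b :+ c :- a :- c) refl _ _ _)
        (+-congʳ (+-congʳ (sym (adjoin-product split p q)))))
      (sym-- (sym-- commF commG) (h-commute comm↓))

  step⇒commute : ∀ F G {f} → (∀ k → E k F ≈ E k G + h k f) →
                 Step G f → Commute G → Commute (↓ f) → Commute F
  step⇒commute F G split step commG comm↓ =
    sym-resp (adjoin-product split) (sym-+ (sym-+ commG step) (h-commute comm↓))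

  -- By `covers` all that lies strictly below F is in G, so G with any single f of F adjoined is a
  -- lower ideal. Commutation there gives `Step G f`; the claim is the sum of these over the f
  -- outside G, plus twice E p G · E q G.
  interchange : ∀ x → CommuteBelow x → ∀ F G → G ⊆ F → F ⊆ ↓ x →
                (∀ {f g} → f ≺ g → g ∈ F → f ∈ G) → Interchange G F
  interchange x below F G G⊆F F⊆↓x covers =
    sym-resp split
      (sym-+ (sym-+ commG commG) (sym-Σ (F ∖ G) λ {f} f∈ → steps (∖⁻ {f} F G f∈)))
    where
    commG : Commute G
    commG = below G (λ a≺b b∈G → covers a≺b (G⊆F b∈G)) (F⊆↓x ∘ G⊆F)
    steps : ∀ {f} → f ∈ F × f ∉ G → Step G f
    steps {f} (f∈F , f∉G) =
      commute⇒step G⊕f G (E-adjoin G⊕f G left (∖⁺ {f} G⊕f G new f∉G) only)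
        (below G⊕f lower (F⊆↓x ∘ G⊕f⊆F)) commG
        (below (↓ f) (↓-lower f) (↓-mono (↓⁻ (F⊆↓x f∈F))))
      where
      G⊕f : SubsetOf
      G⊕f a = G a ∨ does (a ≟ f)
      left : G ⊆ G⊕f
      left {a} p rewrite p = ≡.refl
      cases : ∀ {a} → a ∈ G⊕f → a ∈ G ⊎ a ≡ f
      cases {a} p with G a | a ≟ f
      ... | true  | _        = inj₁ ≡.refl
      ... | false | yes a≡f  = inj₂ a≡f
      new : f ∈ G⊕f
      new rewrite f∉G = dec-true (f ≟ f) ≡.refl
      only : ∀ {a} → a ∈ G⊕f ∖ G → a ≡ f
      only {a} a∈ with ∖⁻ {a} G⊕f G a∈
      ... | p , q with cases p
      ...   | inj₁ r = ∈∉-absurd {a} {G} r q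
      ...   | inj₂ r = r
      G⊕f⊆F : G⊕f ⊆ F
      G⊕f⊆F p with cases p
      ... | inj₁ r      = G⊆F r
      ... | inj₂ ≡.refl = f∈F
      lower : Lower G⊕f
      lower a≺b b∈ = left (covers a≺b (G⊕f⊆F b∈))
    split : ∀ p q → E p G * E q F + E p F * E q G ≈
            E p G * E q G + E p G * E q G + Σ⟨ F ∖ G ⟩ (λ f → h p f * E q G + E p G * h q f)
    split p q = begin
      E p G * E q F + E p F * E q G
        ≈⟨ +-cong (*-congˡ (E-split q F G G⊆F)) (*-congʳ (E-split p F G G⊆F)) ⟩
      E p G * (E q G + Σ⟨ F ∖ G ⟩ (h q)) + (E p G + Σ⟨ F ∖ G ⟩ (h p)) * E q G
        ≈⟨ solve 4 (λ a b c d → a :* (b :+ c) :+ (a :+ d) :* b ⊜ a :* b :+ a :* b :+ (d :* b :+ a :* c)) refl _ _ _ _ ⟩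
      E p G * E q G + E p G * E q G + (Σ⟨ F ∖ G ⟩ (h p) * E q G + E p G * Σ⟨ F ∖ G ⟩ (h q))
        ≈⟨ +-congˡ (+-cong (Σ-*ʳ _ _ _) (Σ-*ˡ _ _ _)) ⟩
      E p G * E q G + E p G * E q G +
        (Σ⟨ F ∖ G ⟩ (λ f → h p f * E q G) + Σ⟨ F ∖ G ⟩ (λ f → E p G * h q f))
        ≈⟨ +-congˡ (Σ-+ _ _ _) ⟨
      E p G * E q G + E p G * E q G + Σ⟨ F ∖ G ⟩ (λ f → h p f * E q G + E p G * h q f)
        ∎

  κ : A → A → K
  κ x a = u x * u a - u a * u x

  -- This is `plactic₂` read as the vanishing of a commutator; it disposes of every term in which
  -- such a letter c comes directly after κ.
  κ-annihilates : ∀ {x a c} → a ≺ x → c ≺ x → ¬ (c ≺ a) → ∀ y → κ x a * (u c * y) ≈ 0#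
  κ-annihilates {x} {a} {c} a≺x c≺x c⊀a y = begin
    κ x a * (u c * y)
      ≈⟨ solve 4 (λ x a c y → (x :* a :- a :* x) :* (c :* y) ⊜ (x :* a :* c :- a :* x :* c) :* y) refl _ _ _ _ ⟩
    (u x * u a * u c - u a * u x * u c) * y
      ≈⟨ *-congʳ (+-congʳ (plactic₂ c⊀a c≺x a≺x)) ⟩
    (u a * u x * u c - u a * u x * u c) * y
      ≈⟨ solve 2 (λ a y → (a :- a) :* y ⊜ :0) refl _ _ ⟩
    0#
      ∎

  -- Split off from ↓ x the chains with maximum c ⊀ a and move c to the left
  -- through E p (↓ a), past all letters but the first letter d.  If d ≺ c, the
  -- claim for (c , d) makes c and d commute, so that κ x a meets c; if d ∼ c,
  -- interchanging ↓ d and ↓ c brings a letter f with u d u c u f = u c u f u d.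
  κ-symmetric : ∀ x → CommuteBelow x → ∀ {a} → a ≺ x →
                Symmetric λ p q → κ x a * (E p (↓ a) * E q (↓ x))
  κ-symmetric = ≺-rec _ λ x rec below {a} a≺x →
    let
      X = ↓ x
      A′ = ↓ a

      expand : ∀ p q → κ x a * (E p A′ * E q X) ≈
               κ x a * (E p A′ * E q A′) + Σ⟨ X ∖ A′ ⟩ (λ c → κ x a * (E p A′ * h q c))
      expand p q = begin
        κ x a * (E p A′ * E q X)
          ≈⟨ *-congˡ (*-congˡ (E-split q X A′ (↓-mono a≺x))) ⟩
        κ x a * (E p A′ * (E q A′ + Σ⟨ X ∖ A′ ⟩ (h q)))
          ≈⟨ solve 4 (λ k a b s → k :* (a :* (b :+ s)) ⊜ k :* (a :* b) :+ k :* a :* s) refl _ _ _ _ ⟩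
        κ x a * (E p A′ * E q A′) + κ x a * E p A′ * Σ⟨ X ∖ A′ ⟩ (h q)
          ≈⟨ +-congˡ (Σ-*ˡ _ _ _) ⟩
        κ x a * (E p A′ * E q A′) + Σ⟨ X ∖ A′ ⟩ (λ c → κ x a * E p A′ * h q c)
          ≈⟨ +-congˡ (Σ-cong (X ∖ A′) (λ _ → *-assoc _ _ _)) ⟩
        κ x a * (E p A′ * E q A′) + Σ⟨ X ∖ A′ ⟩ (λ c → κ x a * (E p A′ * h q c))
          ∎
    in sym-resp expand
         (sym-+ (sym-* (κ x a) (below A′ (↓-lower a) (↓-mono a≺x)))
                (sym-Σ (X ∖ A′) λ {c} c∈ →
                   let c∈X , c∉A′ = ∖⁻ {c} X A′ c∈
                   in top rec below a≺x (↓⁻ c∈X) (∉↓⁻ c∉A′)))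
    where
    Claim : A → Set
    Claim x = CommuteBelow x → ∀ {a} → a ≺ x → Symmetric λ p q → κ x a * (E p (↓ a) * E q (↓ x))

    module _ {x} (rec : ∀ c → c ≺ x → Claim c) (below : CommuteBelow x)
             {a} (a≺x : a ≺ x) {c} (c≺x : c ≺ x) (c⊀a : ¬ (c ≺ a)) where

      swapped : ∀ {d} → d ≺ a → Symmetric λ p q → κ x a * (u d * u c * (E p (↓ d) * E q (↓ c)))
      swapped {d} d≺a with d ≺? c
      ... | yes d≺c =
        sym-resp
          (λ p q → begin
            κ x a * (u d * u c * (E p (↓ d) * E q (↓ c)))
              ≈⟨ solve 4 (λ k d c y → k :* (d :* c :* y) ⊜
                                       k :* (c :* (d :* y)) :- k :* ((c :* d :- d :* c) :* y)) refl _ _ _ _ ⟩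
            κ x a * (u c * (u d * (E p (↓ d) * E q (↓ c)))) - κ x a * (κ c d * (E p (↓ d) * E q (↓ c)))
              ≈⟨ +-congʳ (κ-annihilates a≺x c≺x c⊀a _) ⟩
            0# - κ x a * (κ c d * (E p (↓ d) * E q (↓ c)))
              ∎)
          (sym-- (λ _ _ → refl) (sym-* (κ x a) (rec c c≺x (commute-mono c≺x below) d≺c)))
      ... | no  d⊀c =
        sym-resp
          (λ p q → begin
            κ x a * (u d * u c * (E p D * E q C))
              ≈⟨ *-assoc _ _ _ ⟨
            k * (E p D * E q C)
              -- Behind `k` the factor E p C may be shrunk to E p D. So the product is the
              -- interchange sum minus E p D · E q D, both of which are symmetric.
              ≈⟨ solve 4 (λ k s r t → k :* r ⊜ k :* (r :+ s) :- k :* t :+ (k :* t :- k :* s)) refl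
                   k (E p C * E q D) (E p D * E q C) (E p D * E q D) ⟩
            k * (E p D * E q C + E p C * E q D) - k * (E p D * E q D)
              + (k * (E p D * E q D) - k * (E p C * E q D))
              ≈⟨ +-congˡ (trans (+-congˡ (-‿cong (shrink p q))) (-‿inverseʳ _)) ⟩
            k * (E p D * E q C + E p C * E q D) - k * (E p D * E q D) + 0#
              ∎)
          (sym-+ (sym-- (sym-* k (interchange x below C D D⊆C (↓-mono c≺x) covers))
                        (sym-* k (below D (↓-lower d) (↓-mono (≺-trans d≺a a≺x)))))
                 (λ _ _ → refl))
        where
        k = κ x a * (u d * u c)
        C = ↓ c
        D = ↓ d
        c⊀d : ¬ (c ≺ d)
        c⊀d c≺d = c⊀a (≺-trans c≺d d≺a)
        D⊆C : D ⊆ C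
        D⊆C z∈ = ↓⁺ (below-third d≺a (↓⁻ z∈) c⊀a)
        covers : ∀ {f g} → f ≺ g → g ∈ C → f ∈ D
        covers f≺g g∈C = ↓⁺ (below-third (↓⁻ g∈C) f≺g d⊀c)
        vanish : ∀ p y {f} → f ∈ C ∖ D → k * (h p f * y) ≈ 0#
        vanish zero    y f∈ = trans (*-congˡ (zeroˡ y)) (zeroʳ k)
        vanish (suc p) y {f} f∈ = begin
          κ x a * (u d * u c) * (u f * E p (↓ f) * y)
            ≈⟨ solve 6 (λ k d c f F y → k :* (d :* c) :* (f :* F :* y) ⊜ k :* (d :* c :* f :* (F :* y)))
                 refl _ _ _ _ _ _ ⟩
          κ x a * (u d * u c * u f * (E p (↓ f) * y))
            ≈⟨ *-congˡ (*-congʳ (plactic₃ (f⊀d , d⊀f) (d⊀c , c⊀d) f≺c)) ⟨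
          κ x a * (u c * u f * u d * (E p (↓ f) * y))
            ≈⟨ solve 5 (λ k c f d y → k :* (c :* f :* d :* y) ⊜ k :* (c :* (f :* d :* y))) refl _ _ _ _ _ ⟩
          κ x a * (u c * (u f * u d * (E p (↓ f) * y)))
            ≈⟨ κ-annihilates a≺x c≺x c⊀a _ ⟩
          0#
            ∎
          where
          f≺c = ↓⁻ (proj₁ (∖⁻ {f} C D f∈))
          f⊀d = ∉↓⁻ (proj₂ (∖⁻ {f} C D f∈))
          d⊀f : ¬ (d ≺ f)
          d⊀f d≺f = d⊀c (≺-trans d≺f f≺c)
        shrink : ∀ p q → k * (E p C * E q D) ≈ k * (E p D * E q D)
        shrink p q = begin
          k * (E p C * E q D)
            ≈⟨ *-congˡ (*-congʳ (E-split p C D D⊆C)) ⟩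
          k * ((E p D + Σ⟨ C ∖ D ⟩ (h p)) * E q D)
            ≈⟨ trans (*-congˡ (distribʳ _ _ _)) (distribˡ _ _ _) ⟩
          k * (E p D * E q D) + k * (Σ⟨ C ∖ D ⟩ (h p) * E q D)
            ≈⟨ +-congˡ (trans (*-congˡ (Σ-*ʳ _ _ _)) (Σ-*ˡ _ _ _)) ⟩
          k * (E p D * E q D) + Σ⟨ C ∖ D ⟩ (λ f → k * (h p f * E q D))
            ≈⟨ +-congˡ (Σ-zero (C ∖ D) (vanish p _)) ⟩
          k * (E p D * E q D) + 0#
            ≈⟨ +-identityʳ _ ⟩
          k * (E p D * E q D)
            ∎

      top : Symmetric λ p q → κ x a * (E p (↓ a) * h q c)
      top zero    zero    = refl
      top zero    (suc q) = begin
        κ x a * (1# * (u c * E q (↓ c)))  ≈⟨ *-congˡ (*-identityˡ _) ⟩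
        κ x a * (u c * E q (↓ c))         ≈⟨ κ-annihilates a≺x c≺x c⊀a _ ⟩
        0#                                ≈⟨ solve 2 (λ k y → :0 ⊜ k :* (y :* :0)) refl _ _ ⟩
        κ x a * (E (suc q) (↓ a) * 0#)    ∎
      top (suc p) zero    = sym (top zero (suc p))
      top (suc p) (suc q) =
        sym-resp pull (sym-Σ (↓ a) λ d∈ → swapped (↓⁻ d∈)) p q
        where
        pull : ∀ p q → κ x a * (E (suc p) (↓ a) * h (suc q) c) ≈
               Σ⟨ ↓ a ⟩ (λ d → κ x a * (u d * u c * (E p (↓ d) * E q (↓ c))))
        pull p q = begin
          κ x a * (E (suc p) (↓ a) * (u c * E q (↓ c)))
            ≈⟨ trans (*-congˡ (Σ-*ʳ _ _ _)) (Σ-*ˡ _ _ _) ⟩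
          Σ⟨ ↓ a ⟩ (λ d → κ x a * (u d * E p (↓ d) * (u c * E q (↓ c))))
            ≈⟨ Σ-cong (↓ a) (λ {d} d∈ → *-congˡ (begin
                 u d * E p (↓ d) * (u c * E q (↓ c))
                   ≈⟨ *-assoc _ _ _ ⟨
                 u d * E p (↓ d) * u c * E q (↓ c)
                   ≈⟨ *-congʳ (pass d c (↓ d)
                        (λ z∈ → ↓⁻ z∈ , below-third (↓⁻ d∈) (↓⁻ z∈) c⊀a)
                        (λ c≺d → c⊀a (≺-trans c≺d (↓⁻ d∈))) p) ⟩
                 u d * u c * E p (↓ d) * E q (↓ c)
                   ≈⟨ *-assoc _ _ _ ⟩
                 u d * u c * (E p (↓ d) * E q (↓ c))
                   ∎)) ⟩
          Σ⟨ ↓ a ⟩ (λ d → κ x a * (u d * u c * (E p (↓ d) * E q (↓ c))))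
            ∎

  meet : A → A → SubsetOf
  meet x c = ↓ x ∩ ↓ c

  meet-lower : ∀ x c → Lower (meet x c)
  meet-lower x c a≺b b∈ =
    let b∈x , b∈c = ∩⁻ (↓ x) (↓ c) b∈
    in ∩⁺ (↓ x) (↓ c) (↓-lower x a≺b b∈x) (↓-lower c a≺b b∈c)

  -- Chains below x are sorted by their top letter a. If a ≺ c, then c passes the whole chain.
  -- Otherwise a ∼ c, the rest of the chain is below c by (3+1)-freeness and can be passed, and
  -- `plactic₃` turns u x u a u c into u c u x u a.
  pass-incomparable : ∀ {x c} → c ∼ x → ∀ p →
    u x * E p (↓ x) * u c ≈
    u x * u c * E p (meet x c) + u c * u x * Σ⟨ ↓ x ∖ meet x c ⟩ (h p)
  pass-incomparable {x} {c} (c⊀x , x⊀c) p = begin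
    u x * E p X * u c
      ≈⟨ *-congʳ (*-congˡ (E-split p X W W⊆X)) ⟩
    u x * (E p W + Σ⟨ X ∖ W ⟩ (h p)) * u c
      ≈⟨ solve 4 (λ x w r c → x :* (w :+ r) :* c ⊜ x :* w :* c :+ x :* r :* c) refl _ _ _ _ ⟩
    u x * E p W * u c + u x * Σ⟨ X ∖ W ⟩ (h p) * u c
      ≈⟨ +-cong (pass x c W (λ z∈ → let z∈x , z∈c = ∩⁻ X (↓ c) z∈ in ↓⁻ z∈x , ↓⁻ z∈c) c⊀x p)
                (trans (Σ-*ˡʳ _ _ _ _) (trans (Σ-cong (X ∖ W) (turn p)) (sym (Σ-*ˡ _ _ _)))) ⟩
    u x * u c * E p W + u c * u x * Σ⟨ X ∖ W ⟩ (h p)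
      ∎
    where
    X = ↓ x
    W = meet x c
    W⊆X : W ⊆ X
    W⊆X z∈ = proj₁ (∩⁻ X (↓ c) z∈)
    turn : ∀ p {a} → a ∈ X ∖ W → u x * h p a * u c ≈ u c * u x * h p a
    turn zero    a∈ = solve 2 (λ x c → x :* :0 :* c ⊜ c :* x :* :0) refl _ _
    turn (suc p) {a} a∈ = begin
      u x * (u a * E p (↓ a)) * u c
        ≈⟨ solve 4 (λ x a y c → x :* (a :* y) :* c ⊜ x :* (a :* y :* c)) refl _ _ _ _ ⟩
      u x * (u a * E p (↓ a) * u c)
        ≈⟨ *-congˡ (pass a c (↓ a) (λ z∈ → ↓⁻ z∈ , below-third a≺x (↓⁻ z∈) c⊀x) c⊀a p) ⟩
      u x * (u a * u c * E p (↓ a))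
        ≈⟨ solve 4 (λ x a c y → x :* (a :* c :* y) ⊜ x :* a :* c :* y) refl _ _ _ _ ⟩
      u x * u a * u c * E p (↓ a)
        ≈⟨ *-congʳ (plactic₃ (a⊀c , c⊀a) (c⊀x , x⊀c) a≺x) ⟩
      u c * u x * u a * E p (↓ a)
        ≈⟨ *-assoc _ _ _ ⟩
      u c * u x * (u a * E p (↓ a))
        ∎
      where
      a≺x = ↓⁻ (proj₁ (∖⁻ {a} X W a∈))
      a⊀c : ¬ (a ≺ c)
      a⊀c a≺c = ∈∉-absurd {a} {W} (∩⁺ X (↓ c) (↓⁺ a≺x) (↓⁺ a≺c)) (proj₂ (∖⁻ {a} X W a∈))
      c⊀a : ¬ (c ≺ a)
      c⊀a c≺a = c⊀x (≺-trans c≺a a≺x)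

  -- Three kinds of chains of Z occur: all letters below x, only the top letter c incomparable to x,
  -- or the two top letters c and d both incomparable to x. The lemmas up to `step` treat them in
  -- this order.
  module AddMaximal {x : A} (below : CommuteBelow x) where

    X : SubsetOf
    X = ↓ x

    -- With u x u a = u a u x + κ x a, the terms with u a u x pair up under exchange of p and q, and
    -- the rest is `κ-symmetric`.
    both-below : Symmetric λ p q → u x * E p X * E (suc q) X + E (suc p) X * (u x * E q X)
    both-below = sym-resp expand
      (sym-Σ X λ {a} a∈ →
        sym-+ (sym-* (u a * u x) (λ _ _ → +-comm _ _)) (λ p q → κ-symmetric x below (↓⁻ a∈) q p))
      where
      expand : ∀ p q → u x * E p X * E (suc q) X + E (suc p) X * (u x * E q X) ≈
        Σ⟨ X ⟩ λ a → u a * u x * (E q (↓ a) * E p X + E p (↓ a) * E q X)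
                      + κ x a * (E q (↓ a) * E p X)
      expand p q = begin
        u x * E p X * E (suc q) X + E (suc p) X * (u x * E q X)
          -- The factors in ↓ x are exchanged so that the one of degree q + 1, whose top letter a is
          -- split off, stands next to x.
          ≈⟨ +-congʳ (trans (*-assoc _ _ _) (trans (*-congˡ (below X (↓-lower x) (λ a∈ → a∈) p (suc q)))
                                                   (sym (*-assoc _ _ _)))) ⟩
        u x * E (suc q) X * E p X + E (suc p) X * (u x * E q X)
          ≈⟨ +-cong (Σ-*ˡʳ _ _ _ _) (Σ-*ʳ _ _ _) ⟩
        Σ⟨ X ⟩ (λ a → u x * (u a * E q (↓ a)) * E p X) + Σ⟨ X ⟩ (λ a → u a * E p (↓ a) * (u x * E q X))
          ≈⟨ Σ-+ X _ _ ⟨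
        Σ⟨ X ⟩ (λ a → u x * (u a * E q (↓ a)) * E p X + u a * E p (↓ a) * (u x * E q X))
          ≈⟨ Σ-cong X (λ {a} a∈ → begin
               u x * (u a * E q (↓ a)) * E p X + u a * E p (↓ a) * (u x * E q X)
                 ≈⟨ +-congˡ (trans (sym (*-assoc _ _ _)) (*-congʳ
                      (pass a x (↓ a) (λ z∈ → ↓⁻ z∈ , ≺-trans (↓⁻ z∈) (↓⁻ a∈))
                        (λ x≺a → ≺-irr (≺-trans x≺a (↓⁻ a∈))) p))) ⟩
               u x * (u a * E q (↓ a)) * E p X + u a * u x * E p (↓ a) * E q X
                 ≈⟨ solve 6 (λ x a s t v w → x :* (a :* s) :* t :+ a :* x :* v :* w ⊜
                               a :* x :* (s :* t :+ v :* w) :+ (x :* a :- a :* x) :* (s :* t)) refl _ _ _ _ _ _ ⟩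
               u a * u x * (E q (↓ a) * E p X + E p (↓ a) * E q X) + κ x a * (E q (↓ a) * E p X)
                 ∎) ⟩
        Σ⟨ X ⟩ (λ a → u a * u x * (E q (↓ a) * E p X + E p (↓ a) * E q X)
                      + κ x a * (E q (↓ a) * E p X))
          ∎

    -- Moving c left in one product and x left in the other leaves the commutator of u x and u c
    -- times E p W · E q W, and u c u x times an interchange of W and ↓ x.
    one-incomparable : ∀ {c} → c ∼ x →
      Symmetric λ p q → u x * E p X * (u c * E q (meet x c)) + u c * E p (meet x c) * (u x * E q X)
    one-incomparable {c} (c⊀x , x⊀c) =
      sym-resp expand
        (sym-+ (sym-* (u x * u c - u c * u x) (below W (meet-lower x c) W⊆X))
               (sym-* (u c * u x) (λ p q → trans (+-comm _ _)
                  (trans (interchange x below X W W⊆X (λ a∈ → a∈) covers p q) (+-comm _ _)))))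
      where
      W = meet x c
      W⊆X : W ⊆ X
      W⊆X z∈ = proj₁ (∩⁻ X (↓ c) z∈)
      covers : ∀ {f g} → f ≺ g → g ∈ X → f ∈ W
      covers f≺g g∈X = ∩⁺ X (↓ c) (↓-lower x f≺g g∈X) (↓⁺ (below-third (↓⁻ g∈X) f≺g c⊀x))
      expand : ∀ p q → u x * E p X * (u c * E q W) + u c * E p W * (u x * E q X) ≈
               (u x * u c - u c * u x) * (E p W * E q W) + u c * u x * (E p X * E q W + E p W * E q X)
      expand p q = begin
        u x * E p X * (u c * E q W) + u c * E p W * (u x * E q X)
          ≈⟨ +-cong (sym (*-assoc _ _ _)) (sym (*-assoc _ _ _)) ⟩
        u x * E p X * u c * E q W + u c * E p W * u x * E q X
          ≈⟨ +-cong (*-congʳ (pass-incomparable (c⊀x , x⊀c) p))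
                    (*-congʳ (pass c x W (λ z∈ → let z∈x , z∈c = ∩⁻ X (↓ c) z∈ in ↓⁻ z∈c , ↓⁻ z∈x) x⊀c p)) ⟩
        (u x * u c * E p W + u c * u x * Σ⟨ X ∖ W ⟩ (h p)) * E q W + u c * u x * E p W * E q X
          ≈⟨ solve 6 (λ x c w r v y → (x :* c :* w :+ c :* x :* r) :* v :+ c :* x :* w :* y ⊜
                (x :* c :- c :* x) :* (w :* v) :+ c :* x :* ((w :+ r) :* v :+ w :* y)) refl _ _ _ _ _ _ ⟩
        (u x * u c - u c * u x) * (E p W * E q W)
          + u c * u x * ((E p W + Σ⟨ X ∖ W ⟩ (h p)) * E q W + E p W * E q X)
          ≈⟨ +-congˡ (*-congˡ (+-congʳ (*-congʳ (E-split p X W W⊆X)))) ⟨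
        (u x * u c - u c * u x) * (E p W * E q W) + u c * u x * (E p X * E q W + E p W * E q X)
          ∎

    -- By (3+1)-freeness ↓ d lies in ↓ x ∩ ↓ c. The chains below x are now sorted by where their top
    -- letter a lies with respect to ↓ d, ↓ x ∩ ↓ c and ↓ x.
    module _ {c d} (d≺c : d ≺ c) (c∼x : c ∼ x) (d∼x : d ∼ x) where

      private
        c⊀x = proj₁ c∼x
        x⊀c = proj₂ c∼x
        d⊀x = proj₁ d∼x
        x⊀d = proj₂ d∼x
        D = ↓ d
        W = meet x c
        D⊆W : D ⊆ W
        D⊆W z∈ = ∩⁺ X (↓ c) (↓⁺ (below-third d≺c (↓⁻ z∈) x⊀c)) (↓⁺ (≺-trans (↓⁻ z∈) d≺c))
        W⊆X : W ⊆ X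
        W⊆X z∈ = proj₁ (∩⁻ X (↓ c) z∈)
        D⊆X : D ⊆ X
        D⊆X z∈ = W⊆X (D⊆W z∈)
        below-d : CommuteBelow d
        below-d Y lower Y⊆D = below Y lower (D⊆X ∘ Y⊆D)
        d⊀ : ∀ {a} → a ∈ X → ¬ (d ≺ a)
        d⊀ a∈X d≺a = d⊀x (≺-trans d≺a (↓⁻ a∈X))
        passing-d : ∀ {a} → a ∈ X → ∀ p → u a * E p (↓ a) * u d ≈ u a * u d * E p (↓ a)
        passing-d {a} a∈X = pass a d (↓ a) (λ z∈ → ↓⁻ z∈ , below-third (↓⁻ a∈X) (↓⁻ z∈) d⊀x) (d⊀ a∈X)

        -- The share of a in the second product, once `plactic₃` has turned u c u d u x into u x u c
        -- u d.
        right : A → ℕ → ℕ → K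
        right a p q = u x * u c * (u d * E p D * u a) * E q (↓ a)

        -- For a ⊀ c, (3+1)-freeness used in both directions gives ↓ a = ↓ d, and both terms become
        -- the same word times E p D · E q D.
        above-D : ∀ {a} → a ∈ X ∖ W → Symmetric λ p q →
          u c * u x * h (suc p) a * (u d * E q D) + right a p q
        above-D {a} a∈ = sym-resp expand (sym-* (w + w) (below-d D (↓-lower d) (λ z∈ → z∈)))
          where
          w = u x * u c * u d * u a
          a∈X = proj₁ (∖⁻ {a} X W a∈)
          a⊀c : ¬ (a ≺ c)
          a⊀c a≺c = ∈∉-absurd {a} {W} (∩⁺ X (↓ c) a∈X (↓⁺ a≺c)) (proj₂ (∖⁻ {a} X W a∈))
          a⊀d : ¬ (a ≺ d)
          a⊀d a≺d = a⊀c (≺-trans a≺d d≺c)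
          ↓a≐D : ∀ y → (↓ a) y ≡ D y
          ↓a≐D = ≐-from-⊆ {↓ a} {D} (λ z∈ → ↓⁺ (below-third (↓⁻ a∈X) (↓⁻ z∈) d⊀x))
                                   (λ z∈ → ↓⁺ (below-third d≺c (↓⁻ z∈) a⊀c))
          expand : ∀ p q → u c * u x * h (suc p) a * (u d * E q D) + right a p q ≈ (w + w) * (E p D * E q D)
          expand p q = begin
            u c * u x * (u a * E p (↓ a)) * (u d * E q D) + right a p q
              ≈⟨ +-cong (solve 6 (λ c x a s d t → c :* x :* (a :* s) :* (d :* t) ⊜ c :* x :* (a :* s :* d) :* t)
                                 refl _ _ _ _ _ _)
                        (*-congʳ (*-congˡ (pass d a D (λ z∈ → ↓⁻ z∈ , ↓⁻ (≡.trans (↓a≐D _) z∈)) a⊀d p))) ⟩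
            u c * u x * (u a * E p (↓ a) * u d) * E q D + u x * u c * (u d * u a * E p D) * E q (↓ a)
              ≈⟨ +-congʳ (*-congʳ (*-congˡ (passing-d a∈X p))) ⟩
            u c * u x * (u a * u d * E p (↓ a)) * E q D + u x * u c * (u d * u a * E p D) * E q (↓ a)
              ≈⟨ +-cong (*-congʳ (*-congˡ (*-congˡ (E-≐ p ↓a≐D)))) (*-congˡ (E-≐ q ↓a≐D)) ⟩
            u c * u x * (u a * u d * E p D) * E q D + u x * u c * (u d * u a * E p D) * E q D
              ≈⟨ +-congʳ (solve 6 (λ c x a d s t → c :* x :* (a :* d :* s) :* t ⊜ c :* (x :* a :* d) :* (s :* t))
                                  refl _ _ _ _ _ _) ⟩
            u c * (u x * u a * u d) * (E p D * E q D) + u x * u c * (u d * u a * E p D) * E q D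
              ≈⟨ +-congʳ (*-congʳ (*-congˡ (plactic₃ (a⊀d , d⊀ a∈X) d∼x (↓⁻ a∈X)))) ⟩
            u c * (u d * u x * u a) * (E p D * E q D) + u x * u c * (u d * u a * E p D) * E q D
              ≈⟨ +-congʳ (*-congʳ (solve 4 (λ c d x a → c :* (d :* x :* a) ⊜ c :* d :* x :* a) refl _ _ _ _)) ⟩
            u c * u d * u x * u a * (E p D * E q D) + u x * u c * (u d * u a * E p D) * E q D
              ≈⟨ +-congʳ (*-congʳ (*-congʳ (plactic₃ d∼x (x⊀c , c⊀x) d≺c))) ⟩
            u x * u c * u d * u a * (E p D * E q D) + u x * u c * (u d * u a * E p D) * E q D
              ≈⟨ solve 6 (λ x c d a s t → x :* c :* d :* a :* (s :* t) :+ x :* c :* (d :* a :* s) :* t ⊜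
                            (x :* c :* d :* a :+ x :* c :* d :* a) :* (s :* t)) refl _ _ _ _ _ _ ⟩
            (w + w) * (E p D * E q D)
              ∎

        -- The pattern of `one-incomparable` again, with d and a in the roles of x and c; here the
        -- meet of ↓ d and ↓ a is ↓ a.
        in-W : ∀ {a} → a ∈ W ∖ D → Symmetric λ p q →
          u x * u c * h (suc p) a * (u d * E q D) + right a p q
        in-W {a} a∈ =
          sym-resp expand (sym-+ (sym-* (v * (u d * u a - u a * u d)) (below-d A′ (↓-lower a) A′⊆D))
                                 (sym-* (v * (u a * u d)) (interchange d below-d D A′ A′⊆D (λ z∈ → z∈) covers)))
          where
          v = u x * u c
          A′ = ↓ a
          V = meet d a
          a∈W = proj₁ (∖⁻ {a} W D a∈)
          a∈X = W⊆X a∈W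
          a⊀d = ∉↓⁻ (proj₂ (∖⁻ {a} W D a∈))
          A′⊆D : A′ ⊆ D
          A′⊆D z∈ = ↓⁺ (below-third (↓⁻ a∈X) (↓⁻ z∈) d⊀x)
          covers : ∀ {f g} → f ≺ g → g ∈ D → f ∈ A′
          covers f≺g g∈D = ↓⁺ (below-third (↓⁻ g∈D) f≺g a⊀d)
          V≐A′ : ∀ y → V y ≡ A′ y
          V≐A′ = ≐-from-⊆ {V} {A′} (λ z∈ → proj₂ (∩⁻ D A′ z∈)) (λ z∈ → ∩⁺ D A′ (A′⊆D z∈) z∈)
          V⊆D : V ⊆ D
          V⊆D z∈ = proj₁ (∩⁻ D A′ z∈)
          expand : ∀ p q → u x * u c * h (suc p) a * (u d * E q D) + right a p q ≈
            v * (u d * u a - u a * u d) * (E p A′ * E q A′) +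
            v * (u a * u d) * (E p A′ * E q D + E p D * E q A′)
          expand p q = begin
            u x * u c * (u a * E p A′) * (u d * E q D) + right a p q
              ≈⟨ +-congʳ (solve 6 (λ x c a s d t → x :* c :* (a :* s) :* (d :* t) ⊜ x :* c :* (a :* s :* d) :* t)
                                  refl _ _ _ _ _ _) ⟩
            u x * u c * (u a * E p A′ * u d) * E q D + right a p q
              ≈⟨ +-cong (*-congʳ (*-congˡ (passing-d a∈X p)))
                        (*-congʳ (*-congˡ (pass-incomparable (a⊀d , d⊀ a∈X) p))) ⟩
            u x * u c * (u a * u d * E p A′) * E q D
              + u x * u c * (u d * u a * E p V + u a * u d * Σ⟨ D ∖ V ⟩ (h p)) * E q A′
              ≈⟨ solve 9 (λ x c a d s t z r y →
                    x :* c :* (a :* d :* s) :* t :+ x :* c :* (d :* a :* z :+ a :* d :* r) :* y ⊜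
                    x :* c :* (d :* a :- a :* d) :* (z :* y) :+ x :* c :* (a :* d) :* (s :* t :+ (z :+ r) :* y))
                    refl _ _ _ _ _ _ _ _ _ ⟩
            v * (u d * u a - u a * u d) * (E p V * E q A′)
              + v * (u a * u d) * (E p A′ * E q D + (E p V + Σ⟨ D ∖ V ⟩ (h p)) * E q A′)
              ≈⟨ +-cong (*-congˡ (*-congʳ (E-≐ p V≐A′)))
                        (*-congˡ (+-congˡ (*-congʳ (sym (E-split p D V V⊆D))))) ⟩
            v * (u d * u a - u a * u d) * (E p A′ * E q A′)
              + v * (u a * u d) * (E p A′ * E q D + E p D * E q A′)
              ∎

        -- As a ≺ d, this is the pattern of `both-below` with d in place of x.
        in-D : ∀ {a} → a ∈ D → Symmetric λ p q →
          u x * u c * h (suc p) a * (u d * E q D) + u x * u c * u d * (h (suc q) a * E p D)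
        in-D {a} a∈D =
          sym-resp expand (sym-+ (sym-* v (λ p q → κ-symmetric d below-d (↓⁻ a∈D) q p))
                                 (sym-* (v * (u a * u d)) (λ _ _ → +-comm _ _)))
          where
          v = u x * u c
          A′ = ↓ a
          expand : ∀ p q →
            u x * u c * h (suc p) a * (u d * E q D) + u x * u c * u d * (h (suc q) a * E p D) ≈
            v * (κ d a * (E q A′ * E p D)) + v * (u a * u d) * (E q A′ * E p D + E p A′ * E q D)
          expand p q = begin
            u x * u c * (u a * E p A′) * (u d * E q D) + u x * u c * u d * (u a * E q A′ * E p D)
              ≈⟨ +-congʳ (solve 6 (λ x c a s d t → x :* c :* (a :* s) :* (d :* t) ⊜ x :* c :* (a :* s :* d) :* t)
                                  refl _ _ _ _ _ _) ⟩
            u x * u c * (u a * E p A′ * u d) * E q D + u x * u c * u d * (u a * E q A′ * E p D)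
              ≈⟨ +-congʳ (*-congʳ (*-congˡ (passing-d (D⊆X a∈D) p))) ⟩
            u x * u c * (u a * u d * E p A′) * E q D + u x * u c * u d * (u a * E q A′ * E p D)
              ≈⟨ solve 8 (λ x c a d s t y z →
                    x :* c :* (a :* d :* s) :* t :+ x :* c :* d :* (a :* y :* z) ⊜
                    x :* c :* ((d :* a :- a :* d) :* (y :* z)) :+ x :* c :* (a :* d) :* (y :* z :+ s :* t))
                    refl _ _ _ _ _ _ _ _ ⟩
            v * (κ d a * (E q A′ * E p D)) + v * (u a * u d) * (E q A′ * E p D + E p A′ * E q D)
              ∎

      two-incomparable : Symmetric λ p q → u x * E p X * (u c * h q d) + u c * h p d * (u x * E q X)
      two-incomparable zero    zero    = refl
      two-incomparable zero    (suc q) = begin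
        u x * 1# * (u c * (u d * E q D)) + u c * 0# * (u x * E (suc q) X)
          ≈⟨ solve 5 (λ x c d y z → x :* :1 :* (c :* (d :* y)) :+ c :* :0 :* (x :* z) ⊜ x :* c :* d :* y)
               refl (u x) (u c) (u d) (E q D) (E (suc q) X) ⟩
        u x * u c * u d * E q D
          ≈⟨ *-congʳ (plactic₃ d∼x (x⊀c , c⊀x) d≺c) ⟨
        u c * u d * u x * E q D
          ≈⟨ solve 4 (λ c d x y → c :* d :* x :* y ⊜ c :* (d :* x :* y)) refl _ _ _ _ ⟩
        u c * (u d * u x * E q D)
          ≈⟨ *-congˡ (pass d x D (λ z∈ → ↓⁻ z∈ , ↓⁻ (D⊆X z∈)) x⊀d q) ⟨
        u c * (u d * E q D * u x)
          ≈⟨ solve 5 (λ x c d y z → c :* (d :* y :* x) ⊜ x :* z :* (c :* :0) :+ c :* (d :* y) :* (x :* :1))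
               refl (u x) (u c) (u d) (E q D) (E (suc q) X) ⟩
        u x * E (suc q) X * (u c * 0#) + u c * (u d * E q D) * (u x * 1#)
          ∎
      two-incomparable (suc p) zero    = sym (two-incomparable zero (suc p))
      two-incomparable (suc p) (suc q) =
        sym-resp expand
          (sym-+ (sym-+ (sym-Σ (X ∖ W) above-D) (sym-Σ (W ∖ D) in-W)) (sym-Σ D in-D)) p q
        where
        v = u x * u c
        first : ∀ p q → u x * E (suc p) X * (u c * h (suc q) d) ≈
          Σ⟨ X ∖ W ⟩ (λ a → u c * u x * h (suc p) a * (u d * E q D)) +
          Σ⟨ W ∖ D ⟩ (λ a → v * h (suc p) a * (u d * E q D)) +
          Σ⟨ D ⟩ (λ a → v * h (suc p) a * (u d * E q D))
        first p q = begin
          u x * E (suc p) X * (u c * (u d * E q D))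
            ≈⟨ *-assoc _ _ _ ⟨
          u x * E (suc p) X * u c * (u d * E q D)
            ≈⟨ *-congʳ (pass-incomparable c∼x (suc p)) ⟩
          (v * E (suc p) W + u c * u x * Σ⟨ X ∖ W ⟩ (h (suc p))) * (u d * E q D)
            ≈⟨ *-congʳ (+-congʳ (*-congˡ (Σ-split W D _ D⊆W))) ⟩
          (v * (E (suc p) D + Σ⟨ W ∖ D ⟩ (h (suc p))) + u c * u x * Σ⟨ X ∖ W ⟩ (h (suc p))) * (u d * E q D)
            ≈⟨ solve 6 (λ v w y s t r → (v :* (s :+ t) :+ w :* r) :* y ⊜ w :* r :* y :+ v :* t :* y :+ v :* s :* y)
                 refl _ _ _ _ _ _ ⟩
          u c * u x * Σ⟨ X ∖ W ⟩ (h (suc p)) * (u d * E q D) + v * Σ⟨ W ∖ D ⟩ (h (suc p)) * (u d * E q D)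
            + v * E (suc p) D * (u d * E q D)
            ≈⟨ +-cong (+-cong (Σ-*ˡʳ _ _ _ _) (Σ-*ˡʳ _ _ _ _)) (Σ-*ˡʳ _ _ _ _) ⟩
          _ ∎
        second : ∀ p q → u c * h (suc p) d * (u x * E (suc q) X) ≈
          Σ⟨ X ∖ W ⟩ (λ a → right a p q) + Σ⟨ W ∖ D ⟩ (λ a → right a p q) +
          Σ⟨ D ⟩ (λ a → v * u d * (h (suc q) a * E p D))
        second p q = begin
          u c * (u d * E p D) * (u x * E (suc q) X)
            ≈⟨ solve 5 (λ c d s x t → c :* (d :* s) :* (x :* t) ⊜ c :* (d :* s :* x) :* t) refl _ _ _ _ _ ⟩
          u c * (u d * E p D * u x) * E (suc q) X
            ≈⟨ *-congʳ (*-congˡ (pass d x D (λ z∈ → ↓⁻ z∈ , ↓⁻ (D⊆X z∈)) x⊀d p)) ⟩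
          u c * (u d * u x * E p D) * E (suc q) X
            ≈⟨ *-congʳ (solve 4 (λ c d x s → c :* (d :* x :* s) ⊜ c :* d :* x :* s) refl _ _ _ _) ⟩
          u c * u d * u x * E p D * E (suc q) X
            ≈⟨ *-congʳ (*-congʳ (plactic₃ d∼x (x⊀c , c⊀x) d≺c)) ⟩
          v * u d * E p D * E (suc q) X
            ≈⟨ *-congˡ (trans (Σ-split X W _ W⊆X) (+-congʳ (Σ-split W D _ D⊆W))) ⟩
          v * u d * E p D * (E (suc q) D + Σ⟨ W ∖ D ⟩ (h (suc q)) + Σ⟨ X ∖ W ⟩ (h (suc q)))
            ≈⟨ solve 5 (λ k s t r y → k :* s :* (t :+ r :+ y) ⊜ k :* s :* y :+ k :* s :* r :+ k :* (s :* t))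
                 refl _ _ _ _ _ ⟩
          v * u d * E p D * Σ⟨ X ∖ W ⟩ (h (suc q)) + v * u d * E p D * Σ⟨ W ∖ D ⟩ (h (suc q))
            + v * u d * (E p D * E (suc q) D)
            ≈⟨ +-cong (+-cong (distribute (X ∖ W)) (distribute (W ∖ D)))
                      -- On D the factors are exchanged before a is split off, so that a comes
                      -- directly after d as `in-D` expects.
                      (trans (*-congˡ (below-d D (↓-lower d) (λ z∈ → z∈) p (suc q)))
                             (trans (*-congˡ (Σ-*ʳ _ _ _)) (Σ-*ˡ _ _ _))) ⟩
          _ ∎
          where
          distribute : ∀ Y → v * u d * E p D * Σ⟨ Y ⟩ (h (suc q)) ≈ Σ⟨ Y ⟩ (λ a → right a p q)
          distribute Y = trans (Σ-*ˡ Y _ _) (Σ-cong Y (λ _ →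
            solve 5 (λ v d s a t → v :* d :* s :* (a :* t) ⊜ v :* (d :* s :* a) :* t) refl _ _ _ _ _))
        expand : ∀ p q →
          u x * E (suc p) X * (u c * h (suc q) d) + u c * h (suc p) d * (u x * E (suc q) X) ≈
          Σ⟨ X ∖ W ⟩ (λ a → u c * u x * h (suc p) a * (u d * E q D) + right a p q) +
          Σ⟨ W ∖ D ⟩ (λ a → v * h (suc p) a * (u d * E q D) + right a p q) +
          Σ⟨ D ⟩ (λ a → v * h (suc p) a * (u d * E q D) + v * u d * (h (suc q) a * E p D))
        expand p q = begin
          u x * E (suc p) X * (u c * h (suc q) d) + u c * h (suc p) d * (u x * E (suc q) X)
            ≈⟨ +-cong (first p q) (second p q) ⟩
          _ ≈⟨ solve 6 (λ a b c d e f → a :+ b :+ c :+ (d :+ e :+ f) ⊜ a :+ d :+ (b :+ e) :+ (c :+ f))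
                 refl _ _ _ _ _ _ ⟩
          _ ≈⟨ +-cong (+-cong (Σ-+ (X ∖ W) _ _) (Σ-+ (W ∖ D) _ _)) (Σ-+ D _ _) ⟨
          _ ∎

    step : ∀ Z → Lower Z → X ⊆ Z → x ∉ Z → (∀ {y} → y ∈ Z → ¬ (x ≺ y)) → Step Z x
    step Z lower X⊆Z x∉Z x-maximal = go
      where
      rest : ∀ c → SubsetOf
      rest c = ↓ c ∖ meet x c
      expandZ : ∀ q → E (suc q) Z ≈
        E (suc q) X + Σ⟨ Z ∖ X ⟩ (λ c → u c * E q (meet x c) + Σ⟨ rest c ⟩ (λ d → u c * h q d))
      expandZ q = trans (Σ-split Z X _ X⊆Z) (+-congˡ (Σ-cong (Z ∖ X) (λ {c} _ → begin
        u c * E q (↓ c)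
          ≈⟨ *-congˡ (E-split q (↓ c) (meet x c) (λ z∈ → proj₂ (∩⁻ X (↓ c) z∈))) ⟩
        u c * (E q (meet x c) + Σ⟨ rest c ⟩ (h q))
          ≈⟨ distribˡ _ _ _ ⟩
        u c * E q (meet x c) + u c * Σ⟨ rest c ⟩ (h q)
          ≈⟨ +-congˡ (Σ-*ˡ _ _ _) ⟩
        u c * E q (meet x c) + Σ⟨ rest c ⟩ (λ d → u c * h q d)
          ∎)))
      part : A → ℕ → ℕ → K
      part c p q = u x * E p X * (u c * E q (meet x c)) + u c * E p (meet x c) * (u x * E q X)
        + Σ⟨ rest c ⟩ (λ d → u x * E p X * (u c * h q d) + u c * h p d * (u x * E q X))
      expand : ∀ p q → h (suc p) x * E (suc q) Z + E (suc p) Z * h (suc q) x ≈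
        u x * E p X * E (suc q) X + E (suc p) X * (u x * E q X) + Σ⟨ Z ∖ X ⟩ (λ c → part c p q)
      expand p q = begin
        u x * E p X * E (suc q) Z + E (suc p) Z * (u x * E q X)
          ≈⟨ +-cong (*-congˡ (expandZ q)) (*-congʳ (expandZ p)) ⟩
        u x * E p X * (E (suc q) X + _) + (E (suc p) X + _) * (u x * E q X)
          ≈⟨ solve 6 (λ a b c d e f → a :* (b :+ c) :+ (d :+ e) :* f ⊜ a :* b :+ d :* f :+ (a :* c :+ e :* f))
               refl _ _ _ _ _ _ ⟩
        _ ≈⟨ +-congˡ (+-cong (Σ-*ˡ _ _ _) (Σ-*ʳ _ _ _)) ⟩
        _ ≈⟨ +-congˡ (Σ-+ (Z ∖ X) _ _) ⟨
        _ ≈⟨ +-congˡ (Σ-cong (Z ∖ X) (λ {c} _ → begin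
               _ ≈⟨ solve 6 (λ a b c d e f → a :* (b :+ c) :+ (d :+ e) :* f ⊜ a :* b :+ d :* f :+ (a :* c :+ e :* f))
                      refl _ _ _ _ _ _ ⟩
               _ ≈⟨ +-congˡ (+-cong (Σ-*ˡ _ _ _) (Σ-*ʳ _ _ _)) ⟩
               _ ≈⟨ +-congˡ (Σ-+ (rest c) _ _) ⟨
               part c p q ∎)) ⟩
        _ ∎
      incomparable : ∀ {c} → c ∈ Z ∖ X → c ∼ x
      incomparable {c} c∈ = let c∈Z , c∉X = ∖⁻ {c} Z X c∈ in ∉↓⁻ c∉X , x-maximal c∈Z
      symPart : ∀ {c} → c ∈ Z ∖ X → Symmetric (part c)
      symPart {c} c∈ = sym-+ (one-incomparable (incomparable c∈)) (sym-Σ (rest c) inner)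
        where
        inner : ∀ {d} → d ∈ rest c →
                Symmetric λ p q → u x * E p X * (u c * h q d) + u c * h p d * (u x * E q X)
        inner {d} d∈ = two-incomparable (↓⁻ d∈c) (incomparable c∈) (d⊀x , x-maximal (lower (↓⁻ d∈c) c∈Z))
          where
          c∈Z = proj₁ (∖⁻ {c} Z X c∈)
          d∈c = proj₁ (∖⁻ {d} (↓ c) (meet x c) d∈)
          d⊀x : ¬ (d ≺ x)
          d⊀x d≺x = ∈∉-absurd {d} {meet x c} (∩⁺ X (↓ c) (↓⁺ d≺x) d∈c) (proj₂ (∖⁻ {d} (↓ c) (meet x c) d∈))
      go : Step Z x
      go zero    zero    = refl
      go zero    (suc q) = solve 2 (λ y z → :0 :* z :+ :1 :* y ⊜ y :* :1 :+ z :* :0) refl _ _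
      go (suc p) zero    = solve 2 (λ y z → y :* :1 :+ z :* :0 ⊜ :0 :* z :+ :1 :* y) refl _ _
      go (suc p) (suc q) = sym-resp expand (sym-+ both-below (sym-Σ (Z ∖ X) symPart)) p q

  -- Induction on the number of elements, because adding x calls for commutation on every lower
  -- ideal inside ↓ x as well as on Z without x; all of them omit x and are smaller than Z.
  commute : ∀ Z → Lower Z → Commute Z
  commute Z lower = go (count Z) Z lower ℕ.≤-refl
    where
    go : ∀ n Z → Lower Z → count Z ℕ.≤ n → Commute Z
    go n Z lower bound with inhabited? Z
    ... | inj₂ none = empty
      where
      E-empty : ∀ p → E (suc p) Z ≈ 0#
      E-empty p = Σ-zero Z (λ {a} a∈ → ∈∉-absurd {a} {Z} a∈ (none a))
      empty : Commute Z
      empty zero    zero    = refl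
      empty zero    (suc q) = trans (*-identityˡ _) (sym (*-identityʳ _))
      empty (suc p) zero    = trans (*-identityʳ _) (sym (*-identityˡ _))
      empty (suc p) (suc q) = trans (*-congʳ (E-empty p))
        (trans (zeroˡ _) (sym (trans (*-congʳ (E-empty q)) (zeroˡ _))))
    go zero    Z lower bound | inj₁ (a , a∈Z) =
      ⊥-elim (ℕ.n≮0 (ℕ.<-≤-trans (count-strict Z (λ _ → false) (λ ()) a∈Z ≡.refl) bound))
    go (suc n) Z lower bound | inj₁ (a , a∈Z) with maximal Z a∈Z
    ... | x , x∈Z , x-max =
      step⇒commute Z Z′ (E-adjoin Z Z′ Z′⊆Z (∖⁺ {x} Z Z′ x∈Z x∉Z′) only)
        (AddMaximal.step below Z′ lower′ X⊆Z′ x∉Z′ (x-max ∘ Z′⊆Z))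
        (go n Z′ lower′ (smaller Z′ Z′⊆Z x∉Z′))
        (below (↓ x) (↓-lower x) (λ z∈ → z∈))
      where
      Z′ : SubsetOf
      Z′ = Z ∖ (λ a → does (a ≟ x))
      Z′⊆Z : Z′ ⊆ Z
      Z′⊆Z {a} a∈ = proj₁ (∖⁻ {a} Z (λ a → does (a ≟ x)) a∈)
      Z′⁺ : ∀ {a} → a ∈ Z → a ≢ x → a ∈ Z′
      Z′⁺ {a} a∈ a≢x = ∖⁺ {a} Z (λ a → does (a ≟ x)) a∈ (dec-false (a ≟ x) a≢x)
      x∉Z′ : x ∉ Z′
      x∉Z′ rewrite x∈Z | dec-true (x ≟ x) ≡.refl = ≡.refl
      only : ∀ {a} → a ∈ Z ∖ Z′ → a ≡ x
      only {a} a∈ = decidable-stable (a ≟ x) λ a≢x →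
        let p , q = ∖⁻ {a} Z Z′ a∈ in ∈∉-absurd {a} {Z′} (Z′⁺ p a≢x) q
      smaller : ∀ Y → Y ⊆ Z → x ∉ Y → count Y ℕ.≤ n
      smaller Y Y⊆Z x∉Y = ℕ.≤-pred (ℕ.≤-trans (count-strict Z Y Y⊆Z x∈Z x∉Y) bound)
      X⊆Z : ↓ x ⊆ Z
      X⊆Z a∈ = lower (↓⁻ a∈) x∈Z
      X⊆Z′ : ↓ x ⊆ Z′
      X⊆Z′ a∈ = Z′⁺ (X⊆Z a∈) (λ { ≡.refl → ≺-irr (↓⁻ a∈) })
      lower′ : Lower Z′
      lower′ a≺b b∈ = Z′⁺ (lower a≺b (Z′⊆Z b∈)) (λ { ≡.refl → x-max (Z′⊆Z b∈) a≺b })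
      below : CommuteBelow x
      below Y lowerY Y⊆X = go n Y lowerY
        (smaller Y (X⊆Z ∘ Y⊆X) (¬∈⇒∉ {x} Y (λ x∈Y → ≺-irr (↓⁻ (Y⊆X x∈Y)))))

  -- Peeling off a diagonal

  full : ℕ → SubsetOf → Row
  full m Y p = E (m ℕ.+ p) Y

  -- By `E-split` this is the difference of the full rows of Y and Y₀ when Y₀ ⊆ Y.
  part : ℕ → SubsetOf → SubsetOf → Row
  part m Y₀ Y p = Σ⟨ Y ∖ Y₀ ⟩ (h (m ℕ.+ p))

  restricted : ℕ → SubsetOf → List SubsetOf → List Row
  restricted m Y₀ []       = []
  restricted m Y₀ (Y ∷ Ys) = part m Y₀ Y ∷ restricted m Y Ys

  -- For Y = ↓ x this is `below-third`. It puts the tail of a chain with top letter in Y below every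
  -- top letter outside Y, so that the latter can pass it.
  Saturated : SubsetOf → Set
  Saturated Y = ∀ {t z s} → t ∈ Y → z ≺ t → s ∉ Y → z ≺ s

  ↓-saturated : ∀ x → Saturated (↓ x)
  ↓-saturated x t∈ z≺t s∉ = below-third (↓⁻ t∈) z≺t (∉↓⁻ s∉)

  -- The conditions concern every ideal but the last: along a diagonal only the last box can be at
  -- the bottom of its column, where the ideal is Z c instead of some ↓ x.
  data Good (Y₀ : SubsetOf) : List SubsetOf → Set where
    []   : Good Y₀ []
    cons : ∀ {Y Ys} → Lower Y₀ → Saturated Y₀ → Y₀ ⊆ Y → Good Y Ys → Good Y₀ (Y ∷ Ys)

  GoodList : List SubsetOf → Set
  GoodList []       = ⊤
  GoodList (Y ∷ Ys) = Good Y Ys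

  good-tail : ∀ {Y₀ Ys} → Good Y₀ Ys → GoodList Ys
  good-tail []             = tt
  good-tail (cons _ _ _ g) = g

  -- Two adjacent equal rows can be subtracted off since the E p Y commute.
  restrict : ∀ m pre Y Ys Ns → Good Y Ys →
    det (pre ++ List.map (full m) (Y ∷ Ys) ++ Ns) ≈ det (pre ++ full m Y ∷ restricted m Y Ys ++ Ns)
  restrict m pre Y₀ []       Ns []                             = refl
  restrict m pre Y₀ (Y ∷ Ys) Ns (cons lower saturated Y₀⊆Y good) = begin
    det (pre ++ full m Y₀ ∷ full m Y ∷ List.map (full m) Ys ++ Ns)
      ≈⟨ reflexive (≡.cong det (List.++-assoc pre (full m Y₀ ∷ []) _)) ⟨
    det (pre′ ++ full m Y ∷ List.map (full m) Ys ++ Ns)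
      -- Later rows are treated first, since the row of Y has to be intact while it is subtracted
      -- from its successor.
      ≈⟨ restrict m pre′ Y Ys Ns good ⟩
    det (pre′ ++ full m Y ∷ post)
      ≈⟨ det-cong (Pointwise.++⁺ (≋-refl {pre′})
           ((λ p → trans (E-split (m ℕ.+ p) Y Y₀ Y₀⊆Y) (+-comm _ _)) ∷ ≋-refl {post})) ⟩
    det (pre′ ++ (λ p → part m Y₀ Y p + full m Y₀ p) ∷ post)
      ≈⟨ det-+ pre′ (part m Y₀ Y) (full m Y₀) post ⟩
    det (pre′ ++ part m Y₀ Y ∷ post) + det (pre′ ++ full m Y₀ ∷ post)
      ≈⟨ +-congˡ (reflexive (≡.cong det (List.++-assoc pre (full m Y₀ ∷ []) _))) ⟩
    det (pre′ ++ part m Y₀ Y ∷ post) + det (pre ++ full m Y₀ ∷ full m Y₀ ∷ post)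
      ≈⟨ +-congˡ (det-alternating pre (full m Y₀) post λ p q → commute Y₀ lower (m ℕ.+ p) (m ℕ.+ q)) ⟩
    det (pre′ ++ part m Y₀ Y ∷ post) + 0#
      ≈⟨ +-identityʳ _ ⟩
    det (pre′ ++ part m Y₀ Y ∷ post)
      ≈⟨ reflexive (≡.cong det (List.++-assoc pre (full m Y₀ ∷ []) _)) ⟩
    det (pre ++ full m Y₀ ∷ part m Y₀ Y ∷ post)
      ∎
    where
    pre′ = pre ++ full m Y₀ ∷ []
    post = restricted m Y Ys ++ Ns

  ∅ : SubsetOf
  ∅ a = false

  -- The first box of the diagonal has no left neighbour, so its full row is already restricted,
  -- relative to ∅. This holds in positive degree; in degree 0 the full entry is 1 but its part is
  -- 0.
  restrict-∅ : ∀ m Ys Ns → GoodList Ys →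
    det (List.map (full (suc m)) Ys ++ Ns) ≈ det (restricted (suc m) ∅ Ys ++ Ns)
  restrict-∅ m []       Ns _    = refl
  restrict-∅ m (Y ∷ Ys) Ns good = trans (restrict (suc m) [] Y Ys Ns good)
    (det-cong {full (suc m) Y ∷ rest} {part (suc m) ∅ Y ∷ rest}
      ((λ p → Σ-≐ (h (suc m ℕ.+ p)) Y≐Y∖∅) ∷ ≋-refl))
    where
    rest = restricted (suc m) Y Ys ++ Ns
    Y≐Y∖∅ : ∀ a → Y a ≡ (Y ∖ ∅) a
    Y≐Y∖∅ = ≐-from-⊆ {Y} {Y ∖ ∅} (λ {a} a∈ → ∖⁺ {a} Y ∅ a∈ ≡.refl) (λ {a} a∈ → proj₁ (∖⁻ {a} Y ∅ a∈))

  uword : List A → K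
  uword []       = 1#
  uword (t ∷ ts) = u t * uword ts

  Σtuples : SubsetOf → List SubsetOf → (List A → K) → K
  Σtuples Y₀ []       F = F []
  Σtuples Y₀ (Y ∷ Ys) F = Σ⟨ Y ∖ Y₀ ⟩ λ t → Σtuples Y Ys (F ∘ (t ∷_))

  data Tuple (Y₀ : SubsetOf) : List SubsetOf → List A → Set where
    []   : Tuple Y₀ [] []
    cons : ∀ {Y Ys t ts} → t ∈ Y → t ∉ Y₀ → Tuple Y Ys ts → Tuple Y₀ (Y ∷ Ys) (t ∷ ts)

  tuple-length : ∀ {Y₀ Ys ts} → Tuple Y₀ Ys ts → length ts ≡ length Ys
  tuple-length []           = ≡.refl
  tuple-length (cons _ _ v) = ≡.cong suc (tuple-length v)

  Σtuples-cong : ∀ Y₀ Ys {F G} → (∀ {ts} → Tuple Y₀ Ys ts → F ts ≈ G ts) → Σtuples Y₀ Ys F ≈ Σtuples Y₀ Ys G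
  Σtuples-cong Y₀ []       F≈G = F≈G []
  Σtuples-cong Y₀ (Y ∷ Ys) F≈G = Σ-cong (Y ∖ Y₀) λ {t} t∈ →
    let t∈Y , t∉Y₀ = ∖⁻ {t} Y Y₀ t∈ in Σtuples-cong Y Ys λ v → F≈G (cons t∈Y t∉Y₀ v)

  Σtuples-*ˡ : ∀ Y₀ Ys y F → y * Σtuples Y₀ Ys F ≈ Σtuples Y₀ Ys (λ ts → y * F ts)
  Σtuples-*ˡ Y₀ []       y F = refl
  Σtuples-*ˡ Y₀ (Y ∷ Ys) y F = trans (Σ-*ˡ (Y ∖ Y₀) y _) (Σ-cong (Y ∖ Y₀) λ _ → Σtuples-*ˡ Y Ys y _)

  Σ-sum : ∀ Z {B : Set} (xs : List B) (f : A → B → K) →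
          sum xs (λ x → Σ⟨ Z ⟩ λ a → f a x) ≈ Σ⟨ Z ⟩ λ a → sum xs (f a)
  Σ-sum Z xs f = trans (sum-swap xs elements _) (sum-cong elements pointwise)
    where
    pointwise : ∀ a → sum xs (λ x → guard (Z a) (f a x)) ≈ guard (Z a) (sum xs (f a))
    pointwise a with Z a
    ... | true  = refl
    ... | false = sum-zero xs λ _ → refl

  Σtuples-sum : ∀ Y₀ Ys {B : Set} (xs : List B) (F : List A → B → K) →
                sum xs (λ x → Σtuples Y₀ Ys λ ts → F ts x) ≈ Σtuples Y₀ Ys λ ts → sum xs (F ts)
  Σtuples-sum Y₀ []       xs F = refl
  Σtuples-sum Y₀ (Y ∷ Ys) xs F = trans (Σ-sum (Y ∖ Y₀) xs _)
    (Σ-cong (Y ∖ Y₀) λ _ → Σtuples-sum Y Ys xs _)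

  -- The next top letter t lies outside the ideal Y that contains b. Hence t ⊀ b as Y is lower, and
  -- Z lies below t as Y is saturated: these are the conditions of `pass`.
  pass-tuple : ∀ k Z {b Y Ys ts} → (∀ {z} → z ∈ Z → z ≺ b) → b ∈ Y → Good Y Ys → Tuple Y Ys ts →
               u b * E k Z * uword ts ≈ u b * uword ts * E k Z
  pass-tuple k Z {b} Z≺b b∈Y [] [] = solve 2 (λ b z → b :* z :* :1 ⊜ b :* :1 :* z) refl _ _
  pass-tuple k Z {b} {Y₀} Z≺b b∈Y (cons lower saturated _ good) (cons {t = t} {ts = ts} t∈ t∉ v) = begin
    u b * E k Z * (u t * uword ts)
      ≈⟨ *-assoc _ _ _ ⟨
    u b * E k Z * u t * uword ts
      ≈⟨ *-congʳ (pass b t Z (λ z∈ → Z≺b z∈ , Z≺t z∈) (λ t≺b → ∈∉-absurd {t} {Y₀} (lower t≺b b∈Y) t∉) k) ⟩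
    u b * u t * E k Z * uword ts
      ≈⟨ solve 4 (λ b t z w → b :* t :* z :* w ⊜ b :* (t :* z :* w)) refl _ _ _ _ ⟩
    u b * (u t * E k Z * uword ts)
      ≈⟨ *-congˡ (pass-tuple k Z Z≺t t∈ good v) ⟩
    u b * (u t * uword ts * E k Z)
      ≈⟨ *-assoc _ _ _ ⟨
    u b * (u t * uword ts) * E k Z
      ∎
    where
    Z≺t : ∀ {z} → z ∈ Z → z ≺ t
    Z≺t z∈ = saturated b∈Y (Z≺b z∈) t∉

  -- Stated for expansions, because the rows left after the first letter is chosen form no
  -- determinant. Each row gives up its top letter t; the tail of the chain moves right past the
  -- later top letters and becomes an entry of the new row of ↓ t.
  peel-expansion : ∀ n m Y₀ Ys Ns φ → GoodList Ys →
    expansion n (restricted (suc m) Y₀ Ys ++ Ns) φ ≈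
    Σtuples Y₀ Ys λ ts → uword ts * expansion n (List.map (full m ∘ ↓_) ts ++ Ns) φ
  peel-expansion n m Y₀ []       Ns φ _    = sym (*-identityˡ _)
  peel-expansion n m Y₀ (Y ∷ Ys) Ns φ good = begin
    sum (range n) (λ p → part (suc m) Y₀ Y p * expansion n (restricted (suc m) Y Ys ++ Ns) (φ ∘ (p ∷_)))
      ≈⟨ sum-cong (range n) (λ p → trans (Σ-*ʳ (Y ∖ Y₀) _ _) (Σ-cong (Y ∖ Y₀) (λ {t} t∈ → factor p (∖⁻ {t} Y Y₀ t∈)))) ⟩
    sum (range n) (λ p → Σ⟨ Y ∖ Y₀ ⟩ λ t → Σtuples Y Ys λ ts →
      uword (t ∷ ts) * (full m (↓ t) p * rest ts p))
      ≈⟨ Σ-sum (Y ∖ Y₀) (range n) _ ⟩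
    Σ⟨ Y ∖ Y₀ ⟩ (λ t → sum (range n) λ p → Σtuples Y Ys λ ts →
      uword (t ∷ ts) * (full m (↓ t) p * rest ts p))
      ≈⟨ Σ-cong (Y ∖ Y₀) (λ {t} _ → trans (Σtuples-sum Y Ys (range n) _)
           (Σtuples-cong Y Ys (λ {ts} _ → sym (sum-*ˡ (range n) (uword (t ∷ ts)) _)))) ⟩
    Σ⟨ Y ∖ Y₀ ⟩ (λ t → Σtuples Y Ys λ ts →
      uword (t ∷ ts) * sum (range n) (λ p → full m (↓ t) p * rest ts p))
      ∎
    where
    rest : List A → ℕ → K
    rest ts p = expansion n (List.map (full m ∘ ↓_) ts ++ Ns) (φ ∘ (p ∷_))
    factor : ∀ p {t} → t ∈ Y × t ∉ Y₀ →
      h (suc m ℕ.+ p) t * expansion n (restricted (suc m) Y Ys ++ Ns) (φ ∘ (p ∷_)) ≈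
      Σtuples Y Ys λ ts → uword (t ∷ ts) * (full m (↓ t) p * rest ts p)
    factor p {t} (t∈Y , _) = begin
      u t * full m (↓ t) p * expansion n (restricted (suc m) Y Ys ++ Ns) (φ ∘ (p ∷_))
        ≈⟨ *-congˡ (peel-expansion n m Y Ys Ns (φ ∘ (p ∷_)) (good-tail good)) ⟩
      u t * full m (↓ t) p * Σtuples Y Ys (λ ts → uword ts * rest ts p)
        ≈⟨ Σtuples-*ˡ Y Ys _ _ ⟩
      Σtuples Y Ys (λ ts → u t * full m (↓ t) p * (uword ts * rest ts p))
        ≈⟨ Σtuples-cong Y Ys (λ {ts} v → begin
             u t * full m (↓ t) p * (uword ts * rest ts p)
               ≈⟨ *-assoc _ _ _ ⟨
             u t * full m (↓ t) p * uword ts * rest ts p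
               ≈⟨ *-congʳ (pass-tuple (m ℕ.+ p) (↓ t) ↓⁻ t∈Y good v) ⟩
             u t * uword ts * full m (↓ t) p * rest ts p
               ≈⟨ *-assoc _ _ _ ⟩
             u t * uword ts * (full m (↓ t) p * rest ts p)
               ∎) ⟩
      Σtuples Y Ys (λ ts → u t * uword ts * (full m (↓ t) p * rest ts p))
        ∎

  peel : ∀ m Y₀ Ys Ns → GoodList Ys →
    det (restricted (suc m) Y₀ Ys ++ Ns) ≈
    Σtuples Y₀ Ys λ ts → uword ts * det (List.map (full m ∘ ↓_) ts ++ Ns)
  peel m Y₀ Ys Ns good = trans (peel-expansion _ m Y₀ Ys Ns ε good)
    (Σtuples-cong Y₀ Ys λ {ts} v → *-congˡ (reflexive
      (≡.cong (λ n → expansion n (List.map (full m ∘ ↓_) ts ++ Ns) ε) (lengths v))))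
    where
    restricted-length : ∀ Y₀ Ys → length (restricted (suc m) Y₀ Ys) ≡ length Ys
    restricted-length Y₀ []       = ≡.refl
    restricted-length Y₀ (Y ∷ Ys) = ≡.cong suc (restricted-length Y Ys)
    lengths : ∀ {ts} → Tuple Y₀ Ys ts →
              length (restricted (suc m) Y₀ Ys ++ Ns) ≡ length (List.map (full m ∘ ↓_) ts ++ Ns)
    lengths {ts} v = ≡.trans (List.length-++ (restricted (suc m) Y₀ Ys))
      (≡.trans (≡.cong (ℕ._+ length Ns)
                 (≡.trans (restricted-length Y₀ Ys)
                   (≡.trans (≡.sym (tuple-length v)) (≡.sym (List.length-map (full m ∘ ↓_) ts)))))
               (≡.sym (List.length-++ (List.map (full m ∘ ↓_) ts))))

  -- A partial filling of the quadrant, independent of any shape: between two diagonals the filled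
  -- boxes do not form a diagram.
  Env : Set
  Env = ℕ → ℕ → Maybe A

  assign : Env → ℕ → ℕ → A → Env
  assign σ c r t c′ r′ = if does (c′ ℕ.≟ c) ∧ does (r′ ℕ.≟ r) then just t else σ c′ r′

  assign-here : ∀ σ c r t → assign σ c r t c r ≡ just t
  assign-here σ c r t rewrite dec-true (c ℕ.≟ c) ≡.refl | dec-true (r ℕ.≟ r) ≡.refl = ≡.refl

  assign-column : ∀ σ c r t {c′} r′ → c′ ≢ c → assign σ c r t c′ r′ ≡ σ c′ r′
  assign-column σ c r t {c′} r′ c′≢c rewrite dec-false (c′ ℕ.≟ c) c′≢c = ≡.refl

  assign-row : ∀ σ c r t c′ {r′} → r′ ≢ r → assign σ c r t c′ r′ ≡ σ c′ r′
  assign-row σ c r t c′ {r′} r′≢r with does (c′ ℕ.≟ c)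
  ... | true rewrite dec-false (r′ ℕ.≟ r) r′≢r = ≡.refl
  ... | false = ≡.refl

  -- The default ∅ is lower and saturated, so the argument need not record which boxes are filled.
  ↓? : Maybe A → SubsetOf
  ↓? nothing  = ∅
  ↓? (just x) = ↓ x

  ↓?-lower : ∀ x → Lower (↓? x)
  ↓?-lower (just x) = ↓-lower x

  ↓?-saturated : ∀ x → Saturated (↓? x)
  ↓?-saturated (just x) = ↓-saturated x

  Eᶻ : ℤ → SubsetOf → K
  Eᶻ (+ k)    Z = E k Z
  Eᶻ -[1+ _ ] Z = 0#

  Eᶻ-negative : ∀ {m n} Z → m ℕ.< n → Eᶻ (m ⊖ n) Z ≡ 0#
  Eᶻ-negative {m} {n} Z m<n =
    ≡.trans (≡.cong (λ j → Eᶻ j Z) (ℤ.⊖-< m<n)) (go (n ℕ.∸ m) (ℕ.m<n⇒0<n∸m m<n))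
    where
    go : ∀ k → 0 ℕ.< k → Eᶻ (ℤ.- (+ k)) Z ≡ 0#
    go (suc k) _ = ≡.refl

  -- Removing all diagonals from the determinant

  module Diagonals
    (α : ℕ → ℕ) (α-anti : ∀ c → α (suc c) ℕ.≤ α c) (Z : ℕ → SubsetOf)
    (Z-lower : ∀ c → Lower (Z c)) (Z-mono : ∀ c → Z c ⊆ Z (suc c)) where

    -- The elements that may sit directly above box (c , r), where column c
    -- is bounded from below by Z c.
    bound : Env → ℕ → ℕ → SubsetOf
    bound σ c r = if does (r ℕ.<? α c) then ↓? (σ c r) else Z c

    bound-inside : ∀ σ {c r} → r ℕ.< α c → bound σ c r ≡ ↓? (σ c r)
    bound-inside σ {c} {r} r<α rewrite dec-true (r ℕ.<? α c) r<α = ≡.refl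

    bound-outside : ∀ σ {c r} → α c ℕ.≤ r → bound σ c r ≡ Z c
    bound-outside σ {c} {r} α≤r rewrite dec-false (r ℕ.<? α c) (ℕ.≤⇒≯ α≤r) = ≡.refl

    bound-lower : ∀ σ c r → Lower (bound σ c r)
    bound-lower σ c r with does (r ℕ.<? α c)
    ... | true  = ↓?-lower (σ c r)
    ... | false = Z-lower c

    bound-cong : ∀ σ σ′ c r → σ c r ≡ σ′ c r → bound σ c r ≡ bound σ′ c r
    bound-cong σ σ′ c r eq = ≡.cong (λ x → if does (r ℕ.<? α c) then ↓? x else Z c) eq

    -- The letters that the entry to the left of box (c , r) rules out there.
    left-bound : Env → ℕ → ℕ → SubsetOf
    left-bound σ zero    r = ∅
    left-bound σ (suc c) r = bound σ c r

    cell-bounds : Env → ℕ → ℕ → ℕ → List SubsetOf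
    cell-bounds σ c r zero    = []
    cell-bounds σ c r (suc k) =
      if does (r ℕ.<? α c) then bound σ c (suc r) ∷ cell-bounds σ (suc c) (suc r) k else []

    -- The original row of column c. The row number i is kept apart from c because every application
    -- of `det-drop` lowers the row numbers by one.
    untouched : ℕ → ℕ → Row
    untouched i c p = Eᶻ (α c ℕ.+ p ⊖ i) (Z c)

    untouched-rows : ℕ → ℕ → ℕ → List Row
    untouched-rows i c zero    = []
    untouched-rows i c (suc k) = untouched i c ∷ untouched-rows (suc i) (suc c) k

    rest-rows : ℕ → ℕ → ℕ → ℕ → List Row
    rest-rows i c r zero    = []
    rest-rows i c r (suc k) =
      if does (r ℕ.<? α c) then rest-rows (suc i) (suc c) (suc r) k else untouched-rows i c (suc k)

    -- The state in which column c is filled from row r downwards. If r ≤ α c, then r boxes remain,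
    -- and r = i + m makes the degree r + p - i equal to m + p. The case r = α c is included: such a
    -- column is still empty, but its row already has this form.
    rows : Env → ℕ → ℕ → ℕ → ℕ → ℕ → List Row
    rows σ m i c r zero    = []
    rows σ m i c r (suc k) =
      (if does (r ℕ.≤? α c) then full m (bound σ c r) else untouched i c) ∷ rows σ m (suc i) (suc c) (suc r) k

    rows-untouched : ∀ σ m i c r k → α c ℕ.< r → rows σ m i c r k ≡ untouched-rows i c k
    rows-untouched σ m i c r zero    α<r = ≡.refl
    rows-untouched σ m i c r (suc k) α<r rewrite dec-false (r ℕ.≤? α c) (ℕ.<⇒≱ α<r) =
      ≡.cong (untouched i c ∷_)
        (rows-untouched σ m (suc i) (suc c) (suc r) k (ℕ.≤-<-trans (α-anti c) (ℕ.m<n⇒m<1+n α<r)))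

    -- Since r + 1 ≤ α c is the same as r < α c, the rows of the form `full m` are exactly those of
    -- the boxes on the diagonal about to be removed.
    rows-split : ∀ σ m i c r k →
      rows σ m i c (suc r) k ≡ List.map (full m) (cell-bounds σ c r k) ++ rest-rows i c r k
    rows-split σ m i c r zero    = ≡.refl
    rows-split σ m i c r (suc k) with r ℕ.<ᵇ α c | inside? r (α c)
    ... | _ | inside r<α = ≡.cong (full m (bound σ c (suc r)) ∷_) (rows-split σ m (suc i) (suc c) (suc r) k)
    ... | _ | outside α≤r = ≡.cong (untouched i c ∷_)
            (rows-untouched σ m (suc i) (suc c) (suc (suc r)) k
              (ℕ.s≤s (ℕ.m≤n⇒m≤1+n (ℕ.≤-trans (α-anti c) α≤r))))

    assignAll : Env → ℕ → ℕ → List A → Env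
    assignAll σ c r []       = σ
    assignAll σ c r (t ∷ ts) = assignAll (assign σ c r t) (suc c) (suc r) ts

    assignAll-before : ∀ σ c r ts {c′} r′ → c′ ℕ.< c → assignAll σ c r ts c′ r′ ≡ σ c′ r′
    assignAll-before σ c r []       r′ c′<c = ≡.refl
    assignAll-before σ c r (t ∷ ts) r′ c′<c =
      ≡.trans (assignAll-before (assign σ c r t) (suc c) (suc r) ts r′ (ℕ.m<n⇒m<1+n c′<c))
              (assign-column σ c r t r′ (ℕ.<⇒≢ c′<c))

    assignAll-here : ∀ σ c r t ts → assignAll σ c r (t ∷ ts) c r ≡ just t
    assignAll-here σ c r t ts =
      ≡.trans (assignAll-before (assign σ c r t) (suc c) (suc r) ts r ℕ.≤-refl) (assign-here σ c r t)

    AgreeFrom : ℕ → Env → Env → Set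
    AgreeFrom c σ σ′ = ∀ {c′} r → c ℕ.≤ c′ → σ c′ r ≡ σ′ c′ r

    cell-bounds-cong : ∀ σ σ′ c r k → AgreeFrom c σ σ′ → cell-bounds σ c r k ≡ cell-bounds σ′ c r k
    cell-bounds-cong σ σ′ c r zero    agree = ≡.refl
    cell-bounds-cong σ σ′ c r (suc k) agree =
      ≡.cong₂ (λ Y Ys → if does (r ℕ.<? α c) then Y ∷ Ys else [])
        (bound-cong σ σ′ c (suc r) (agree (suc r) ℕ.≤-refl))
        (cell-bounds-cong σ σ′ (suc c) (suc r) k (λ r′ c<c′ → agree r′ (ℕ.<⇒≤ c<c′)))

    assign-agree : ∀ σ c r t → AgreeFrom (suc c) (assign σ c r t) σ
    assign-agree σ c r t r′ c<c′ = assign-column σ c r t r′ (ℕ.>⇒≢ c<c′)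

    -- Y₀ is the ideal of the previous column. That the ideals grow along the diagonal is needed to
    -- subtract neighbouring rows; the inclusion in Z c keeps the entries of column c in Z c.
    Invariant : Env → SubsetOf → ℕ → ℕ → ℕ → Set
    Invariant σ Y₀ c r zero    = ⊤
    Invariant σ Y₀ c r (suc k) =
      bound σ c r ⊆ Z c × (r ℕ.≤ α c → Y₀ ⊆ bound σ c r) × Invariant σ (bound σ c r) (suc c) (suc r) k

    invariant-cong : ∀ σ σ′ Y₀ c r k → AgreeFrom c σ σ′ → Invariant σ′ Y₀ c r k → Invariant σ Y₀ c r k
    invariant-cong σ σ′ Y₀ c r zero    agree _ = tt
    invariant-cong σ σ′ Y₀ c r (suc k) agree inv
      rewrite bound-cong σ σ′ c r (agree r ℕ.≤-refl) =
      let inZ , chain , rest = inv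
      in inZ , chain , invariant-cong σ σ′ _ (suc c) (suc r) k (λ r′ c<c′ → agree r′ (ℕ.<⇒≤ c<c′)) rest

    invariant-outside : ∀ σ Y₀ c r k → α c ℕ.≤ r → Y₀ ⊆ Z c → Invariant σ Y₀ c r k
    invariant-outside σ Y₀ c r zero    α≤r Y₀⊆ = tt
    invariant-outside σ Y₀ c r (suc k) α≤r Y₀⊆ rewrite bound-outside σ α≤r =
      (λ a∈ → a∈) , (λ _ → Y₀⊆) ,
      invariant-outside σ (Z c) (suc c) (suc r) k (ℕ.m≤n⇒m≤1+n (ℕ.≤-trans (α-anti c) α≤r)) (Z-mono c)

    inside-saturated : ∀ σ {c r} → r ℕ.< α c → Saturated (bound σ c r)
    inside-saturated σ {c} {r} r<α rewrite bound-inside σ {c} {r} r<α = ↓?-saturated (σ c r)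

    invariant-good : ∀ σ Y₀ c r k → Lower Y₀ → (r ℕ.< α c → Saturated Y₀) →
                     Invariant σ Y₀ c (suc r) k → Good Y₀ (cell-bounds σ c r k)
    invariant-good σ Y₀ c r zero    lower saturated inv = []
    invariant-good σ Y₀ c r (suc k) lower saturated (_ , chain , inv) with r ℕ.<ᵇ α c | inside? r (α c)
    ... | _ | outside _  = []
    ... | _ | inside r<α = cons lower (saturated r<α) (chain r<α)
      (invariant-good σ _ (suc c) (suc r) k (bound-lower σ c (suc r))
        (λ r<α′ → inside-saturated σ (ℕ.<-≤-trans r<α′ (α-anti c))) inv)

    invariant-goodList : ∀ σ Y₀ c r k → Invariant σ Y₀ c (suc r) k → GoodList (cell-bounds σ c r k)
    invariant-goodList σ Y₀ c r zero    inv = tt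
    invariant-goodList σ Y₀ c r (suc k) (_ , _ , inv) with r ℕ.<ᵇ α c | inside? r (α c)
    ... | _ | outside _  = tt
    ... | _ | inside r<α = invariant-good σ _ (suc c) (suc r) k (bound-lower σ c (suc r))
        (λ r<α′ → inside-saturated σ (ℕ.<-≤-trans r<α′ (α-anti c))) inv

    -- The new ideals ↓ t grow again: the previous letter lies in Y₀ and t does not, so by
    -- saturation all that is below the previous letter is below t. The last hypothesis is this fact
    -- for Y₁, the new ideal of the previous column.
    invariant-assign : ∀ σ Y₀ Y₁ c r k ts → Tuple Y₀ (cell-bounds σ c r k) ts →
      ∀ {Y} → Invariant σ Y c (suc r) k → Y₁ ⊆ Z c →
      (r ℕ.< α c → ∀ {z s} → z ∈ Y₁ → s ∉ Y₀ → z ≺ s) →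
      Invariant (assignAll σ c r ts) Y₁ c r k
    invariant-assign σ Y₀ Y₁ c r zero    ts v inv Y₁⊆ below = tt
    invariant-assign σ Y₀ Y₁ c r (suc k) ts v (inZ , _ , inv) Y₁⊆ below = go ts (inside? r (α c)) v
      where
      Ys = cell-bounds σ (suc c) (suc r) k
      go : ∀ ts {b} → Inside r (α c) b → Tuple Y₀ (if b then bound σ c (suc r) ∷ Ys else []) ts →
           Invariant (assignAll σ c r ts) Y₁ c r (suc k)
      go [] (outside α≤r) [] = invariant-outside σ Y₁ c r (suc k) α≤r Y₁⊆
      go (t ∷ ts) (inside r<α) (cons t∈ t∉ v) =
        ≡.subst (λ Y → Y ⊆ Z c × (r ℕ.≤ α c → Y₁ ⊆ Y) × Invariant σ′ Y (suc c) (suc r) k) (≡.sym bound≡)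
          ( ↓t⊆Z
          , (λ _ z∈ → ↓⁺ (below r<α z∈ t∉))
          , invariant-assign (assign σ c r t) (bound σ c (suc r)) (↓ t) (suc c) (suc r) k ts
              (≡.subst (λ Ys → Tuple _ Ys ts)
                (≡.sym (cell-bounds-cong (assign σ c r t) σ (suc c) (suc r) k (assign-agree σ c r t))) v)
              (invariant-cong (assign σ c r t) σ _ (suc c) (suc (suc r)) k (assign-agree σ c r t) inv)
              (λ z∈ → Z-mono c (↓t⊆Z z∈))
              (λ r<α′ z∈ s∉ → inside-saturated σ (ℕ.<-≤-trans r<α′ (α-anti c)) t∈ (↓⁻ z∈) s∉))
        where
        σ′ = assignAll σ c r (t ∷ ts)
        bound≡ : bound σ′ c r ≡ ↓ t
        bound≡ = ≡.trans (bound-inside σ′ r<α) (≡.cong ↓? (assignAll-here σ c r t ts))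
        ↓t⊆Z : ↓ t ⊆ Z c
        ↓t⊆Z z∈ = Z-lower c (↓⁻ z∈) (inZ t∈)

    -- The diagonal passes just below the column, which thus has all its α c boxes left; as α c + p
    -- - i = m + p, its row joins the full ones for the next diagonal.
    untouched-reached : ∀ i m c p → α c ≡ i ℕ.+ m → untouched i c p ≡ E (m ℕ.+ p) (Z c)
    untouched-reached i m c p eq = ≡.cong (λ k → Eᶻ k (Z c))
      (≡.trans (≡.cong (λ a → a ℕ.+ p ⊖ i) eq)
        (≡.trans (≡.cong (_⊖ i) (ℕ.+-assoc i m p))
          (≡.trans (ℤ.⊖-≥ (ℕ.m≤m+n i (m ℕ.+ p))) (≡.cong +_ (ℕ.m+n∸m≡n i (m ℕ.+ p))))))

    rows-assigned : ∀ σ m i c r k {Y₀} ts → r ≡ i ℕ.+ m → Tuple Y₀ (cell-bounds σ c r k) ts →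
      (List.map (full m ∘ ↓_) ts ++ rest-rows i c r k) ≋ rows (assignAll σ c r ts) m i c r k
    rows-assigned σ m i c r zero    [] r≡ [] = []
    rows-assigned σ m i c r (suc k) ts r≡ v with r ℕ.<ᵇ α c | inside? r (α c)
    rows-assigned σ m i c r (suc k) [] r≡ [] | _ | outside α≤r
      rewrite rows-untouched σ m (suc i) (suc c) (suc r) k (ℕ.s≤s (ℕ.≤-trans (α-anti c) α≤r))
      with r ℕ.≤? α c
    ... | no  r≰α rewrite dec-false (r ℕ.≤? α c) r≰α = ≋-refl
    ... | yes r≤α rewrite dec-true (r ℕ.≤? α c) r≤α = (λ p → reflexive
            (untouched-reached i m c p (≡.trans (ℕ.≤-antisym α≤r r≤α) r≡))) ∷ ≋-refl
    rows-assigned σ m i c r (suc k) (t ∷ ts) r≡ (cons _ _ v) | _ | inside r<α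
      rewrite dec-true (r ℕ.≤? α c) (ℕ.<⇒≤ r<α) =
      (λ p → reflexive (≡.cong (E (m ℕ.+ p) ∘ ↓?) (≡.sym (assignAll-here σ c r t ts)))) ∷
      rows-assigned (assign σ c r t) m (suc i) (suc c) (suc r) k ts (≡.cong suc r≡)
        (≡.subst (λ Ys → Tuple _ Ys ts)
          (≡.sym (cell-bounds-cong (assign σ c r t) σ (suc c) (suc r) k (assign-agree σ c r t))) v)

    -- A letter is tested only against the boxes below and to the left. Both belong to the preceding
    -- diagonal, so in reading order they are filled before.
    tableaux : List (ℕ × ℕ) → Env → K
    tableaux []             σ = 1#
    tableaux ((c , r) ∷ bs) σ =
      Σ⟨ bound σ c (suc r) ∖ left-bound σ c r ⟩ λ t → u t * tableaux bs (assign σ c r t)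

    -- The box below one box of a diagonal is the left neighbour of the next box on it. Hence the
    -- same ideal bounds one letter from above and is the set excluded for the next.
    tableaux-cells : ∀ c r k bs σ →
      tableaux (cells α c r k ++ bs) σ ≈
      Σtuples (left-bound σ c r) (cell-bounds σ c r k) (λ ts → uword ts * tableaux bs (assignAll σ c r ts))
    tableaux-cells c r zero    bs σ = sym (*-identityˡ _)
    tableaux-cells c r (suc k) bs σ with r ℕ.<ᵇ α c | inside? r (α c)
    ... | _ | outside _ = sym (*-identityˡ _)
    ... | _ | inside _  = Σ-cong (bound σ c (suc r) ∖ left-bound σ c r) λ {t} _ → begin
      u t * tableaux (cells α (suc c) (suc r) k ++ bs) (assign σ c r t)
        ≈⟨ *-congˡ (tableaux-cells (suc c) (suc r) k bs (assign σ c r t)) ⟩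
      u t * Σtuples (bound (assign σ c r t) c (suc r)) (cell-bounds (assign σ c r t) (suc c) (suc r) k) (F t)
        ≈⟨ *-congˡ (reflexive (≡.cong₂ (λ Y Ys → Σtuples Y Ys (F t))
             (bound-cong (assign σ c r t) σ c (suc r) (assign-row σ c r t c ℕ.1+n≢n))
             (cell-bounds-cong (assign σ c r t) σ (suc c) (suc r) k (assign-agree σ c r t)))) ⟩
      u t * Σtuples (bound σ c (suc r)) (cell-bounds σ (suc c) (suc r) k) (F t)
        ≈⟨ Σtuples-*ˡ (bound σ c (suc r)) (cell-bounds σ (suc c) (suc r) k) _ _ ⟩
      Σtuples (bound σ c (suc r)) (cell-bounds σ (suc c) (suc r) k) (λ ts → u t * F t ts)
        ≈⟨ Σtuples-cong (bound σ c (suc r)) (cell-bounds σ (suc c) (suc r) k) (λ _ → sym (*-assoc _ _ _)) ⟩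
      Σtuples (bound σ c (suc r)) (cell-bounds σ (suc c) (suc r) k)
        (λ ts → uword (t ∷ ts) * tableaux bs (assignAll σ c r (t ∷ ts)))
        ∎
      where
      F : A → List A → K
      F t ts = uword ts * tableaux bs (assignAll (assign σ c r t) (suc c) (suc r) ts)

    peel-diagonal : ∀ m c k bs σ {Y} → Invariant σ Y c (suc m) k →
      (∀ σ′ → Invariant σ′ ∅ c m k → det (rows σ′ m 0 c m k) ≈ tableaux bs σ′) →
      det (restricted (suc m) (left-bound σ c m) (cell-bounds σ c m k) ++ rest-rows 0 c m k) ≈
      tableaux (cells α c m k ++ bs) σ
    peel-diagonal m c k bs σ inv continue = begin
      det (restricted (suc m) (left-bound σ c m) Ys ++ rest-rows 0 c m k)
        ≈⟨ peel m _ Ys _ (invariant-goodList σ _ c m k inv) ⟩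
      Σtuples (left-bound σ c m) Ys (λ ts → uword ts * det (List.map (full m ∘ ↓_) ts ++ rest-rows 0 c m k))
        ≈⟨ Σtuples-cong (left-bound σ c m) Ys (λ {ts} v → *-congˡ (trans
             (det-cong (rows-assigned σ m 0 c m k ts ≡.refl v))
             (continue _ (invariant-assign σ _ ∅ c m k ts v inv (λ ()) (λ _ ()))))) ⟩
      Σtuples (left-bound σ c m) Ys (λ ts → uword ts * tableaux bs (assignAll σ c m ts))
        ≈⟨ tableaux-cells c m k bs σ ⟨
      tableaux (cells α c m k ++ bs) σ
        ∎
      where Ys = cell-bounds σ c m k

    restricted-shift : ∀ Y₀ Ys → List.map (_∘ suc) (restricted 0 Y₀ Ys) ≡ restricted 1 Y₀ Ys
    restricted-shift Y₀ []       = ≡.refl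
    restricted-shift Y₀ (Y ∷ Ys) = ≡.cong (part 1 Y₀ Y ∷_) (restricted-shift Y Ys)

    restricted-zero : ∀ Y₀ Ys → LAll.All (λ M → M 0 ≈ 0#) (restricted 0 Y₀ Ys)
    restricted-zero Y₀ []       = []
    restricted-zero Y₀ (Y ∷ Ys) = Σ-zero (Y ∖ Y₀) (λ _ → refl) ∷ restricted-zero Y Ys

    untouched-zero : ∀ i c k → α c ℕ.< i → LAll.All (λ M → M 0 ≈ 0#) (untouched-rows i c k)
    untouched-zero i c zero    α<i = []
    untouched-zero i c (suc k) α<i =
      negative ∷ untouched-zero (suc i) (suc c) k (ℕ.s≤s (ℕ.≤-trans (α-anti c) (ℕ.<⇒≤ α<i)))
      where
      α+0<i : α c ℕ.+ 0 ℕ.< i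
      α+0<i = ≡.subst (ℕ._< i) (≡.sym (ℕ.+-identityʳ (α c))) α<i
      negative : untouched i c 0 ≈ 0#
      negative = reflexive (Eᶻ-negative (Z c) α+0<i)

    -- Columns that the diagonal misses have α c ≤ r < i, so the degree α c - i at position 0 is
    -- negative.
    rest-zero : ∀ i c r k → r ℕ.< i → LAll.All (λ M → M 0 ≈ 0#) (rest-rows i c r k)
    rest-zero i c r zero    r<i = []
    rest-zero i c r (suc k) r<i with r ℕ.<ᵇ α c | inside? r (α c)
    ... | _ | inside _    = rest-zero (suc i) (suc c) (suc r) k (ℕ.s<s r<i)
    ... | _ | outside α≤r = untouched-zero i c (suc k) (ℕ.≤-<-trans α≤r r<i)

    untouched-shift : ∀ i c k → List.map (_∘ suc) (untouched-rows (suc i) c k) ≋ untouched-rows i c k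
    untouched-shift i c zero    = []
    untouched-shift i c (suc k) =
      (λ p → reflexive (≡.cong (λ j → Eᶻ j (Z c))
        (≡.trans (≡.cong (_⊖ suc i) (ℕ.+-suc (α c) p)) (ℤ.[1+m]⊖[1+n]≡m⊖n (α c ℕ.+ p) i))))
      ∷ untouched-shift (suc i) (suc c) k

    rest-shift : ∀ i c r k → List.map (_∘ suc) (rest-rows (suc i) c r k) ≋ rest-rows i c r k
    rest-shift i c r zero    = []
    rest-shift i c r (suc k) with does (r ℕ.<? α c)
    ... | true  = rest-shift (suc i) (suc c) (suc r) k
    ... | false = untouched-shift i c (suc k)

    -- Once the first remaining column is used up, the first letter of every
    -- word in the expansion has to be 0, and that column can be dropped.
    upper-tableaux : ∀ k c σ {Y} → Invariant σ Y c 0 k →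
                     det (rows σ 0 0 c 0 k) ≈ tableaux (upper-order α c k) σ
    upper-tableaux zero    c σ inv = refl
    upper-tableaux (suc k) c σ (_ , _ , inv) = begin
      det (full 0 Y ∷ rows σ 0 1 (suc c) 1 k)
        ≈⟨ reflexive (≡.cong (λ Ms → det (full 0 Y ∷ Ms)) (rows-split σ 0 1 (suc c) 0 k)) ⟩
      det (List.map (full 0) (Y ∷ Ys) ++ rest-rows 1 (suc c) 0 k)
        ≈⟨ restrict 0 [] Y Ys _ (invariant-good σ Y (suc c) 0 k (bound-lower σ c 0)
             (λ 0<α → inside-saturated σ (ℕ.<-≤-trans 0<α (α-anti c))) inv) ⟩
      det (full 0 Y ∷ restricted 0 Y Ys ++ rest-rows 1 (suc c) 0 k)
        ≈⟨ det-drop (full 0 Y) _ (LAll.++⁺ (restricted-zero Y Ys) (rest-zero 1 (suc c) 0 k ℕ.z<s)) ⟩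
      -- The exhausted column contributes E 0 Y = 1. The shift raises the restricted rows from m = 0
      -- to m = 1, the positive degree that `peel` requires, and renumbers the remaining rows.
      1# * det (List.map (_∘ suc) (restricted 0 Y Ys ++ rest-rows 1 (suc c) 0 k))
        ≈⟨ *-identityˡ _ ⟩
      det (List.map (_∘ suc) (restricted 0 Y Ys ++ rest-rows 1 (suc c) 0 k))
        ≈⟨ reflexive (≡.cong det (List.map-++ (_∘ suc) (restricted 0 Y Ys) _)) ⟩
      det (List.map (_∘ suc) (restricted 0 Y Ys) ++ List.map (_∘ suc) (rest-rows 1 (suc c) 0 k))
        ≈⟨ reflexive (≡.cong (λ Ms → det (Ms ++ List.map (_∘ suc) (rest-rows 1 (suc c) 0 k))) (restricted-shift Y Ys)) ⟩
      det (restricted 1 Y Ys ++ List.map (_∘ suc) (rest-rows 1 (suc c) 0 k))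
        ≈⟨ det-cong (Pointwise.++⁺ (≋-refl {restricted 1 Y Ys}) (rest-shift 0 (suc c) 0 k)) ⟩
      det (restricted 1 Y Ys ++ rest-rows 0 (suc c) 0 k)
        ≈⟨ peel-diagonal 0 (suc c) k (upper-order α (suc c) k) σ inv (λ σ′ → upper-tableaux k (suc c) σ′) ⟩
      tableaux (upper-order α c (suc k)) σ
        ∎
      where
      Y = bound σ c 0
      Ys = cell-bounds σ (suc c) 0 k

    det-tableaux : ∀ m ℓ σ {Y} → Invariant σ Y 0 m ℓ → det (rows σ m 0 0 m ℓ) ≈ tableaux (order-from α ℓ m) σ
    det-tableaux zero    ℓ σ inv = upper-tableaux ℓ 0 σ inv
    det-tableaux (suc m) ℓ σ inv = begin
      det (rows σ (suc m) 0 0 (suc m) ℓ)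
        ≈⟨ reflexive (≡.cong det (rows-split σ (suc m) 0 0 m ℓ)) ⟩
      det (List.map (full (suc m)) Ys ++ rest-rows 0 0 m ℓ)
        ≈⟨ restrict-∅ m Ys _ (invariant-goodList σ _ 0 m ℓ inv) ⟩
      det (restricted (suc m) ∅ Ys ++ rest-rows 0 0 m ℓ)
        ≈⟨ peel-diagonal m 0 ℓ (order-from α ℓ m) σ inv (λ σ′ → det-tableaux m ℓ σ′) ⟩
      tableaux (order-from α ℓ (suc m)) σ
        ∎
      where Ys = cell-bounds σ 0 m ℓ

-- The free algebra modulo an ideal

module Quotient {A : Set} (_≟_ : DecidableEquality A)
  (G : Pred (FreeAlgebra.Poly _≟_) 0ℓ) where

  open FreeAlgebra _≟_
  open NoncommutativeSolver ℤ.+-*-ring using (solve; _⊜_; _:+_; _:*_; _:-_; :0)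

  Monomial : Set
  Monomial = ℤ × List A

  times : Monomial → Monomial → Monomial
  times (c , v) (d , w) = c ℤ.* d , v ++ w

  scale : ℤ → Monomial → Monomial
  scale c (d , w) = c ℤ.* d , w

  coeff-+ : ∀ f g w → coeff (f + g) w ≡ coeff f w ℤ.+ coeff g w
  coeff-+ []      g w = ≡.sym (ℤ.+-identityˡ _)
  coeff-+ ((c , v) ∷ f) g w =
    ≡.trans (≡.cong (λ i → x ℤ.+ i) (coeff-+ f g w)) (≡.sym (ℤ.+-assoc x (coeff f w) (coeff g w)))
    where x = if does (List.≡-dec _≟_ v w) then c else 0ℤ

  coeff-· : ∀ c f w → coeff (c · f) w ≡ c ℤ.* coeff f w
  coeff-· c []            w = ≡.sym (ℤ.*-zeroʳ c)
  coeff-· c ((d , v) ∷ f) w =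
    ≡.trans (≡.cong₂ ℤ._+_ (scaled (does (List.≡-dec _≟_ v w))) (coeff-· c f w))
            (≡.sym (ℤ.*-distribˡ-+ c _ _))
    where
    scaled : ∀ b → (if b then c ℤ.* d else 0ℤ) ≡ c ℤ.* (if b then d else 0ℤ)
    scaled true  = ≡.refl
    scaled false = ≡.sym (ℤ.*-zeroʳ c)

  coeff-- : ∀ f g w → coeff (f - g) w ≡ coeff f w ℤ.- coeff g w
  coeff-- f g w = ≡.trans (coeff-+ f (-1ℤ · g) w)
    (≡.cong (λ i → coeff f w ℤ.+ i) (≡.trans (coeff-· -1ℤ g w) (ℤ.-1*i≡-i (coeff g w))))

  ·-*ˡ : ∀ c f g → (c · f) * g ≡ c · (f * g)
  ·-*ˡ c []      g = ≡.refl
  ·-*ˡ c (x ∷ f) g =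
    ≡.trans (≡.cong₂ _++_ (≡.trans (List.map-cong (λ y → ≡.cong (_, _) (ℤ.*-assoc c _ _)) g) (List.map-∘ g)) (·-*ˡ c f g))
            (≡.sym (List.map-++ (scale c) (List.map (times x) g) (f * g)))

  ·-*ʳ : ∀ c f g → f * (c · g) ≡ c · (f * g)
  ·-*ʳ c []      g = ≡.refl
  ·-*ʳ c (x ∷ f) g =
    ≡.trans (≡.cong₂ _++_ (≡.trans (≡.sym (List.map-∘ g)) (≡.trans (List.map-cong commuted g) (List.map-∘ g))) (·-*ʳ c f g))
            (≡.sym (List.map-++ (scale c) (List.map (times x) g) (f * g)))
    where
    commuted : ∀ y → times x (scale c y) ≡ scale c (times x y)
    commuted (d , w) = ≡.cong (_, _)
      (≡.trans (≡.sym (ℤ.*-assoc (proj₁ x) c d))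
        (≡.trans (≡.cong (λ i → i ℤ.* d) (ℤ.*-comm (proj₁ x) c)) (ℤ.*-assoc c (proj₁ x) d)))

  *-distribʳ-+ : ∀ f g k → (f + g) * k ≡ f * k + g * k
  *-distribʳ-+ []      g k = ≡.refl
  *-distribʳ-+ (x ∷ f) g k = ≡.trans (≡.cong (List.map (times x) k ++_) (*-distribʳ-+ f g k))
      (≡.sym (List.++-assoc (List.map (times x) k) _ _))

  -- Distributing from the left rearranges the list of terms, so this law holds for coefficients,
  -- whereas associativity and distributivity from the right hold for the lists themselves.
  coeff-distribˡ : ∀ f g k w → coeff (f * (g + k)) w ≡ coeff (f * g) w ℤ.+ coeff (f * k) w
  coeff-distribˡ []      g k w = ≡.refl
  coeff-distribˡ (x ∷ f) g k w = begin
    coeff (List.map (times x) (g + k) + f * (g + k)) w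
      ≡⟨ ≡.cong (λ p → coeff (p + f * (g + k)) w) (List.map-++ (times x) g k) ⟩
    coeff ((xg + xk) + f * (g + k)) w
      ≡⟨ coeff-+ (xg + xk) (f * (g + k)) w ⟩
    coeff (xg + xk) w ℤ.+ coeff (f * (g + k)) w
      ≡⟨ ≡.cong₂ ℤ._+_ (coeff-+ xg xk w) (coeff-distribˡ f g k w) ⟩
    (coeff xg w ℤ.+ coeff xk w) ℤ.+ (coeff (f * g) w ℤ.+ coeff (f * k) w)
      ≡⟨ solve 4 (λ a b c d → (a :+ b) :+ (c :+ d) ⊜ (a :+ c) :+ (b :+ d)) ≡.refl (coeff xg w) (coeff xk w) _ _ ⟩
    (coeff xg w ℤ.+ coeff (f * g) w) ℤ.+ (coeff xk w ℤ.+ coeff (f * k) w)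
      ≡⟨ ≡.cong₂ ℤ._+_ (coeff-+ xg (f * g) w) (coeff-+ xk (f * k) w) ⟨
    coeff (xg + f * g) w ℤ.+ coeff (xk + f * k) w
      ∎
    where
    open ≡.≡-Reasoning
    xg = List.map (times x) g
    xk = List.map (times x) k

  *-assoc : ∀ f g k → (f * g) * k ≡ f * (g * k)
  *-assoc []      g k = ≡.refl
  *-assoc (x ∷ f) g k = ≡.trans (*-distribʳ-+ (List.map (times x) g) (f * g) k)
    (≡.cong₂ _++_ (row g) (*-assoc f g k))
    where
    row : ∀ g → List.map (times x) g * k ≡ List.map (times x) (g * k)
    row []      = ≡.refl
    row (y ∷ g) = ≡.trans
      (≡.cong₂ _++_ (≡.trans (List.map-cong (λ z → ≡.cong₂ _,_ (ℤ.*-assoc (proj₁ x) _ _) (List.++-assoc (proj₂ x) _ _)) k)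
                             (List.map-∘ k)) (row g))
      (≡.sym (List.map-++ (times x) (List.map (times y) k) (g * k)))

  *-identityˡ : ∀ f → 1# * f ≡ f
  *-identityˡ f = ≡.trans (List.++-identityʳ _)
    (≡.trans (List.map-cong (λ (d , w) → ≡.cong (_, w) (ℤ.*-identityˡ d)) f) (List.map-id f))

  *-identityʳ : ∀ f → f * 1# ≡ f
  *-identityʳ []            = ≡.refl
  *-identityʳ ((c , v) ∷ f) = ≡.cong₂ _∷_ (≡.cong₂ _,_ (ℤ.*-identityʳ c) (List.++-identityʳ v)) (*-identityʳ f)

  infix 4 _~_
  -- A record keeps f and g recoverable from the type; the bare membership mentions only their
  -- difference, which reduces to a concatenation.
  record _~_ (f g : Poly) : Set where
    constructor congruent
    field difference : f ≡ g [mod Ideal G ]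

  ~-from-≈ : ∀ {f g} → f ≈ g → f ~ g
  ~-from-≈ {f} {g} f≈g = congruent (resp
    (λ w → ≡.sym (≡.trans (coeff-- f g w) (≡.trans (≡.cong (λ i → i ℤ.- coeff g w) (f≈g w)) (ℤ.+-inverseʳ (coeff g w))))) zero)

  ~-from-≡ : ∀ {f g} → f ≡ g → f ~ g
  ~-from-≡ f≡g = ~-from-≈ λ w → ≡.cong (λ p → coeff p w) f≡g

  private
    ~-sym : ∀ {f g} → f ~ g → g ~ f
    -- Closure of the ideal is under multiplication by polynomials, so -1 is used as a constant
    -- polynomial.
    ~-sym {f} {g} (congruent f~g) = congruent (resp {f = (-1ℤ · 1#) * (f - g)}
      (λ w → begin
        coeff ((-1ℤ · 1#) * (f - g)) w     ≡⟨ ≡.cong (λ p → coeff p w) (·-*ˡ -1ℤ 1# (f - g)) ⟩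
        coeff (-1ℤ · (1# * (f - g))) w     ≡⟨ coeff-· -1ℤ (1# * (f - g)) w ⟩
        -1ℤ ℤ.* coeff (1# * (f - g)) w     ≡⟨ ≡.cong (λ p → -1ℤ ℤ.* coeff p w) (*-identityˡ (f - g)) ⟩
        -1ℤ ℤ.* coeff (f - g) w            ≡⟨ ≡.trans (ℤ.-1*i≡-i _) (≡.cong ℤ.-_ (coeff-- f g w)) ⟩
        ℤ.- (coeff f w ℤ.- coeff g w)      ≡⟨ ℤ.+-identityˡ _ ⟨
        0ℤ ℤ.- (coeff f w ℤ.- coeff g w)   ≡⟨ solve 2 (λ a b → :0 :- (a :- b) ⊜ b :- a) ≡.refl (coeff f w) (coeff g w) ⟩
        coeff g w ℤ.- coeff f w            ≡⟨ coeff-- g f w ⟨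
        coeff (g - f) w                    ∎)
      (mulˡ (-1ℤ · 1#) f~g))
      where open ≡.≡-Reasoning

    ~-trans : ∀ {f g k} → f ~ g → g ~ k → f ~ k
    ~-trans {f} {g} {k} (congruent f~g) (congruent g~k) = congruent (resp {f = (f - g) + (g - k)}
      (λ w → begin
        coeff ((f - g) + (g - k)) w                                  ≡⟨ coeff-+ (f - g) (g - k) w ⟩
        coeff (f - g) w ℤ.+ coeff (g - k) w                          ≡⟨ ≡.cong₂ ℤ._+_ (coeff-- f g w) (coeff-- g k w) ⟩
        (coeff f w ℤ.- coeff g w) ℤ.+ (coeff g w ℤ.- coeff k w)
          ≡⟨ solve 3 (λ a b c → (a :- b) :+ (b :- c) ⊜ a :- c) ≡.refl (coeff f w) (coeff g w) (coeff k w) ⟩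
        coeff f w ℤ.- coeff k w                                      ≡⟨ coeff-- f k w ⟨
        coeff (f - k) w                                              ∎)
      (add f~g g~k))
      where open ≡.≡-Reasoning

    +-cong : ∀ {f g f′ g′} → f ~ g → f′ ~ g′ → f + f′ ~ g + g′
    +-cong {f} {g} {f′} {g′} (congruent f~g) (congruent f′~g′) = congruent (resp {f = (f - g) + (f′ - g′)}
      (λ w → begin
        coeff ((f - g) + (f′ - g′)) w                                  ≡⟨ coeff-+ (f - g) (f′ - g′) w ⟩
        coeff (f - g) w ℤ.+ coeff (f′ - g′) w                          ≡⟨ ≡.cong₂ ℤ._+_ (coeff-- f g w) (coeff-- f′ g′ w) ⟩
        (coeff f w ℤ.- coeff g w) ℤ.+ (coeff f′ w ℤ.- coeff g′ w)
          ≡⟨ solve 4 (λ a b c d → (a :- b) :+ (c :- d) ⊜ (a :+ c) :- (b :+ d)) ≡.refl (coeff f w) (coeff g w)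
              (coeff f′ w) (coeff g′ w) ⟩
        (coeff f w ℤ.+ coeff f′ w) ℤ.- (coeff g w ℤ.+ coeff g′ w)
          ≡⟨ ≡.cong₂ ℤ._-_ (coeff-+ f f′ w) (coeff-+ g g′ w) ⟨
        coeff (f + f′) w ℤ.- coeff (g + g′) w                          ≡⟨ coeff-- (f + f′) (g + g′) w ⟨
        coeff ((f + f′) - (g + g′)) w                                  ∎)
      (add f~g f′~g′))
      where open ≡.≡-Reasoning

    coeff-*-- : ∀ f g k w → coeff (f * (g - k)) w ≡ coeff (f * g) w ℤ.- coeff (f * k) w
    coeff-*-- f g k w = ≡.trans (coeff-distribˡ f g (-1ℤ · k) w)
      (≡.cong (λ i → coeff (f * g) w ℤ.+ i)
        (≡.trans (≡.cong (λ p → coeff p w) (·-*ʳ -1ℤ f k)) (≡.trans (coeff-· -1ℤ (f * k) w) (ℤ.-1*i≡-i _))))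

    coeff---* : ∀ f g k w → coeff ((f - g) * k) w ≡ coeff (f * k) w ℤ.- coeff (g * k) w
    coeff---* f g k w = ≡.trans (≡.cong (λ p → coeff p w) (*-distribʳ-+ f (-1ℤ · g) k))
      (≡.trans (≡.cong (λ p → coeff (f * k + p) w) (·-*ˡ -1ℤ g k)) (coeff-- (f * k) (g * k) w))

    *-cong : ∀ {f g f′ g′} → f ~ g → f′ ~ g′ → f * f′ ~ g * g′
    *-cong {f} {g} {f′} {g′} (congruent f~g) (congruent f′~g′) = congruent (resp {f = (f - g) * f′ + g * (f′ - g′)}
      (λ w → begin
        coeff ((f - g) * f′ + g * (f′ - g′)) w
          ≡⟨ coeff-+ ((f - g) * f′) (g * (f′ - g′)) w ⟩
        coeff ((f - g) * f′) w ℤ.+ coeff (g * (f′ - g′)) w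
          ≡⟨ ≡.cong₂ ℤ._+_ (coeff---* f g f′ w) (coeff-*-- g f′ g′ w) ⟩
        (coeff (f * f′) w ℤ.- coeff (g * f′) w) ℤ.+ (coeff (g * f′) w ℤ.- coeff (g * g′) w)
          ≡⟨ solve 3 (λ a b c → (a :- b) :+ (b :- c) ⊜ a :- c) ≡.refl (coeff (f * f′) w) (coeff (g * f′) w) (coeff (g * g′) w) ⟩
        coeff (f * f′) w ℤ.- coeff (g * g′) w
          ≡⟨ coeff-- (f * f′) (g * g′) w ⟨
        coeff (f * f′ - g * g′) w
          ∎)
      (add (mulʳ f′ f~g) (mulˡ g f′~g′)))
      where open ≡.≡-Reasoning

    neg-cong : ∀ {f g} → f ~ g → -1ℤ · f ~ -1ℤ · g
    neg-cong {f} {g} f~g = ~-trans (~-from-≡ (≡.sym (neg f)))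
        (~-trans (*-cong (~-from-≡ { -1ℤ · 1#} ≡.refl) f~g) (~-from-≡ (neg g)))
      where
      neg : ∀ f → (-1ℤ · 1#) * f ≡ -1ℤ · f
      neg f = ≡.trans (·-*ˡ -1ℤ 1# f) (≡.cong (-1ℤ ·_) (*-identityˡ f))

  quotientRing : Ring 0ℓ 0ℓ
  quotientRing = record
    { Carrier = Poly
    ; _≈_ = _~_
    ; _+_ = _+_
    ; _*_ = _*_
    ; -_ = -1ℤ ·_
    ; 0# = 0#
    ; 1# = 1#
    ; isRing = record
      { +-isAbelianGroup = record
        { isGroup = record
          { isMonoid = record
            { isSemigroup = record
              { isMagma = record
                { isEquivalence = record
                  { refl = ~-from-≈ λ _ → ≡.refl ; sym = ~-sym ; trans = ~-trans }
                ; ∙-cong = +-cong }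
              ; assoc = λ f g k → ~-from-≡ (List.++-assoc f g k) }
            ; identity = (λ f → ~-from-≡ ≡.refl) , λ f → ~-from-≡ (List.++-identityʳ f) }
          ; inverse =
              (λ f → ~-from-≈ (λ w → ≡.trans (swap (-1ℤ · f) f w) (inverse f w)))
            , (λ f → ~-from-≈ (inverse f))
          ; ⁻¹-cong = neg-cong }
        ; comm = λ f g → ~-from-≈ (swap f g) }
      ; *-cong = *-cong
      ; *-assoc = λ f g k → ~-from-≡ (*-assoc f g k)
      ; *-identity = (λ f → ~-from-≡ (*-identityˡ f)) , λ f → ~-from-≡ (*-identityʳ f)
      ; distrib = (λ f g k → ~-from-≈ λ w → ≡.trans (coeff-distribˡ f g k w) (≡.sym (coeff-+ (f * g) (f * k) w)))
                , λ f g k → ~-from-≡ (*-distribʳ-+ g k f)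
      } }
    where
    swap : ∀ f g → f + g ≈ g + f
    swap f g w = ≡.trans (coeff-+ f g w) (≡.trans (ℤ.+-comm (coeff f w) _) (≡.sym (coeff-+ g f w)))
    inverse : ∀ f → f - f ≈ 0#
    inverse f w = ≡.trans (coeff-- f f w) (ℤ.+-inverseʳ (coeff f w))

-- Translation from the definitions of J and of tableaux

parity : ℕ → Sign
parity zero    = plus
parity (suc n) = minus ∙ parity n

flip : Bool → Sign
flip b = if b then minus else plus

Π∙ : {B : Set} → List B → (B → Sign) → Sign
Π∙ xs f = List.foldr (λ x s → f x ∙ s) plus xs

Π∙-++ : {B : Set} (xs ys : List B) (f : B → Sign) → Π∙ (xs ++ ys) f ≡ Π∙ xs f ∙ Π∙ ys f
Π∙-++ []       ys f = ≡.refl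
Π∙-++ (x ∷ xs) ys f = ≡.trans (≡.cong (f x ∙_) (Π∙-++ xs ys f)) (≡.sym (∙-assoc (f x) (Π∙ xs f) (Π∙ ys f)))

Π∙-map : {B C : Set} (g : B → C) (xs : List B) (f : C → Sign) → Π∙ (List.map g xs) f ≡ Π∙ xs (f ∘ g)
Π∙-map g xs f = List.foldr-map _ g plus xs

Π∙-cong : {B : Set} (xs : List B) {f g : B → Sign} → (∀ x → f x ≡ g x) → Π∙ xs f ≡ Π∙ xs g
Π∙-cong []       f≡g = ≡.refl
Π∙-cong (x ∷ xs) f≡g = ≡.cong₂ _∙_ (f≡g x) (Π∙-cong xs f≡g)

Π∙-cartesianProduct : {B C : Set} (xs : List B) (ys : List C) (f : B × C → Sign) →
  Π∙ (cartesianProduct xs ys) f ≡ Π∙ xs (λ x → Π∙ ys (λ y → f (x , y)))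
Π∙-cartesianProduct []       ys f = ≡.refl
Π∙-cartesianProduct (x ∷ xs) ys f = ≡.trans (Π∙-++ (List.map (x ,_) ys) _ f)
  (≡.cong₂ _∙_ (Π∙-map (x ,_) ys f) (Π∙-cartesianProduct xs ys f))

Π∙-allFin : ∀ k (f : Fin (suc k) → Sign) → Π∙ (allFin (suc k)) f ≡ f Fin.zero ∙ Π∙ (allFin k) (f ∘ Fin.suc)
Π∙-allFin k f = ≡.cong (f Fin.zero ∙_)
  (≡.trans (≡.cong (λ xs → Π∙ xs f) (≡.sym (List.map-tabulate (λ i → i) Fin.suc))) (Π∙-map Fin.suc (allFin k) f))

parity-filter : {B : Set} {Q : Pred B 0ℓ} (Q? : Decidable Q) (xs : List B) →
  parity (length (filter Q? xs)) ≡ Π∙ xs (λ x → flip (does (Q? x)))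
parity-filter Q? []       = ≡.refl
parity-filter Q? (x ∷ xs) with does (Q? x)
... | true  = ≡.cong (minus ∙_) (parity-filter Q? xs)
... | false = parity-filter Q? xs

letters : ∀ {n k} → Vec (Fin n) k → List ℕ
letters []      = []
letters (p ∷ v) = toℕ p ∷ letters v

order-≢ : ∀ p q → p ≢ q → order p q ≡ flip (q ℕ.<ᵇ p)
order-≢ zero    zero    p≢q = ⊥-elim (p≢q ≡.refl)
order-≢ zero    (suc q) p≢q = ≡.refl
order-≢ (suc p) zero    p≢q = ≡.refl
order-≢ (suc p) (suc q) p≢q = order-≢ p q (p≢q ∘ ≡.cong suc)

against-inversions : ∀ {n k} (p : Fin n) (v : Vec (Fin n) k) → VAll.All (p ≢_) v →
  against (toℕ p) (letters v) ≡ Π∙ (allFin k) (λ j → flip (toℕ (lookup v j) ℕ.<ᵇ toℕ p))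
against-inversions p []      []            = ≡.refl
against-inversions {k = suc k} p (q ∷ v) (p≢q ∷ p≢) =
  ≡.trans (≡.cong₂ _∙_ (order-≢ (toℕ p) (toℕ q) (p≢q ∘ Fin.toℕ-injective)) (against-inversions p v p≢))
          (≡.sym (Π∙-allFin k (λ j → flip (toℕ (lookup (q ∷ v) j) ℕ.<ᵇ toℕ p))))

inverted : ∀ {n k} → Vec (Fin n) k → Fin k → Fin k → Bool
inverted v i j = (toℕ i ℕ.<ᵇ toℕ j) ∧ (toℕ (lookup v j) ℕ.<ᵇ toℕ (lookup v i))

-- The double product runs over all ordered pairs of positions; those with i ≥ j contribute `plus`.
-- Distinct letters make every factor of ε differ from `null`.
ε-inversions : ∀ {n k} (v : Vec (Fin n) k) → VUnique.Unique v →
  ε (letters v) ≡ Π∙ (allFin k) (λ i → Π∙ (allFin k) (λ j → flip (inverted v i j)))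
ε-inversions []      _ = ≡.refl
ε-inversions {k = suc k} (p ∷ v) (p∉v VAllPairs.∷ unique) = begin
  against (toℕ p) (letters v) ∙ ε (letters v)
    ≡⟨ ≡.cong₂ _∙_ (against-inversions p v p∉v) (ε-inversions v unique) ⟩
  Π∙ (allFin k) (λ j → inv Fin.zero (Fin.suc j)) ∙ Π∙ (allFin k) (λ i → Π∙ (allFin k) (λ j → inv (Fin.suc i) (Fin.suc j)))
    ≡⟨ ≡.cong₂ _∙_ (Π∙-allFin k (inv Fin.zero)) (Π∙-cong (allFin k) (λ i → Π∙-allFin k (inv (Fin.suc i)))) ⟨
  Π∙ (allFin (suc k)) (inv Fin.zero) ∙ Π∙ (allFin k) (λ i → Π∙ (allFin (suc k)) (inv (Fin.suc i)))
    ≡⟨ Π∙-allFin k (λ i → Π∙ (allFin (suc k)) (inv i)) ⟨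
  Π∙ (allFin (suc k)) (λ i → Π∙ (allFin (suc k)) (inv i))
    ∎
  where
  open ≡.≡-Reasoning
  inv : Fin (suc k) → Fin (suc k) → Sign
  inv i j = flip (inverted (p ∷ v) i j)

ε-inversions-parity : ∀ {ℓ} (v : Vec (Fin ℓ) ℓ) → VUnique.Unique v → ε (letters v) ≡ parity (length (inversions v))
ε-inversions-parity {ℓ} v unique = begin
  ε (letters v)                                                         ≡⟨ ε-inversions v unique ⟩
  Π∙ (allFin ℓ) (λ i → Π∙ (allFin ℓ) (λ j → flip (inverted v i j)))
      ≡⟨ Π∙-cartesianProduct (allFin ℓ) (allFin ℓ) (λ (i , j) → flip (inverted v i j)) ⟨
  Π∙ pairs (λ (i , j) → flip (inverted v i j))                          ≡⟨ parity-filter inversion? pairs ⟨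
  parity (length (inversions v))                                        ∎
  where
  open ≡.≡-Reasoning
  pairs = cartesianProduct (allFin ℓ) (allFin ℓ)
  inversion? : Decidable (λ (i , j) → i Fin.< j × lookup v j Fin.< lookup v i)
  inversion? (i , j) = (i Fin.<? j) ×-dec (lookup v j Fin.<? lookup v i)

-- A repeated letter would contribute the factor `order p p`, which is `null`. This allows the
-- filter to permutations to be replaced by the sign itself.
unique-from-ε : ∀ {n k} (v : Vec (Fin n) k) → ε (letters v) ≢ null → VUnique.Unique v
unique-from-ε []      _  = VAllPairs.[]
unique-from-ε (p ∷ v) ≢null =
  distinct v (λ eq → ≢null (≡.cong (_∙ ε (letters v)) eq)) VAllPairs.∷
  unique-from-ε v (λ eq → ≢null (≡.trans (≡.cong (against (toℕ p) (letters v) ∙_) eq) (∙-null (against (toℕ p) (letters v)))))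
  where
  distinct : ∀ {k} (v : Vec _ k) → against (toℕ p) (letters v) ≢ null → VAll.All (p ≢_) v
  distinct []      _     = []
  distinct (q ∷ v) ≢null =
    (λ { ≡.refl → ≢null (≡.cong (_∙ against (toℕ p) (letters v)) (order-refl (toℕ p))) }) ∷
    distinct v (λ eq → ≢null (≡.trans (≡.cong (order (toℕ p) (toℕ q) ∙_) eq) (∙-null (order (toℕ p) (toℕ q)))))

range-allFin : ∀ n → range n ≡ List.map toℕ (allFin n)
range-allFin zero    = ≡.refl
range-allFin (suc n) = ≡.cong (0 ∷_) (≡.trans (≡.cong (List.map suc) (range-allFin n))
  (≡.trans (≡.sym (List.map-∘ (allFin n)))
    (≡.trans (List.map-∘ (allFin n)) (≡.cong (List.map toℕ) (List.map-tabulate (λ i → i) Fin.suc)))))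

module PermutationSums (R : Ring 0ℓ 0ℓ) where

  open Ring R renaming (Carrier to K) hiding (zero)
  open Sums R
  open Determinants R
  open import Algebra.Properties.Ring R
  open import Relation.Binary.Reasoning.Setoid setoid

  prod : {B : Set} → List B → (B → K) → K
  prod xs f = List.foldr (λ x p → f x * p) 1# xs

  prod-allFin : ∀ k (f : Fin (suc k) → K) → prod (allFin (suc k)) f ≡ f Fin.zero * prod (allFin k) (f ∘ Fin.suc)
  prod-allFin k f = ≡.cong (f Fin.zero *_)
    (≡.trans (≡.cong (λ xs → prod xs f) (≡.sym (List.map-tabulate (λ i → i) Fin.suc)))
             (List.foldr-map _ Fin.suc 1# (allFin k)))

  act-*ʳ : ∀ s x y → act s (x * y) ≈ x * act s y
  act-*ʳ plus  x y = refl
  act-*ʳ null  x y = sym (zeroʳ x)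
  act-*ʳ minus x y = -‿distribʳ-* x y

  act-cong : ∀ s {x y} → x ≈ y → act s x ≈ act s y
  act-cong plus  x≈y = x≈y
  act-cong null  x≈y = refl
  act-cong minus x≈y = -‿cong x≈y

  sum-vectors : ∀ n k (F : Fin k → ℕ → K) (φ : List ℕ → Sign) →
    sum (vectors (allFin n) k) (λ v → act (φ (letters v)) (prod (allFin k) λ i → F i (toℕ (lookup v i)))) ≈
    expansion n (tabulate F) φ
  sum-vectors n zero    F φ = +-identityʳ _
  sum-vectors n (suc k) F φ = begin
    sum (vectors (allFin n) (suc k)) _
      ≈⟨ sum-cartesianProduct _∷_ (allFin n) (vectors (allFin n) k) _ ⟩
    sum (allFin n) (λ p → sum (vectors (allFin n) k) (λ v →
      act (φ (toℕ p ∷ letters v)) (prod (allFin (suc k)) λ i → F i (toℕ (lookup (p ∷ v) i)))))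
      ≈⟨ sum-cong (allFin n) (λ p → sum-cong (vectors (allFin n) k) (λ v → trans
           (act-cong (φ (toℕ p ∷ letters v)) (reflexive (prod-allFin k _)))
           (act-*ʳ (φ (toℕ p ∷ letters v)) (F Fin.zero (toℕ p)) _))) ⟩
    sum (allFin n) (λ p → sum (vectors (allFin n) k) (λ v →
      F Fin.zero (toℕ p) * act (φ (toℕ p ∷ letters v)) (prod (allFin k) λ i → F (Fin.suc i) (toℕ (lookup v i)))))
      ≈⟨ sum-cong (allFin n) (λ p → sym (sum-*ˡ (vectors (allFin n) k) _ _)) ⟩
    sum (allFin n) (λ p → F Fin.zero (toℕ p) * sum (vectors (allFin n) k) (λ v →
      act (φ (toℕ p ∷ letters v)) (prod (allFin k) λ i → F (Fin.suc i) (toℕ (lookup v i)))))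
      ≈⟨ sum-cong (allFin n) (λ p → *-congˡ (sum-vectors n k (F ∘ Fin.suc) (φ ∘ (toℕ p ∷_)))) ⟩
    sum (allFin n) (λ p → F Fin.zero (toℕ p) * expansion n (tabulate (F ∘ Fin.suc)) (φ ∘ (toℕ p ∷_)))
      ≈⟨ reflexive (sum-map toℕ (allFin n) _) ⟨
    sum (List.map toℕ (allFin n)) (λ p → F Fin.zero p * expansion n (tabulate (F ∘ Fin.suc)) (φ ∘ (p ∷_)))
      ≈⟨ reflexive (≡.cong (λ xs → sum xs (λ p → F Fin.zero p * expansion n (tabulate (F ∘ Fin.suc)) (φ ∘ (p ∷_))))
          (range-allFin n)) ⟨
    expansion n (tabulate F) φ
      ∎

at : ∀ {ℓ} → Vec ℕ ℓ → ℕ → ℕ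
at α = heights (toList α)

at-toℕ : ∀ {ℓ} (α : Vec ℕ ℓ) i → at α (toℕ i) ≡ lookup α i
at-toℕ (a ∷ α) Fin.zero    = ≡.refl
at-toℕ (a ∷ α) (Fin.suc i) = at-toℕ α i

at-anti : ∀ {ℓ} (α : Vec ℕ ℓ) → IsPartition α → ∀ c → at α (suc c) ℕ.≤ at α c
at-anti []          part c       = ℕ.z≤n
at-anti (a ∷ [])    part zero    = ℕ.z≤n
at-anti (a ∷ b ∷ α) part zero    = part Fin.zero (Fin.suc Fin.zero) ℕ.z≤n
at-anti (a ∷ α)     part (suc c) = at-anti α (λ i j i≤j → part (Fin.suc i) (Fin.suc j) (ℕ.s≤s i≤j)) c

height : ∀ {ℓ} → Vec ℕ ℓ → ℕ
height = Vec.foldr _ ℕ._⊔_ 0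

at≤height : ∀ {ℓ} (α : Vec ℕ ℓ) c → at α c ℕ.≤ height α
at≤height []      c       = ℕ.z≤n
at≤height (a ∷ α) zero    = ℕ.m≤m⊔n a (height α)
at≤height (a ∷ α) (suc c) = ℕ.≤-trans (at≤height α c) (ℕ.m≤n⊔m a (height α))

⊖-≡⁺ : ∀ m n p q → m ℕ.+ q ≡ p ℕ.+ n → m ⊖ n ≡ p ⊖ q
⊖-≡⁺ m n p q eq = begin
  m ⊖ n                   ≡⟨ ℤ.+-cancelˡ-⊖ q m n ⟨
  (q ℕ.+ m) ⊖ (q ℕ.+ n)   ≡⟨ ≡.cong₂ _⊖_ (≡.trans (ℕ.+-comm q m) (≡.trans eq (ℕ.+-comm p n))) (ℕ.+-comm q n) ⟩
  (n ℕ.+ p) ⊖ (n ℕ.+ q)   ≡⟨ ℤ.+-cancelˡ-⊖ n p q ⟩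
  p ⊖ q                   ∎
  where open ≡.≡-Reasoning

⊖-≡⁻ : ∀ m n p q → m ⊖ n ≡ p ⊖ q → m ℕ.+ q ≡ p ℕ.+ n
⊖-≡⁻ m n p q eq = ℤ.+-injective (begin
  + (m ℕ.+ q)                  ≡⟨ clear m n q ⟨
  m ⊖ n ℤ.+ + (n ℕ.+ q)        ≡⟨ ≡.cong₂ (λ i j → i ℤ.+ + j) eq (ℕ.+-comm n q) ⟩
  p ⊖ q ℤ.+ + (q ℕ.+ n)        ≡⟨ clear p q n ⟩
  + (p ℕ.+ n)                  ∎)
  where
  open ≡.≡-Reasoning
  clear : ∀ m n q → m ⊖ n ℤ.+ + (n ℕ.+ q) ≡ + (m ℕ.+ q)
  clear m n q = begin
    m ⊖ n ℤ.+ + (n ℕ.+ q)              ≡⟨ ℤ.distribˡ-⊖-+-pos (n ℕ.+ q) m n ⟩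
    (m ℕ.+ (n ℕ.+ q)) ⊖ n
        ≡⟨ ≡.cong₂ _⊖_ (≡.trans (≡.sym (ℕ.+-assoc m n q)) (≡.trans (≡.cong (ℕ._+ q) (ℕ.+-comm m n)) (ℕ.+-assoc n m q)))
            (≡.sym (ℕ.+-identityʳ n)) ⟩
    (n ℕ.+ (m ℕ.+ q)) ⊖ (n ℕ.+ 0)      ≡⟨ ℤ.+-cancelˡ-⊖ n (m ℕ.+ q) 0 ⟩
    + (m ℕ.+ q)                        ∎

toℕ² : ∀ {ℓ} (α : Vec ℕ ℓ) → Box α → ℕ × ℕ
toℕ² α (c , r) = toℕ c , toℕ r

map-toℕ²-boxes : ∀ {ℓ} (α : Vec ℕ ℓ) → List.map (toℕ² α) (boxes α) ≡ columnBoxes (toList α)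
map-toℕ²-boxes []              = ≡.refl
map-toℕ²-boxes {suc ℓ} (a ∷ α) = begin
  List.map (toℕ² (a ∷ α)) (List.map (Fin.zero ,_) (allFin a) ++ concatMap col (tabulate Fin.suc))
    ≡⟨ List.map-++ (toℕ² (a ∷ α)) (List.map (Fin.zero ,_) (allFin a)) _ ⟩
  List.map (toℕ² (a ∷ α)) (List.map (Fin.zero ,_) (allFin a)) ++ List.map (toℕ² (a ∷ α)) (concatMap col (tabulate Fin.suc))
    ≡⟨ ≡.cong₂ _++_ (≡.trans (≡.sym (List.map-∘ (allFin a)))
        (≡.trans (List.map-∘ (allFin a)) (≡.cong (List.map (0 ,_)) (≡.sym (range-allFin a)))))
         (≡.cong (λ xs → List.map (toℕ² (a ∷ α)) (concatMap col xs)) (≡.sym (List.map-tabulate (λ i → i) Fin.suc))) ⟩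
  List.map (0 ,_) (range a) ++ List.map (toℕ² (a ∷ α)) (concatMap col (List.map Fin.suc (allFin ℓ)))
    ≡⟨ ≡.cong (λ xs → List.map (0 ,_) (range a) ++ List.map (toℕ² (a ∷ α)) xs) (List.concatMap-map col Fin.suc (allFin ℓ)) ⟩
  List.map (0 ,_) (range a) ++ List.map (toℕ² (a ∷ α)) (concatMap (col ∘ Fin.suc) (allFin ℓ))
    ≡⟨ ≡.cong (List.map (0 ,_) (range a) ++_) (begin
         List.map (toℕ² (a ∷ α)) (concatMap (col ∘ Fin.suc) (allFin ℓ))
           ≡⟨ List.map-concatMap (toℕ² (a ∷ α)) (col ∘ Fin.suc) (allFin ℓ) ⟩
         concatMap (List.map (toℕ² (a ∷ α)) ∘ col ∘ Fin.suc) (allFin ℓ)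
           ≡⟨ List.concatMap-cong shifted (allFin ℓ) ⟩
         concatMap (List.map (shift ∘ toℕ² α) ∘ col′) (allFin ℓ)
           ≡⟨ List.map-concatMap (shift ∘ toℕ² α) col′ (allFin ℓ) ⟨
         List.map (shift ∘ toℕ² α) (boxes α)
           ≡⟨ List.map-∘ (boxes α) ⟩
         List.map shift (List.map (toℕ² α) (boxes α))
           ≡⟨ ≡.cong (List.map shift) (map-toℕ²-boxes α) ⟩
         List.map shift (columnBoxes (toList α))
           ∎) ⟩
  columnBoxes (a ∷ toList α)
    ∎
  where
  open ≡.≡-Reasoning
  col : ∀ c → List (Box (a ∷ α))
  col c = List.map (c ,_) (allFin (lookup (a ∷ α) c))
  col′ : ∀ c → List (Box α)
  col′ c = List.map (c ,_) (allFin (lookup α c))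
  shifted : ∀ c → List.map (toℕ² (a ∷ α)) (col (Fin.suc c)) ≡ List.map (shift ∘ toℕ² α) (col′ c)
  shifted c = ≡.trans (≡.sym (List.map-∘ (allFin (lookup α c)))) (List.map-∘ (allFin (lookup α c)))

reading-order : ∀ {ℓ} (α : Vec ℕ ℓ) → List (Box α)
reading-order α = concatMap (diagonal α) (diagonals α)

columnBoxes-inside : ∀ α → LAll.All (λ (c , r) → c ℕ.< List.length α × r ℕ.< heights α c) (columnBoxes α)
columnBoxes-inside []      = []
columnBoxes-inside (a ∷ α) = LAll.++⁺
  (LAll.map⁺ (LAll.map (λ r<a → ℕ.z<s , r<a) (range-below a)))
  (LAll.map⁺ (LAll.map (λ (c< , r<) → ℕ.s<s c< , r<) (columnBoxes-inside α)))
  where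
  range-below : ∀ n → LAll.All (ℕ._< n) (range n)
  range-below zero    = []
  range-below (suc n) = ℕ.z<s ∷ LAll.map⁺ (LAll.map ℕ.s<s (range-below n))

module _ {ℓ} (α : Vec ℕ ℓ) (partition : IsPartition α) where

  private
    H = height α
    N = H ℕ.+ ℓ

    blocks : List (ℕ × ℕ)
    blocks = concatMap (diagonal-at (toList α) H) (upTo N)

    blocks≡order : blocks ≡ order-from (at α) ℓ (suc H)
    blocks≡order = ≡.subst
      (λ k → concatMap (diagonal-at (toList α) H) (upTo (H ℕ.+ k)) ≡ order-from (at α) k (suc H))
      (Vec.length-toList α)
      (all-diagonals (toList α) (at-anti α partition) H H 0 (λ n → n) (λ _ → ≡.refl) ≡.refl)

    diagonal≡ : ∀ n → List.map (toℕ² α) (diagonal α (n ⊖ H)) ≡ diagonal-at (toList α) H n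
    diagonal≡ n = begin
      List.map (toℕ² α) (filter (λ b → content α b ℤ.≟ n ⊖ H) (boxes α))
        ≡⟨ ≡.cong (List.map (toℕ² α)) (filter-does (λ b → content α b ℤ.≟ n ⊖ H) (onDiagonal? H n ∘ (toℕ² α)) (boxes α)
            (λ (c , r) →
             does-⇔ (mk⇔ (⊖-≡⁻ (toℕ c) (toℕ r) n H) (⊖-≡⁺ (toℕ c) (toℕ r) n H))
               (toℕ c ⊖ toℕ r ℤ.≟ n ⊖ H) (onDiagonal? H n (toℕ c , toℕ r)))) ⟩
      List.map (toℕ² α) (filter (onDiagonal? H n ∘ (toℕ² α)) (boxes α))
        ≡⟨ filter-map (onDiagonal? H n) (toℕ² α) (boxes α) ⟨
      filter (onDiagonal? H n) (List.map (toℕ² α) (boxes α))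
        ≡⟨ ≡.cong (filter (onDiagonal? H n)) (map-toℕ²-boxes α) ⟩
      diagonal-at (toList α) H n
        ∎
      where open ≡.≡-Reasoning

  reading-order≡ : List.map (toℕ² α) (reading-order α) ≡ order-from (at α) ℓ (suc (height α))
  reading-order≡ = begin
    List.map (toℕ² α) (concatMap (diagonal α) (List.map (_⊖ H) (upTo N)))
      ≡⟨ ≡.cong (List.map (toℕ² α)) (List.concatMap-map (diagonal α) (_⊖ H) (upTo N)) ⟩
    List.map (toℕ² α) (concatMap (λ n → diagonal α (n ⊖ H)) (upTo N))
      ≡⟨ List.map-concatMap (toℕ² α) (λ n → diagonal α (n ⊖ H)) (upTo N) ⟩
    concatMap (λ n → List.map (toℕ² α) (diagonal α (n ⊖ H))) (upTo N)
      ≡⟨ List.concatMap-cong diagonal≡ (upTo N) ⟩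
    blocks
      ≡⟨ blocks≡order ⟩
    order-from (at α) ℓ (suc H)
      ∎
    where open ≡.≡-Reasoning

  -- Each box has exactly one content, found at position c + `height α` - r. The permutation is
  -- needed because fillings are enumerated column by column.
  order-↭ : order-from (at α) ℓ (suc (height α)) ↭ columnBoxes (toList α)
  order-↭ = ↭-trans (↭.↭-reflexive (≡.sym blocks≡order))
    (classes-↭ (onDiagonal? H)
      (λ { {m} {n} {c , r} p q → ℕ.+-cancelʳ-≡ r m n (≡.trans (≡.sym p) q) })
      (upTo N) (Unique.upTo⁺ N) (columnBoxes (toList α))
      (LAll.map (λ {b} → covered b) (columnBoxes-inside (toList α))))
    where
    covered : ∀ b → proj₁ b ℕ.< List.length (toList α) × proj₂ b ℕ.< at α (proj₁ b) →
              ∃[ n ] n ∈ˡ upTo N × OnDiagonal H n b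
    covered (c , r) (c< , r<) = c ℕ.+ H ℕ.∸ r , Membership.∈-upTo⁺ n<N , ≡.sym (ℕ.m∸n+n≡m r≤)
      where
      r≤ : r ℕ.≤ c ℕ.+ H
      r≤ = ℕ.≤-trans (ℕ.<⇒≤ r<) (ℕ.≤-trans (at≤height α c) (ℕ.m≤n+m H c))
      n<N : c ℕ.+ H ℕ.∸ r ℕ.< N
      n<N = ℕ.≤-<-trans (ℕ.m∸n≤m (c ℕ.+ H) r) (≡.subst (ℕ._< N) (ℕ.+-comm H c)
              (ℕ.+-monoʳ-< H (≡.subst (c ℕ.<_) (Vec.length-toList α) c<)))

module PlacticAlgebra (P : FinitePoset) (free : FinitePoset.ThreePlusOneFree P) where

  open FinitePoset P using (_<_; _<?_) renaming (Carrier to A)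
  open FreeAlgebra (FinitePoset._≟_ P) renaming (_≈_ to _≈ᶜ_; _+_ to _+ᵖ_; _*_ to _*ᵖ_; _-_ to _-ᵖ_; 1# to 1ᵖ; 0# to 0ᵖ)
  open Quotient (FinitePoset._≟_ P) (PlacticGenerator P) using (quotientRing; ~-from-≡; congruent; ·-*ˡ)

  plactic : PlacticMap P quotientRing
  plactic = record
    { u        = u
    ; plactic₁ = λ p q r → congruent (generator (plac₁ p q r))
    ; plactic₂ = λ p q r → congruent (generator (plac₂ p q r))
    ; plactic₃ = λ p q r → congruent (generator (plac₃ p q r))
    }

  open Ring quotientRing renaming (Carrier to K) hiding (zero)
  open PlacticRing P free quotientRing plactic hiding (A; _∼_)
  open Determinants quotientRing
  open PermutationSums quotientRing
  open import Relation.Binary.Reasoning.Setoid setoid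

  decreasing-in? : {S : Pred A 0ℓ} → Decidable S → ∀ {k} (w : Vec A k) → Dec (Linked (λ a b → b < a) w × VAll.All S w)
  decreasing-in? S? w = linked? (λ a b → b <? a) w ×-dec VAll.all? S? w

  -- The first letter is the largest, so in a lower ideal it brings all others with it; what remains
  -- is a decreasing word below a, as in the recursion of `E`.
  decreasing-∷ : ∀ {S : Pred A 0ℓ} (S? : Decidable S) → (∀ {a b} → a < b → S b → S a) →
    ∀ {k} a (w : Vec A k) → does (decreasing-in? S? (a ∷ w)) ≡ does (S? a) ∧ does (decreasing-in? (_<? a) w)
  decreasing-∷ {S} S? lower a w =
    does-⇔ (mk⇔ (λ (l , s) → VAll.head s , split l) (λ (s , l , b) → join l b , s ∷ VAll.map (λ b<a → lower b<a s) b))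
      (decreasing-in? S? (a ∷ w)) (S? a ×-dec decreasing-in? (_<? a) w)
    where
    Decreasing : ∀ {k} → Vec A k → Set
    Decreasing = Linked (λ a b → b < a)
    split : ∀ {k a} {w : Vec A k} → Decreasing (a ∷ w) → Decreasing w × VAll.All (_< a) w
    split [-]                = [] , []
    split {w = b ∷ w} (b<a ∷ l) = l , b<a ∷ VAll.map (λ c<b → ≺-trans c<b b<a) (proj₂ (split l))
    join : ∀ {k a} {w : Vec A k} → Decreasing w → VAll.All (_< a) w → Decreasing (a ∷ w)
    join []  []        = [-]
    join [-] (b<a ∷ _) = b<a ∷ [-]
    join (l ∷ ls) (b<a ∷ _) = b<a ∷ l ∷ ls

  sum-decreasing : ∀ k {S : Pred A 0ℓ} (S? : Decidable S) → (∀ {a b} → a < b → S b → S a) →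
    sum (vectors elements k) (λ w → guard (does (decreasing-in? S? w)) (mono (toList w))) ≈ E k (λ a → does (S? a))
  sum-decreasing zero    S? lower = +-identityʳ _
  sum-decreasing (suc k) S? lower = trans (sum-cartesianProduct _∷_ elements (vectors elements k) _)
    (sum-cong elements λ a → begin
      sum (vectors elements k) (λ w → guard (does (decreasing-in? S? (a ∷ w))) (mono (a ∷ toList w)))
        ≈⟨ sum-cong (vectors elements k) (λ w → reflexive
             (≡.cong (λ b → guard b (mono (a ∷ toList w))) (decreasing-∷ S? lower a w))) ⟩
      sum (vectors elements k) (λ w → guard (does (S? a) ∧ does (decreasing-in? (_<? a) w)) (mono (a ∷ toList w)))
        ≈⟨ factor a (does (S? a)) ⟩
      guard (does (S? a)) (u a * sum (vectors elements k) (λ w → guard (does (decreasing-in? (_<? a) w)) (mono (toList w))))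
        ≈⟨ guard-cong (does (S? a)) (*-congˡ {u a} (sum-decreasing k (_<? a) ≺-trans)) ⟩
      guard (does (S? a)) (u a * E k (↓ a))
        ∎)
    where
    factor : ∀ a b →
      sum (vectors elements k) (λ w → guard (b ∧ does (decreasing-in? (_<? a) w)) (mono (a ∷ toList w))) ≈
      guard b (u a * sum (vectors elements k) (λ w → guard (does (decreasing-in? (_<? a) w)) (mono (toList w))))
    factor a true  = sym (trans (sum-*ˡ (vectors elements k) (u a) _)
      (sum-cong (vectors elements k) λ w → guard-*ˡ (does (decreasing-in? (_<? a) w)) (u a) (mono (toList w))))
    factor a false = sum-zero (vectors elements k) λ _ → refl

  e≈Eᶻ : ∀ j {S : Pred A 0ℓ} (S? : Decidable S) → (∀ {a b} → a < b → S b → S a) →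
         e P j S? ≈ Eᶻ j (λ a → does (S? a))
  e≈Eᶻ (+ k)    S? lower = trans (sum-filter _ (vectors elements k) _) (sum-decreasing k S? lower)
  e≈Eᶻ -[1+ _ ] S? lower = refl

  signed : ∀ n f → (-1ℤ ℤ.^ n) · f ≈ act (parity n) f
  signed zero    f = trans (~-from-≡ (≡.trans (≡.cong (1ℤ ·_) (≡.sym (Quotient.*-identityˡ _≟_ (PlacticGenerator P) f)))
                                              (≡.sym (·-*ˡ 1ℤ 1ᵖ f)))) (*-identityˡ f)
  signed (suc n) f = begin
    (-1ℤ ℤ.* -1ℤ ℤ.^ n) · f    ≈⟨ ~-from-≡
        (≡.trans (List.map-cong (λ (d , w) → ≡.cong (_, w) (ℤ.*-assoc -1ℤ (-1ℤ ℤ.^ n) d)) f) (List.map-∘ f)) ⟩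
    - ((-1ℤ ℤ.^ n) · f)        ≈⟨ -‿cong (signed n f) ⟩
    - act (parity n) f         ≈⟨ act-minus (parity n) f ⟨
    act (minus ∙ parity n) f   ∎

  signed-permutation : ∀ {ℓ} (v : Vec (Fin ℓ) ℓ) (unique? : Dec (VUnique.Unique v)) f →
    guard (does unique?) (sgn v · f) ≈ act (ε (letters v)) f
  signed-permutation v (yes unique) f = trans (signed (length (inversions v)) f)
    (reflexive (≡.cong (λ s → act s f) (≡.sym (ε-inversions-parity v unique))))
  signed-permutation v (no ¬unique) f with ε (letters v) in eq
  ... | plus  = ⊥-elim (¬unique (unique-from-ε v (λ eq′ → case-≢ (≡.trans (≡.sym eq) eq′))))
    where case-≢ : ¬ (plus ≡ null)
          case-≢ ()
  ... | null  = refl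
  ... | minus = ⊥-elim (¬unique (unique-from-ε v (λ eq′ → case-≢ (≡.trans (≡.sym eq) eq′))))
    where case-≢ : ¬ (minus ≡ null)
          case-≢ ()

  -- Letters are unconstrained here. Separating the enumeration from the tableau conditions makes
  -- the sum independent of the order of the boxes.
  sumEnv : List (ℕ × ℕ) → Env → (Env → K) → K
  sumEnv []             σ F = F σ
  sumEnv ((c , r) ∷ bs) σ F = sum elements λ t → sumEnv bs (assign σ c r t) F

  Avoids : ℕ → ℕ → List (ℕ × ℕ) → Set
  Avoids c r = LAll.All (λ b → b ≢ (c , r))

  sumEnv-cong : ∀ bs σ {F G : Env → K} →
    (∀ σ′ → (∀ c r → Avoids c r bs → σ′ c r ≡ σ c r) → F σ′ ≈ G σ′) → sumEnv bs σ F ≈ sumEnv bs σ G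
  sumEnv-cong []             σ F≈G = F≈G σ (λ _ _ _ → ≡.refl)
  sumEnv-cong ((c , r) ∷ bs) σ F≈G = sum-cong elements λ t → sumEnv-cong bs (assign σ c r t)
    λ σ′ agree → F≈G σ′ λ { c′ r′ (b≢ ∷ avoids) → ≡.trans (agree c′ r′ avoids) (assign-other t b≢) }
    where
    assign-other : ∀ t {c′ r′} → (c , r) ≢ (c′ , r′) → assign σ c r t c′ r′ ≡ σ c′ r′
    assign-other t {c′} {r′} b≢ with c′ ℕ.≟ c
    ... | no  c′≢c  = assign-column σ c r t r′ c′≢c
    ... | yes ≡.refl = assign-row σ c r t c (λ { ≡.refl → b≢ ≡.refl })

  sumEnv-*ˡ : ∀ bs σ y F → y * sumEnv bs σ F ≈ sumEnv bs σ (λ σ′ → y * F σ′)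
  sumEnv-*ˡ []             σ y F = refl
  sumEnv-*ˡ ((c , r) ∷ bs) σ y F = trans (sum-*ˡ elements y _)
    (sum-cong elements λ t → sumEnv-*ˡ bs (assign σ c r t) y F)

  sumEnv-guard : ∀ bs σ b F → guard b (sumEnv bs σ F) ≈ sumEnv bs σ (λ σ′ → guard b (F σ′))
  sumEnv-guard bs             σ true  F = refl
  sumEnv-guard []             σ false F = refl
  sumEnv-guard ((c , r) ∷ bs) σ false F = sym (sum-zero elements λ t → sym (sumEnv-guard bs (assign σ c r t) false F))

  infix 4 _≗ᵉ_
  _≗ᵉ_ : Env → Env → Set
  σ ≗ᵉ ρ = ∀ c r → σ c r ≡ ρ c r

  -- Assigning letters in another order gives a function that agrees only pointwise, so reordering
  -- is justified under summands that respect pointwise equality.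
  Extensional : (Env → K) → Set
  Extensional F = ∀ σ ρ → σ ≗ᵉ ρ → F σ ≈ F ρ

  assign-≗ : ∀ {σ ρ} c r t → σ ≗ᵉ ρ → assign σ c r t ≗ᵉ assign ρ c r t
  assign-≗ c r t σ≗ρ c′ r′ = ≡.cong (λ x → if does (c′ ℕ.≟ c) ∧ does (r′ ℕ.≟ r) then just t else x) (σ≗ρ c′ r′)

  sumEnv-≗ : ∀ bs {F} → Extensional F → Extensional (λ σ → sumEnv bs σ F)
  sumEnv-≗ []             ext σ ρ σ≗ρ = ext σ ρ σ≗ρ
  sumEnv-≗ ((c , r) ∷ bs) ext σ ρ σ≗ρ = sum-cong elements λ t → sumEnv-≗ bs ext _ _ (assign-≗ c r t σ≗ρ)

  sumEnv-↭ : ∀ {bs bs′} → bs ↭ bs′ → ∀ {F} → Extensional F → ∀ σ → sumEnv bs σ F ≈ sumEnv bs′ σ F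
  sumEnv-↭ ↭.refl                ext σ = refl
  sumEnv-↭ (↭.prep (c , r) p)    ext σ = sum-cong elements λ t → sumEnv-↭ p ext (assign σ c r t)
  sumEnv-↭ (↭.trans p q)         ext σ = trans (sumEnv-↭ p ext σ) (sumEnv-↭ q ext σ)
  sumEnv-↭ {bs′ = _ ∷ _ ∷ bs′} (↭.swap (c , r) (c′ , r′) p) {F} ext σ with ≡-dec ℕ._≟_ ℕ._≟_ (c , r) (c′ , r′)
  -- If the two boxes coincide, swapping them changes nothing in the list; the assignments
  -- themselves would not commute, as the later one wins.
  ... | yes ≡.refl = sum-cong elements λ t → sum-cong elements λ t′ → sumEnv-↭ p ext _
  ... | no  b≢b′   = trans
    (sum-cong elements λ t → sum-cong elements λ t′ → trans (sumEnv-↭ p ext _) (sumEnv-≗ bs′ ext _ _ (commuted t t′)))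
    (sum-swap elements elements _)
    where
    hit : ∀ {c r x y} → does (x ℕ.≟ c) ∧ does (y ℕ.≟ r) ≡ true → (c , r) ≡ (x , y)
    hit {c} {r} {x} {y} eq with x ℕ.≡ᵇ c | ℕ.≡ᵇ⇒≡ x c | y ℕ.≡ᵇ r | ℕ.≡ᵇ⇒≡ y r
    ... | true | x≡c | true | y≡r = ≡.cong₂ _,_ (≡.sym (x≡c tt)) (≡.sym (y≡r tt))
    if-swap : ∀ a b {x y z : Maybe A} → ¬ (a ≡ true × b ≡ true) →
              (if a then x else (if b then y else z)) ≡ (if b then y else (if a then x else z))
    if-swap true  true  both = ⊥-elim (both (≡.refl , ≡.refl))
    if-swap true  false both = ≡.refl
    if-swap false true  both = ≡.refl
    if-swap false false both = ≡.refl
    commuted : ∀ t t′ → assign (assign σ c r t) c′ r′ t′ ≗ᵉ assign (assign σ c′ r′ t′) c r t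
    commuted t t′ x y = if-swap (does (x ℕ.≟ c′) ∧ does (y ℕ.≟ r′)) (does (x ℕ.≟ c) ∧ does (y ℕ.≟ r))
      λ (p , q) → b≢b′ (≡.trans (hit {c} {r} {x} {y} q) (≡.sym (hit {c′} {r′} {x} {y} p)))

  -- Fillings as assignments of letters to boxes

  Column : Set
  Column = ℕ → Maybe A

  consColumn : Maybe A → Column → Column
  consColumn x f zero    = x
  consColumn x f (suc r) = f r

  vecColumn : ∀ {k} → Vec A k → Column
  vecColumn []      = λ _ → nothing
  vecColumn (x ∷ v) = consColumn (just x) (vecColumn v)

  assignColumn : Column → ℕ → A → Column
  assignColumn f r t r′ = if does (r′ ℕ.≟ r) then just t else f r′

  consEnv : Column → Env → Env
  consEnv f σ zero    = f
  consEnv f σ (suc c) = σ c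

  emptyEnv : Env
  emptyEnv _ _ = nothing

  sumColumn : List ℕ → Column → (Column → K) → K
  sumColumn []       f F = F f
  sumColumn (r ∷ rs) f F = sum elements λ t → sumColumn rs (assignColumn f r t) F

  ColumnExtensional : (Column → K) → Set
  ColumnExtensional F = ∀ f g → (∀ r → f r ≡ g r) → F f ≈ F g

  sumColumn-≗ : ∀ rs {F} → ColumnExtensional F → ColumnExtensional (λ f → sumColumn rs f F)
  sumColumn-≗ []       ext f g f≗g = ext f g f≗g
  sumColumn-≗ (r ∷ rs) ext f g f≗g = sum-cong elements λ t → sumColumn-≗ rs ext _ _
    λ r′ → ≡.cong (λ x → if does (r′ ℕ.≟ r) then just t else x) (f≗g r′)

  consColumn-≗ : ∀ x {f g : Column} → (∀ r → f r ≡ g r) → ∀ r → consColumn x f r ≡ consColumn x g r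
  consColumn-≗ x f≗g zero    = ≡.refl
  consColumn-≗ x f≗g (suc r) = f≗g r

  sumColumn-shift : ∀ rs x f {F} → ColumnExtensional F →
    sumColumn (List.map suc rs) (consColumn x f) F ≈ sumColumn rs f (F ∘ consColumn x)
  sumColumn-shift []       x f ext = refl
  sumColumn-shift (r ∷ rs) x f ext = sum-cong elements λ t → trans
    (sumColumn-≗ (List.map suc rs) ext _ _ λ { zero → ≡.refl ; (suc r′) → ≡.refl })
    (sumColumn-shift rs x (assignColumn f r t) ext)

  sum-vecColumns : ∀ k {F} → ColumnExtensional F →
    sum (vectors elements k) (F ∘ vecColumn) ≈ sumColumn (range k) (λ _ → nothing) F
  sum-vecColumns zero    ext = +-identityʳ _
  sum-vecColumns (suc k) {F} ext = trans (sum-cartesianProduct _∷_ elements (vectors elements k) _)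
    (sum-cong elements λ t → begin
      sum (vectors elements k) (λ v → F (consColumn (just t) (vecColumn v)))
        ≈⟨ sum-vecColumns k (λ f g f≗g → ext _ _ (consColumn-≗ (just t) f≗g)) ⟩
      sumColumn (range k) (λ _ → nothing) (F ∘ consColumn (just t))
        ≈⟨ sumColumn-shift (range k) (just t) (λ _ → nothing) ext ⟨
      sumColumn (List.map suc (range k)) (consColumn (just t) (λ _ → nothing)) F
        ≈⟨ sumColumn-≗ (List.map suc (range k)) ext _ _ (λ { zero → ≡.refl ; (suc r) → ≡.refl }) ⟩
      sumColumn (List.map suc (range k)) (assignColumn (λ _ → nothing) 0 t) F
        ∎)

  sumEnv-firstColumn : ∀ rs bs f σ {F} → Extensional F →
    sumEnv (List.map (0 ,_) rs ++ bs) (consEnv f σ) F ≈ sumColumn rs f (λ g → sumEnv bs (consEnv g σ) F)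
  sumEnv-firstColumn []       bs f σ ext = refl
  sumEnv-firstColumn (r ∷ rs) bs f σ ext = sum-cong elements λ t → trans
    (sumEnv-≗ (List.map (0 ,_) rs ++ bs) ext _ _ λ { zero r′ → ≡.refl ; (suc c) r′ → ≡.refl })
    (sumEnv-firstColumn rs bs (assignColumn f r t) σ ext)

  sumEnv-shift : ∀ bs f σ {F} → Extensional F →
    sumEnv (List.map shift bs) (consEnv f σ) F ≈ sumEnv bs σ (F ∘ consEnv f)
  sumEnv-shift []             f σ ext = refl
  sumEnv-shift ((c , r) ∷ bs) f σ ext = sum-cong elements λ t → trans
    (sumEnv-≗ (List.map shift bs) ext _ _ λ { zero r′ → ≡.refl ; (suc c′) r′ → ≡.refl })
    (sumEnv-shift bs f (assign σ c r t) ext)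

  env : ∀ {ℓ} {α : Vec ℕ ℓ} → Filling A α → Env
  env []      = emptyEnv
  env (v ∷ T) = consEnv (vecColumn v) (env T)

  sum-fillings : ∀ {ℓ} (α : Vec ℕ ℓ) {F} → Extensional F →
    sum (fillings elements α) (F ∘ env) ≈ sumEnv (columnBoxes (toList α)) emptyEnv F
  sum-fillings []      ext = +-identityʳ _
  sum-fillings (k ∷ α) {F} ext = begin
    sum (fillings elements (k ∷ α)) (F ∘ env)
      ≈⟨ sum-cartesianProduct _∷_ (vectors elements k) (fillings elements α) _ ⟩
    sum (vectors elements k) (λ v → sum (fillings elements α) (λ T → F (consEnv (vecColumn v) (env T))))
      ≈⟨ sum-cong (vectors elements k) (λ v → trans
           (sum-fillings α (λ σ ρ σ≗ρ → ext _ _ λ { zero r → ≡.refl ; (suc c) r → σ≗ρ c r }))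
           (sym (sumEnv-shift (columnBoxes (toList α)) (vecColumn v) emptyEnv ext))) ⟩
    sum (vectors elements k) (λ v → sumEnv bs (consEnv (vecColumn v) emptyEnv) F)
      ≈⟨ sum-vecColumns k (λ f g f≗g → sumEnv-≗ bs ext _ _ λ { zero r → f≗g r ; (suc c) r → ≡.refl }) ⟩
    sumColumn (range k) (λ _ → nothing) (λ f → sumEnv bs (consEnv f emptyEnv) F)
      ≈⟨ sumEnv-firstColumn (range k) bs (λ _ → nothing) emptyEnv ext ⟨
    sumEnv (List.map (0 ,_) (range k) ++ bs) (consEnv (λ _ → nothing) emptyEnv) F
      ≈⟨ sumEnv-≗ (List.map (0 ,_) (range k) ++ bs) ext _ _ (λ { zero r → ≡.refl ; (suc c) r → ≡.refl }) ⟩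
    sumEnv (columnBoxes (k ∷ toList α)) emptyEnv F
      ∎
    where bs = List.map shift (columnBoxes (toList α))

  module Environments (α : ℕ → ℕ) (α-anti : ∀ c → α (suc c) ℕ.≤ α c) (Z : ℕ → SubsetOf)
    (Z-lower : ∀ c → Lower (Z c)) (Z-mono : ∀ c → Z c ⊆ Z (suc c)) where

    open Diagonals α α-anti Z Z-lower Z-mono public

    untouched-tabulate : ∀ k c (G : Fin k → ℕ → K) →
      (∀ j p → untouched (toℕ j ℕ.+ c) (toℕ j ℕ.+ c) p ≈ G j p) → untouched-rows c c k ≋ tabulate G
    untouched-tabulate zero    c G eq = []
    untouched-tabulate (suc k) c G eq = eq Fin.zero ∷ untouched-tabulate k (suc c) (G ∘ Fin.suc)
      (λ j p → trans (reflexive (≡.cong (λ i → untouched i i p) (ℕ.+-suc (toℕ j) c))) (eq (Fin.suc j) p))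

    allowed : Env → ℕ × ℕ → Bool
    allowed σ (c , r) = maybe (bound σ c (suc r) ∖ left-bound σ c r) false (σ c r)

    all-allowed : List (ℕ × ℕ) → Env → Bool
    all-allowed []       σ = true
    all-allowed (b ∷ bs) σ = allowed σ b ∧ all-allowed bs σ

    reading : List (ℕ × ℕ) → Env → K
    reading []             σ = 1#
    reading ((c , r) ∷ bs) σ = maybe u 1# (σ c r) * reading bs σ

    weight : List (ℕ × ℕ) → Env → K
    weight bs σ = guard (all-allowed bs σ) (reading bs σ)

    -- The test of a letter can wait until all boxes are filled: the box itself and its neighbours
    -- below and to the left are not among the later boxes.
    tableaux≈sumEnv : ∀ bs σ → LAllPairs.AllPairs Later bs → tableaux bs σ ≈ sumEnv bs σ (weight bs)
    tableaux≈sumEnv []             σ []              = refl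
    tableaux≈sumEnv ((c , r) ∷ bs) σ (later ∷ pairs) = sum-cong elements λ t → begin
      guard (X t) (u t * tableaux bs (assign σ c r t))
        ≈⟨ guard-cong (X t) (*-congˡ {u t} (tableaux≈sumEnv bs (assign σ c r t) pairs)) ⟩
      guard (X t) (u t * sumEnv bs (assign σ c r t) (weight bs))
        ≈⟨ guard-cong (X t) (sumEnv-*ˡ bs (assign σ c r t) (u t) (weight bs)) ⟩
      guard (X t) (sumEnv bs (assign σ c r t) (λ σ′ → u t * weight bs σ′))
        ≈⟨ sumEnv-guard bs (assign σ c r t) (X t) _ ⟩
      sumEnv bs (assign σ c r t) (λ σ′ → guard (X t) (u t * weight bs σ′))
        ≈⟨ sumEnv-cong bs (assign σ c r t) (step t) ⟩
      sumEnv bs (assign σ c r t) (weight ((c , r) ∷ bs))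
        ∎
      where
      X : A → Bool
      X = bound σ c (suc r) ∖ left-bound σ c r
      module _ (t : A) (σ′ : Env) (agree : ∀ c′ r′ → Avoids c′ r′ bs → σ′ c′ r′ ≡ assign σ c r t c′ r′) where
        here≡ : σ′ c r ≡ just t
        here≡ = ≡.trans (agree c r (LAll.map distinct later)) (assign-here σ c r t)
          where
          distinct : ∀ {b} → Later (c , r) b → b ≢ (c , r)
          distinct (inj₁ lt)       ≡.refl = ℕ.<-irrefl ≡.refl lt
          distinct (inj₂ (_ , lt)) ≡.refl = ℕ.<-irrefl ≡.refl lt
        below≡ : σ′ c (suc r) ≡ σ c (suc r)
        below≡ = ≡.trans (agree c (suc r) (LAll.map distinct later)) (assign-row σ c r t c ℕ.1+n≢n)
          where
          distinct : ∀ {b} → Later (c , r) b → b ≢ (c , suc r)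
          distinct (inj₁ lt)       ≡.refl = ℕ.<⇒≱ lt (ℕ.+-monoʳ-≤ c (ℕ.n≤1+n r))
          distinct (inj₂ (_ , lt)) ≡.refl = ℕ.<-irrefl ≡.refl lt
        left≡ : ∀ c₀ → c ≡ suc c₀ → σ′ c₀ r ≡ σ c₀ r
        left≡ c₀ ≡.refl = ≡.trans (agree c₀ r (LAll.map distinct later)) (assign-column σ c r t r (ℕ.<⇒≢ (ℕ.n<1+n c₀)))
          where
          distinct : ∀ {b} → Later (c , r) b → b ≢ (c₀ , r)
          distinct (inj₁ lt)       ≡.refl = ℕ.<⇒≱ lt (ℕ.n≤1+n _)
          distinct (inj₂ (_ , lt)) ≡.refl = ℕ.<⇒≱ lt (ℕ.n≤1+n _)
        left-bound≡ : ∀ c₀ → c ≡ c₀ → left-bound σ′ c₀ r ≡ left-bound σ c₀ r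
        left-bound≡ zero     c≡ = ≡.refl
        left-bound≡ (suc c₀) c≡ = bound-cong σ′ σ c₀ r (left≡ c₀ c≡)
        allowed≡ : allowed σ′ (c , r) ≡ X t
        allowed≡ = ≡.trans (≡.cong (maybe (bound σ′ c (suc r) ∖ left-bound σ′ c r) false) here≡)
          (≡.cong₂ (λ Y Y′ → (Y ∖ Y′) t) (bound-cong σ′ σ c (suc r) below≡) (left-bound≡ c ≡.refl))
        step : guard (X t) (u t * weight bs σ′) ≈ weight ((c , r) ∷ bs) σ′
        step = begin
          guard (X t) (u t * guard (all-allowed bs σ′) (reading bs σ′))
            ≈⟨ guard-cong (X t) (guard-*ˡ (all-allowed bs σ′) (u t) (reading bs σ′)) ⟩
          guard (X t) (guard (all-allowed bs σ′) (u t * reading bs σ′))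
            ≈⟨ reflexive (guard-∧ (X t) (all-allowed bs σ′) _) ⟩
          guard (X t ∧ all-allowed bs σ′) (u t * reading bs σ′)
            ≈⟨ reflexive (≡.cong₂ (λ b x → guard (b ∧ all-allowed bs σ′) (maybe u 1# x * reading bs σ′))
                 (≡.sym allowed≡) (≡.sym here≡)) ⟩
          weight ((c , r) ∷ bs) σ′
            ∎
          where
          guard-∧ : ∀ a b x → guard a (guard b x) ≡ guard (a ∧ b) x
          guard-∧ true  b x = ≡.refl
          guard-∧ false b x = ≡.refl

    weight-cong : ∀ bs σ ρ → (∀ c r → σ c r ≡ ρ c r) → weight bs σ ≡ weight bs ρ
    weight-cong bs σ ρ σ≡ρ = ≡.cong₂ guard (allowed≡ bs) (reading≡ bs)
      where
      left≡ : ∀ c r → left-bound σ c r ≡ left-bound ρ c r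
      left≡ zero    r = ≡.refl
      left≡ (suc c) r = bound-cong σ ρ c r (σ≡ρ c r)
      allowed≡ : ∀ bs → all-allowed bs σ ≡ all-allowed bs ρ
      allowed≡ []             = ≡.refl
      allowed≡ ((c , r) ∷ bs) = ≡.cong₂ _∧_
        (≡.trans (≡.cong₂ (λ Y Y′ → maybe (Y ∖ Y′) false (σ c r)) (bound-cong σ ρ c (suc r) (σ≡ρ c (suc r))) (left≡ c r))
                 (≡.cong (maybe (bound ρ c (suc r) ∖ left-bound ρ c r) false) (σ≡ρ c r)))
        (allowed≡ bs)
      reading≡ : ∀ bs → reading bs σ ≡ reading bs ρ
      reading≡ []             = ≡.refl
      reading≡ ((c , r) ∷ bs) = ≡.cong₂ _*_ (≡.cong (maybe u 1#) (σ≡ρ c r)) (reading≡ bs)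

  -- Beyond the last column all of P is taken, which keeps the sequence one of nested lower ideals.
  ideal-at : ∀ {k} → (Fin k → SubsetOf) → ℕ → SubsetOf
  ideal-at {zero}  Y c       = λ _ → true
  ideal-at {suc k} Y zero    = Y Fin.zero
  ideal-at {suc k} Y (suc c) = ideal-at (Y ∘ Fin.suc) c

  ideal-at-toℕ : ∀ {k} (Y : Fin k → SubsetOf) i → ideal-at Y (toℕ i) ≡ Y i
  ideal-at-toℕ Y Fin.zero    = ≡.refl
  ideal-at-toℕ Y (Fin.suc i) = ideal-at-toℕ (Y ∘ Fin.suc) i

  ideal-at-lower : ∀ {k} (Y : Fin k → SubsetOf) → (∀ i → Lower (Y i)) → ∀ c → Lower (ideal-at Y c)
  ideal-at-lower {zero}  Y lower c       = λ _ _ → ≡.refl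
  ideal-at-lower {suc k} Y lower zero    = lower Fin.zero
  ideal-at-lower {suc k} Y lower (suc c) = ideal-at-lower (Y ∘ Fin.suc) (lower ∘ Fin.suc) c

  ideal-at-mono : ∀ {k} (Y : Fin k → SubsetOf) → (∀ i j → i Fin.≤ j → Y i ⊆ Y j) →
                  ∀ c → ideal-at Y c ⊆ ideal-at Y (suc c)
  ideal-at-mono {zero}        Y mono c       = λ a∈ → a∈
  ideal-at-mono {suc zero}    Y mono zero    = λ _ → ≡.refl
  ideal-at-mono {suc (suc k)} Y mono zero    = mono Fin.zero (Fin.suc Fin.zero) ℕ.z≤n
  ideal-at-mono {suc k}       Y mono (suc c) =
    ideal-at-mono (Y ∘ Fin.suc) (λ i j i≤j → mono (Fin.suc i) (Fin.suc j) (ℕ.s≤s i≤j)) c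

  vecColumn-lookup : ∀ {k} (v : Vec A k) i → vecColumn v (toℕ i) ≡ just (lookup v i)
  vecColumn-lookup (x ∷ v) Fin.zero    = ≡.refl
  vecColumn-lookup (x ∷ v) (Fin.suc i) = vecColumn-lookup v i

  env-column : ∀ {ℓ} {α : Vec ℕ ℓ} (T : Filling A α) c r → env T (toℕ c) r ≡ vecColumn (column T c) r
  env-column (v ∷ T) Fin.zero    r = ≡.refl
  env-column (v ∷ T) (Fin.suc c) r = env-column T c r

  env-entry : ∀ {ℓ} {α : Vec ℕ ℓ} (T : Filling A α) c r → env T (toℕ c) (toℕ r) ≡ just (entry T (c , r))
  env-entry T c r = ≡.trans (env-column T c (toℕ r)) (vecColumn-lookup (column T c) r)

  next : ∀ {k} → Vec A k → SubsetOf → ℕ → SubsetOf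
  next {k} v Y r = if does (r ℕ.<? k) then ↓? (vecColumn v r) else Y

  does⁻ : {S : Set} (S? : Dec S) → does S? ≡ true → S
  does⁻ (yes s) _ = s

  -- Only the bottom entry is tested against S; the others are below it, and S is a lower ideal.
  column⁺ : ∀ {k} {S : Pred A 0ℓ} (S? : Decidable S) → (∀ {a b} → a < b → S b → S a) → (v : Vec A k) →
    (∀ i → lookup v i ∈ next v (λ a → does (S? a)) (suc (toℕ i))) → Linked _<_ v × VAll.All S v
  column⁺ S? lower []          ok = [] , []
  column⁺ S? lower (x ∷ [])    ok = [-] , does⁻ (S? x) (ok Fin.zero) ∷ []
  column⁺ S? lower (x ∷ y ∷ v) ok =
    let l , s = column⁺ S? lower (y ∷ v) (ok ∘ Fin.suc)
        x<y   = ↓⁻ (ok Fin.zero)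
    in x<y ∷ l , lower x<y (VAll.head s) ∷ s

  column⁻ : ∀ {k} {S : Pred A 0ℓ} (S? : Decidable S) (v : Vec A k) → Linked _<_ v → VAll.All S v →
    ∀ i → lookup v i ∈ next v (λ a → does (S? a)) (suc (toℕ i))
  column⁻ S? (x ∷ [])    l s Fin.zero    = dec-true (S? x) (VAll.head s)
  column⁻ S? (x ∷ y ∷ v) l s Fin.zero    = ↓⁺ (Linked.head l)
  column⁻ S? (x ∷ y ∷ v) l s (Fin.suc i) = column⁻ S? (y ∷ v) (Linked.tail l) (VAll.tail s) i

  module Shape {ℓ} (α : Vec ℕ ℓ) (partition : IsPartition α)
    (Z : Fin ℓ → Pred A 0ℓ) (Z? : ∀ i → Decidable (Z i))
    (lower : ∀ i → FinitePoset.IsLowerIdeal P (Z i))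
    (nested : ∀ i j → i Fin.≤ j → ∀ {a} → Z i a → Z j a) where

    J≈det : J P α Z? ≈ det (tabulate λ i p → Eᶻ (lookup α i ℕ.+ p ⊖ toℕ i) (λ a → does (Z? i a)))
    J≈det = begin
      J P α Z?
        ≈⟨ sum-filter _ (vectors (allFin ℓ) ℓ) _ ⟩
      sum (vectors (allFin ℓ) ℓ) _
        ≈⟨ sum-cong (vectors (allFin ℓ) ℓ) (λ v → signed-permutation v (VAllPairs.allPairs? (λ i j → ¬? (i Fin.≟ j)) v) _) ⟩
      sum (vectors (allFin ℓ) ℓ) (λ v → act (ε (letters v)) (prod (allFin ℓ) λ i → F i (toℕ (lookup v i))))
        ≈⟨ sum-vectors ℓ ℓ F ε ⟩
      expansion ℓ (tabulate F) ε
        ≈⟨ reflexive (≡.cong (λ n → expansion n (tabulate F) ε) (List.length-tabulate F)) ⟨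
      det (tabulate F)
        ≈⟨ det-cong (Pointwise.tabulate⁺ (λ i p → trans
             (e≈Eᶻ (+ lookup α i ℤ.+ + p ℤ.- + toℕ i) (Z? i) (lower i))
             (reflexive (≡.cong (λ j → Eᶻ j (λ a → does (Z? i a))) (ℤ.m-n≡m⊖n (lookup α i ℕ.+ p) (toℕ i)))))) ⟩
      det (tabulate λ i p → Eᶻ (lookup α i ℕ.+ p ⊖ toℕ i) (λ a → does (Z? i a)))
        ∎
      where
      F : Fin ℓ → ℕ → K
      F i p = e P (+ lookup α i ℤ.+ + p ℤ.- + toℕ i) (Z? i)

    Zᵇ : Fin ℓ → SubsetOf
    Zᵇ i a = does (Z? i a)

    Zᵇ-lower : ∀ i → Lower (Zᵇ i)
    Zᵇ-lower i {a} {b} a≺b b∈ = dec-true (Z? i a) (lower i a≺b (does⁻ (Z? i b) b∈))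

    Zᵇ-mono : ∀ i j → i Fin.≤ j → Zᵇ i ⊆ Zᵇ j
    Zᵇ-mono i j i≤j {a} a∈ = dec-true (Z? j a) (nested i j i≤j (does⁻ (Z? i a) a∈))

    open Environments (at α) (at-anti α partition) (ideal-at Zᵇ) (ideal-at-lower Zᵇ Zᵇ-lower) (ideal-at-mono Zᵇ Zᵇ-mono)

    word-order : List (ℕ × ℕ)
    word-order = order-from (at α) ℓ (suc (height α))

    bound-next : ∀ (T : Filling A α) c r → bound (env {α = α} T) (toℕ c) r ≡ next (column T c) (Zᵇ c) r
    bound-next T c r = ≡.trans
      (≡.cong₂ (λ n x → if does (r ℕ.<? n) then ↓? x else ideal-at Zᵇ (toℕ c)) (at-toℕ α c) (env-column T c r))
      (≡.cong (λ Y → if does (r ℕ.<? lookup α c) then ↓? (vecColumn (column T c) r) else Y) (ideal-at-toℕ Zᵇ c))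

    bound-entry : ∀ (T : Filling A α) c r → bound (env {α = α} T) (toℕ c) (toℕ r) ≡ ↓ (entry T (c , r))
    bound-entry T c r = ≡.trans
      (bound-inside (env {α = α} T) (≡.subst (toℕ r ℕ.<_) (≡.sym (at-toℕ α c)) (Fin.toℕ<n r)))
      (≡.cong ↓? (env-entry T c r))

    box-allowed : Filling A α → Box α → Set
    box-allowed T (c , r) = entry T (c , r) ∈ bound (env {α = α} T) (toℕ c) (suc (toℕ r)) × entry T (c , r) ∉ left-bound
        (env {α = α} T) (toℕ c) (toℕ r)

    allowed⁻ : ∀ (T : Filling A α) b → allowed (env {α = α} T) (toℕ² α b) ≡ true → box-allowed T b
    allowed⁻ T (c , r) eq = ∖⁻ {entry T (c , r)} (bound (env {α = α} T) (toℕ c) (suc (toℕ r)))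
        (left-bound (env {α = α} T) (toℕ c) (toℕ r))
      (≡.trans (≡.cong (maybe _ false) (≡.sym (env-entry T c r))) eq)

    allowed⁺ : ∀ (T : Filling A α) b → box-allowed T b → allowed (env {α = α} T) (toℕ² α b) ≡ true
    allowed⁺ T (c , r) (p , q) = ≡.trans (≡.cong (maybe _ false) (env-entry T c r))
      (∖⁺ {entry T (c , r)} (bound (env {α = α} T) (toℕ c) (suc (toℕ r))) (left-bound (env {α = α} T) (toℕ c) (toℕ r)) p q)

    ssyt-allowed : ∀ (T : Filling A α) → IsSSYT P α Z T → ∀ b → box-allowed T b
    ssyt-allowed T (ssyt increasing noDescent inZ) (c , r) =
      ≡.subst (entry T (c , r) ∈_) (≡.sym (bound-next T c (suc (toℕ r))))
        (column⁻ (Z? c) (column T c) (increasing c) (inZ c) r) ,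
      left (toℕ c) ≡.refl
      where
      left : ∀ m → toℕ c ≡ m → entry T (c , r) ∉ left-bound (env {α = α} T) m (toℕ r)
      left zero    eq = ≡.refl
      left (suc m) eq = ≡.subst₂ (λ c₀ r₀ → entry T (c , r) ∉ bound (env {α = α} T) c₀ r₀) (Fin.toℕ-fromℕ< m<ℓ)
          (Fin.toℕ-fromℕ< r<)
        (≡.subst (entry T (c , r) ∉_) (≡.sym (bound-entry T c₀ r₀))
          (∉↓⁺ (noDescent c₀ c r₀ r (≡.trans eq (≡.cong suc (≡.sym (Fin.toℕ-fromℕ< m<ℓ)))) (≡.sym (Fin.toℕ-fromℕ< r<)))))
        where
        m<ℓ : m ℕ.< ℓ
        m<ℓ = ℕ.<-trans (ℕ.n<1+n m) (≡.subst (ℕ._< ℓ) eq (Fin.toℕ<n c))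
        c₀ = Fin.fromℕ< m<ℓ
        c₀≤c : c₀ Fin.≤ c
        c₀≤c = ≡.subst₂ ℕ._≤_ (≡.sym (Fin.toℕ-fromℕ< m<ℓ)) (≡.sym eq) (ℕ.n≤1+n m)
        -- The left neighbour is a box of the diagram since the heights decrease weakly.
        r< : toℕ r ℕ.< lookup α c₀
        r< = ℕ.<-≤-trans (Fin.toℕ<n r) (partition c₀ c c₀≤c)
        r₀ = Fin.fromℕ< r<

    allowed-ssyt : ∀ (T : Filling A α) → (∀ b → box-allowed T b) → IsSSYT P α Z T
    allowed-ssyt T ok = ssyt (λ c → proj₁ (columns c)) noDescent (λ c → proj₂ (columns c))
      where
      columns : ∀ c → Linked _<_ (column T c) × VAll.All (Z c) (column T c)
      columns c = column⁺ (Z? c) (lower c) (column T c) λ r →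
        ≡.subst (entry T (c , r) ∈_) (bound-next T c (suc (toℕ r))) (proj₁ (ok (c , r)))
      noDescent : ∀ c c′ r r′ → toℕ c′ ≡ suc (toℕ c) → toℕ r′ ≡ toℕ r → ¬ (entry T (c′ , r′) < entry T (c , r))
      noDescent c c′ r r′ c′≡ r′≡ = ∉↓⁻ (≡.subst (entry T (c′ , r′) ∉_)
        (≡.trans (≡.cong₂ (left-bound (env {α = α} T)) c′≡ r′≡) (bound-entry T c r)) (proj₂ (ok (c′ , r′))))

    all-allowed⁻ : ∀ bs σ → all-allowed bs σ ≡ true → LAll.All (λ b → allowed σ b ≡ true) bs
    all-allowed⁻ []       σ _  = []
    all-allowed⁻ (b ∷ bs) σ eq with allowed σ b in eq′
    ... | true = eq′ ∷ all-allowed⁻ bs σ eq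

    all-allowed⁺ : ∀ bs σ → LAll.All (λ b → allowed σ b ≡ true) bs → all-allowed bs σ ≡ true
    all-allowed⁺ []       σ []       = ≡.refl
    all-allowed⁺ (b ∷ bs) σ (p ∷ ps) = ≡.cong₂ _∧_ p (all-allowed⁺ bs σ ps)

    ∈-word-order : ∀ b → toℕ² α b ∈ˡ word-order
    ∈-word-order (c , r) = ↭.∈-resp-↭ (↭-sym (order-↭ α partition))
      (≡.subst (toℕ² α (c , r) ∈ˡ_) (map-toℕ²-boxes α) (Membership.∈-map⁺ (toℕ² α)
        (Membership.∈-concat⁺′ (Membership.∈-map⁺ (c ,_) (Membership.∈-allFin r))
          (Membership.∈-map⁺ (λ c → List.map (c ,_) (allFin (lookup α c))) (Membership.∈-allFin c)))))

    isSSYT-allowed : ∀ (T : Filling A α) → does (isSSYT? P α Z? T) ≡ all-allowed word-order (env {α = α} T)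
    isSSYT-allowed T = ≡.trans
      (does-⇔ (mk⇔ to from) (isSSYT? P α Z? T) (all-allowed word-order (env {α = α} T) Bool.≟ true))
      (does-≟ (all-allowed word-order (env {α = α} T)))
      where
      does-≟ : ∀ b → does (b Bool.≟ true) ≡ b
      does-≟ true  = ≡.refl
      does-≟ false = ≡.refl
      to : IsSSYT P α Z T → all-allowed word-order (env {α = α} T) ≡ true
      to T-ssyt = all-allowed⁺ word-order (env {α = α} T) (≡.subst (LAll.All _) (reading-order≡ α partition)
        (LAll.map⁺ (LAll.universal (λ b → allowed⁺ T b (ssyt-allowed T T-ssyt b)) (reading-order α))))
      from : all-allowed word-order (env {α = α} T) ≡ true → IsSSYT P α Z T
      from eq = allowed-ssyt T λ b → allowed⁻ T b (LAll.lookup (all-allowed⁻ word-order (env {α = α} T) eq) (∈-word-order b))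

    diagword-reading : ∀ (T : Filling A α) → mono (diagword {α = α} T) ≡ reading word-order (env {α = α} T)
    diagword-reading T = ≡.trans
      (≡.cong mono (≡.sym (List.map-concatMap (entry {α = α} T) (diagonal α) (diagonals α))))
      (≡.trans (go (reading-order α)) (≡.cong (λ bs → reading bs (env {α = α} T)) (reading-order≡ α partition)))
      where
      go : ∀ bs → mono (List.map (entry {α = α} T) bs) ≡ reading (List.map (toℕ² α) bs) (env {α = α} T)
      go []             = ≡.refl
      go ((c , r) ∷ bs) = ≡.cong₂ (λ x y → maybe u 1# x * y) (≡.sym (env-entry T c r)) (go bs)

    J≈tableaux : J P α Z? ≈ tableaux word-order emptyEnv
    J≈tableaux = begin
      J P α Z?
        ≈⟨ J≈det ⟩
      det (tabulate λ i p → Eᶻ (lookup α i ℕ.+ p ⊖ toℕ i) (Zᵇ i))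
        ≈⟨ det-cong (untouched-tabulate ℓ 0 _ (λ i p → reflexive (≡.trans
             (≡.cong (λ j → untouched j j p) (ℕ.+-identityʳ (toℕ i)))
             (≡.cong₂ (λ n Y → Eᶻ (n ℕ.+ p ⊖ toℕ i) Y) (at-toℕ α i) (ideal-at-toℕ Zᵇ i))))) ⟨
      det (untouched-rows 0 0 ℓ)
        -- One more than the height is the right start: at the height itself, a first column of that
        -- height would already count as reached.
        ≈⟨ reflexive (≡.cong det (rows-untouched emptyEnv (suc (height α)) 0 0 (suc (height α)) ℓ (ℕ.s≤s (at≤height α 0)))) ⟨
      det (rows emptyEnv (suc (height α)) 0 0 (suc (height α)) ℓ)
        ≈⟨ det-tableaux (suc (height α)) ℓ emptyEnv
             (invariant-outside emptyEnv ∅ 0 (suc (height α)) ℓ (ℕ.m≤n⇒m≤1+n (at≤height α 0)) (λ ())) ⟩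
      tableaux word-order emptyEnv
        ∎

    J≈∑SSYT : J P α Z? ≈ ∑ (SSYT P α Z?) (λ (T : Filling A α) → mono (diagword {α = α} T))
    J≈∑SSYT = begin
      J P α Z?
        ≈⟨ J≈tableaux ⟩
      tableaux word-order emptyEnv
        ≈⟨ tableaux≈sumEnv word-order emptyEnv (order-from-later (at α) ℓ (suc (height α))) ⟩
      sumEnv word-order emptyEnv (weight word-order)
        ≈⟨ sumEnv-↭ (order-↭ α partition) extensional emptyEnv ⟩
      sumEnv (columnBoxes (toList α)) emptyEnv (weight word-order)
        ≈⟨ sum-fillings α extensional ⟨
      sum (fillings elements α) (λ (T : Filling A α) → weight word-order (env {α = α} T))
        ≈⟨ sum-cong (fillings elements α)
            (λ (T : Filling A α) → reflexive (≡.cong₂ guard (isSSYT-allowed T) (diagword-reading T))) ⟨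
      sum (fillings elements α) (λ (T : Filling A α) → guard (does (isSSYT? P α Z? T)) (mono (diagword {α = α} T)))
        ≈⟨ sum-filter (isSSYT? P α Z?) (fillings elements α) _ ⟨
      ∑ (SSYT P α Z?) (λ (T : Filling A α) → mono (diagword {α = α} T))
        ∎
      where
      extensional : Extensional (weight word-order)
      extensional σ ρ σ≗ρ = reflexive (weight-cong word-order σ ρ σ≗ρ)

open import Relation.Unary using (_⊆_)

mainTheorem16 : (P : FinitePoset) → let open FinitePoset P in let open FreeAlgebra _≟_ in
    ThreePlusOneFree →
    ∀ {ℓ} (α : Vec ℕ ℓ) → IsPartition α →
    (Z : Fin ℓ → Pred Carrier 0ℓ) (Z? : ∀ i → Decidable (Z i)) →
    (∀ i → IsLowerIdeal (Z i)) →
    (∀ i j → i Fin.≤ j → Z i ⊆ Z j) →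
    J P α Z? ≡ ∑ (SSYT P α Z?) (λ T → mono (diagword T)) [mod I-plac P ]
mainTheorem16 P free α partition Z Z? lower nested =
  Quotient._~_.difference
    (PlacticAlgebra.Shape.J≈∑SSYT P free α partition Z Z? lower (λ i j i≤j → nested i j i≤j))
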